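{- Let $\mathcal X$ be an antisymmetric cyclotomic scheme over a finite field. Then $gb(\mathcal X)\le 1$ and $b(\mathcal X)\le 3$.
   Context: A coherent configuration on a finite set $\Omega$ is a pair $\mathcal X=(\Omega,S)$ where $S$ is a partition of $\Omega\times\Omega$ such that $1_\Omega$ is a union of elements of $S$, $s^*=\{(\beta,\alpha):(\alpha,\beta)\in s\}\in S$ for $s\in S$, and for $r,s,t\in S$ the number $|\{\gamma:(\alpha,\gamma)\in r,(\gamma,\beta)\in s\}|$ is independent of $(\alpha,\beta)\in t$; fibers are sets $\Gamma$ with $1_\Gamma\in S$. It is antisymmetric if every $s\in S$ with $s=s^*$ lies in $1_\Omega$. A fission is a finer coherent configuration (its relation set, i.e. unions of basic relations, contains that of $\mathcal X$); complete means all basic relations are singletons. For $\Pi\subseteq 2^\Omega$ the $\Pi$-fission is the smallest fission in which every member of $\Pi$ is a union of fibers; $\Pi$ is a generalized base if the $\Pi$-fission is complete, and a set $B\subseteq\Omega$ is a base if $\{\{\beta\}:\beta\in B\}$ is a generalized base; $gb(\mathcal X)$, $b(\mathcal X)$ are the minimum sizes. For a finite field $\mathbb F$ and a subgroup $K$ of $\mathbb F^\times$, the cyclotomic scheme over $\mathbb F$ is $\mathrm{Inv}(G)$ with $G=\{x\mapsto ax+b: a\in K, b\in\mathbb F\}\le\mathrm{AGL}(1,\mathbb F)$, where $\mathrm{Inv}(G)=(\mathbb F,\text{orbits of }G\text{ on }\mathbb F\times\mathbb F)$. -}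

module Defs where

open import Algebra.Bundles using (CommutativeRing)
open import Data.Bool.Base using (Bool; true; false)
import Data.Bool.Properties as Bool
open import Data.Fin.Base using (Fin; zero; suc; combine; remQuot)
import Data.Fin.Permutation as Perm
open import Data.Fin.Permutation using (Permutation′; _⟨$⟩ʳ_; _⟨$⟩ˡ_; _∘ₚ_)
open import Data.Fin.Properties using (_≟_; any?; all?; remQuot-combine; combine-injective; combine-surjective)
open import Data.Fin.Subset using (Subset; _∈_; _∉_; _⊆_; ⊤; ⁅_⁆; ⋃; ∣_∣; Nonempty)
open import Data.Fin.Subset.Properties using (_∈?_; _⊆?_; nonempty?; anySubset?; ⊆-antisym; ∉⊥; ∈⊤; x∈⁅x⁆; x∈⁅y⁆⇒x≡y; p⊆p∪q; q⊆p∪q; x∈p∪q⁻)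
open import Data.List.Base using (List; []; _∷_; map; filter; allFin; length)
import Data.List.Membership.Propositional as List
import Data.List.Relation.Unary.Any as Any
open import Data.List.Membership.Propositional.Properties using (∈-map⁺; ∈-filter⁺; ∈-allFin)
open import Data.List.Relation.Unary.All as All using (All; []; _∷_)
open import Data.List.Relation.Unary.Unique.Propositional using (Unique)
import Data.List.Relation.Unary.Unique.DecPropositional as DecUnique
import Data.List.Relation.Unary.Unique.Propositional.Properties as Unique
open import Data.Nat.Base using (ℕ; zero; suc; _*_; _≤_; z≤n; s≤s)
import Data.Nat.Properties as ℕ
open import Data.Product.Base using (Σ; ∃; ∃₂; _×_; _,_; proj₁; proj₂)
open import Data.Sum.Base using (inj₁; inj₂)
import Data.Vec.Base as Vec
open import Data.Vec.Base using (Vec; []; _∷_; lookup; tabulate; toList; fromList)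
open import Data.Vec.Properties using ([]=⇒lookup; lookup⇒[]=; lookup∘tabulate; tabulate-cong; ≡-dec; length-toList; toList∘fromList)
open import Algebra.Properties.CommutativeMonoid.Sum ℕ.+-0-commutativeMonoid using (sum; sum-permute)
open import Function.Base using (_∘_; case_of_)
open import Function.Bundles using (Inverse)
open import Level using (Level; 0ℓ; _⊔_) renaming (suc to lsuc)
open import Relation.Binary.PropositionalEquality using (_≡_; refl; sym; trans; cong; cong₂; subst; setoid; module ≡-Reasoning)
open import Relation.Nullary using (¬_; Dec; yes; no; does; contradiction)
open import Relation.Nullary.Decidable using (map′; _×-dec_; _→-dec_; ¬?; decidable-stable; dec-true; dec-false)
open import Relation.Unary using (Pred; Decidable)

private
  variable
    k n : ℕ
    p : Level

------------------------------------------------------------------------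
-- Subsets of Fin k

subsetOf : {P : Pred (Fin k) p} → Decidable P → Subset k
subsetOf P? = tabulate (does ∘ P?)

∈-subsetOf⁺ : {P : Pred (Fin k) p} (P? : Decidable P) {x : Fin k} → P x → x ∈ subsetOf P?
∈-subsetOf⁺ P? {x} px =
  lookup⇒[]= x (subsetOf P?) (trans (lookup∘tabulate (does ∘ P?) x) (dec-true (P? x) px))

∈-subsetOf⁻ : {P : Pred (Fin k) p} (P? : Decidable P) {x : Fin k} → x ∈ subsetOf P? → P x
∈-subsetOf⁻ P? {x} x∈ with P? x in eq
... | yes px = px
... | no _ with trans (sym ([]=⇒lookup x∈)) (trans (lookup∘tabulate (does ∘ P?) x) (cong does eq))
...   | ()

IsUnionOf : Pred (Subset k) p → Pred (Subset k) p
IsUnionOf S r = ∃ λ T → All S T × r ≡ ⋃ T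

record IsPartition (S : Pred (Subset k) p) : Set p where
  field
    nonempty : ∀ {s} → S s → Nonempty s
    covering : ∀ x → ∃ λ s → S s × x ∈ s
    disjoint : ∀ {s t x} → S s → S t → x ∈ s → x ∈ t → s ≡ t

elements : Subset k → List (Fin k)
elements B = filter (_∈? B) (allFin _)

------------------------------------------------------------------------
-- Binary relations on Fin n, as subsets of Fin n × Fin n ≅ Fin (n * n).
-- The square is opaque so that n can be inferred from a relation.

opaque
  square : ℕ → ℕ
  square n = n * n

  pair : Fin n → Fin n → Fin (square n)
  pair = combine

  unpair : Fin (square n) → Fin n × Fin n
  unpair {n} = remQuot {n} n

  unpair-pair : (α β : Fin n) → unpair (pair α β) ≡ (α , β)
  unpair-pair = remQuot-combine

  pair-injective : {α β α′ β′ : Fin n} → pair α β ≡ pair α′ β′ → α ≡ α′ × β ≡ β′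
  pair-injective = combine-injective _ _ _ _

  pair-surjective : (x : Fin (square n)) → ∃₂ λ α β → pair α β ≡ x
  pair-surjective {n} = combine-surjective {n} {n}

Relation : ℕ → Set
Relation n = Subset (square n)

infix 4 _⟨_,_⟩
_⟨_,_⟩ : Relation n → Fin n → Fin n → Set
s ⟨ α , β ⟩ = pair α β ∈ s

relationOf : {R : Fin n → Fin n → Set p} → (∀ α β → Dec (R α β)) → Relation n
relationOf {n = n} R? =
  subsetOf (λ x → R? (proj₁ (unpair x)) (proj₂ (unpair x)))

infix 30 1[_]
1[_] : Subset n → Relation n
1[ Γ ] = relationOf (λ α β → (α ≟ β) ×-dec (α ∈? Γ))

infixl 30 _*ʳ
_*ʳ : Relation n → Relation n
s *ʳ = relationOf (λ α β → pair β α ∈? s)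

between : Relation n → Relation n → Fin n → Fin n → Subset n
between r s α β = subsetOf (λ γ → (pair α γ ∈? r) ×-dec (pair γ β ∈? s))

------------------------------------------------------------------------
-- Coherent configurations on Fin n

record IsCoherent (S : Pred (Relation n) 0ℓ) : Set where
  field
    isPartition : IsPartition S
    diagonal    : IsUnionOf S 1[ ⊤ ]
    converse    : ∀ {s} → S s → S (s *ʳ)
    regular     : ∀ {r s t} → S r → S s → S t →
                  ∀ {α β α′ β′} → t ⟨ α , β ⟩ → t ⟨ α′ , β′ ⟩ →
                  ∣ between r s α β ∣ ≡ ∣ between r s α′ β′ ∣

  open IsPartition isPartition public

record CoherentConfiguration (n : ℕ) : Set₁ where
  field
    S          : Pred (Relation n) 0ℓ
    isCoherent : IsCoherent S

  open IsCoherent isCoherent public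

open CoherentConfiguration using (S)

IsAntisymmetric : CoherentConfiguration n → Set
IsAntisymmetric X = ∀ {s} → S X s → s ≡ s *ʳ → s ⊆ 1[ ⊤ ]

IsComplete : CoherentConfiguration n → Set
IsComplete X = ∀ {s} → S X s → ∃ λ i → s ≡ ⁅ i ⁆

IsFiber : CoherentConfiguration n → Pred (Subset n) 0ℓ
IsFiber X Γ = S X 1[ Γ ]

IsRelationOf : CoherentConfiguration n → Pred (Relation n) 0ℓ
IsRelationOf X = IsUnionOf (S X)

-- X ⊑ Y : Y is a fission of X.
infix 4 _⊑_
_⊑_ : CoherentConfiguration n → CoherentConfiguration n → Set
X ⊑ Y = ∀ {r} → IsRelationOf X r → IsRelationOf Y r

-- A set Π of subsets is given by a list; its size is the length once the
-- list is required to have no repetitions.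
record IsΠFission (X : CoherentConfiguration n) (Π : List (Subset n))
                  (Y : CoherentConfiguration n) : Set₁ where
  field
    fission   : X ⊑ Y
    separates : All (IsUnionOf (IsFiber Y)) Π
    smallest  : ∀ {Z} → X ⊑ Z → All (IsUnionOf (IsFiber Z)) Π → Y ⊑ Z

IsGeneralizedBase : CoherentConfiguration n → Pred (List (Subset n)) (lsuc 0ℓ)
IsGeneralizedBase X Π = ∃ λ Y → IsΠFission X Π Y × IsComplete Y

IsBase : CoherentConfiguration n → Pred (Subset n) (lsuc 0ℓ)
IsBase X B = IsGeneralizedBase X (map ⁅_⁆ (elements B))

HasGeneralizedBaseOfSize : CoherentConfiguration n → Pred ℕ (lsuc 0ℓ)
HasGeneralizedBaseOfSize X k = ∃ λ Π → Unique Π × length Π ≡ k × IsGeneralizedBase X Π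

HasBaseOfSize : CoherentConfiguration n → Pred ℕ (lsuc 0ℓ)
HasBaseOfSize X k = ∃ λ B → ∣ B ∣ ≡ k × IsBase X B

IsMinimum : Pred ℕ p → Pred ℕ p
IsMinimum P k = P k × (∀ {j} → P j → k ≤ j)

------------------------------------------------------------------------
-- The minima gb and b.  Being a generalized base is decidable, and the set of
-- all points is a base, so both minima exist; they are characterised by
-- gb-isMinimum and b-isMinimum.

private
  minimum : {P : Pred ℕ p} → Decidable P → ∀ k → P k → ∃ (IsMinimum P)
  minimum P? zero    pk = 0 , pk , λ _ → z≤n
  minimum P? (suc k) pk with P? 0
  ... | yes p₀ = 0 , p₀ , λ _ → z≤n
  ... | no ¬p₀ with minimum (P? ∘ suc) k pk
  ...   | m , pm , m≤ = suc m , pm , λ { {zero} p₀ → contradiction p₀ ¬p₀ ; {suc j} pj → s≤s (m≤ pj) }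

  infix 4 _≟ₛ_
  _≟ₛ_ : (s t : Subset k) → Dec (s ≡ t)
  _≟ₛ_ = ≡-dec Bool._≟_

  allSubsets? : {P : Pred (Subset k) p} → Decidable P → Dec (∀ s → P s)
  allSubsets? P? with anySubset? (¬? ∘ P?)
  ... | yes (s , ¬ps) = no λ ∀p → ¬ps (∀p s)
  ... | no ¬∃         = yes λ s → decidable-stable (P? s) λ ¬ps → ¬∃ (s , ¬ps)

  anyVec? : ∀ {m} {P : Pred (Vec (Subset k) m) p} → Decidable P → Dec (∃ P)
  anyVec? {m = zero}  P? = map′ (λ q → [] , q) (λ { ([] , q) → q }) (P? [])
  anyVec? {m = suc m} P? =
    map′ (λ { (x , xs , q) → (x ∷ xs) , q }) (λ { ((x ∷ xs) , q) → x , xs , q })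
         (anySubset? λ x → anyVec? λ xs → P? (x ∷ xs))

  ⋃⁻ : {S : Pred (Subset k) p} (T : List (Subset k)) → All S T →
       ∀ {x} → x ∈ ⋃ T → ∃ λ s → S s × x ∈ s × s ⊆ ⋃ T
  ⋃⁻ []      []         x∈ = contradiction x∈ ∉⊥
  ⋃⁻ (t ∷ T) (st ∷ sT) x∈ with x∈p∪q⁻ t (⋃ T) x∈
  ... | inj₁ x∈t = t , st , x∈t , p⊆p∪q (⋃ T)
  ... | inj₂ x∈T with ⋃⁻ T sT x∈T
  ...   | s , ss , x∈s , s⊆ = s , ss , x∈s , λ y∈s → q⊆p∪q t (⋃ T) (s⊆ y∈s)

Pointwise : Pred (Subset k) p → Pred (Subset k) p
Pointwise S r = ∀ {x} → x ∈ r → ∃ λ s → S s × x ∈ s × s ⊆ r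

isUnionOf⇒pointwise : {S : Pred (Subset k) p} {r : Subset k} → IsUnionOf S r → Pointwise S r
isUnionOf⇒pointwise (T , sT , refl) = ⋃⁻ T sT

pointwise⇒isUnionOf : {S : Pred (Subset k) p} {r : Subset k} → Pointwise S r → IsUnionOf S r
pointwise⇒isUnionOf {k = k} {S = S} {r} pw with go (allFin k)
  where
  go : (xs : List (Fin k)) → ∃ λ T → All S T × ⋃ T ⊆ r × (∀ {x} → x List.∈ xs → x ∈ r → x ∈ ⋃ T)
  go [] = [] , [] , (λ x∈ → contradiction x∈ ∉⊥) , λ ()
  go (y ∷ ys) with go ys | y ∈? r
  ... | T , sT , T⊆ , c | no y∉ =
    T , sT , T⊆ , λ { (Any.here refl) x∈r → contradiction x∈r y∉ ; (Any.there x∈) → c x∈ }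
  ... | T , sT , T⊆ , c | yes y∈ with pw y∈
  ...   | s , ss , y∈s , s⊆ =
    s ∷ T , ss ∷ sT
    , (λ x∈ → case x∈p∪q⁻ s (⋃ T) x∈ of λ { (inj₁ q) → s⊆ q ; (inj₂ q) → T⊆ q })
    , λ { (Any.here refl) _ → p⊆p∪q (⋃ T) y∈s ; (Any.there x∈) x∈r → q⊆p∪q s (⋃ T) (c x∈ x∈r) }
... | T , sT , T⊆ , c = T , sT , ⊆-antisym (λ {x} → c (∈-allFin x)) T⊆

∈-relationOf⁺ : {R : Fin n → Fin n → Set p} (R? : ∀ α β → Dec (R α β)) {α β : Fin n} →
                R α β → relationOf R? ⟨ α , β ⟩
∈-relationOf⁺ {n = n} {R = R} R? {α} {β} r =
  ∈-subsetOf⁺ (λ x → R? (proj₁ (unpair x)) (proj₂ (unpair x)))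
    (subst (λ q → R (proj₁ q) (proj₂ q)) (sym (unpair-pair α β)) r)

∈-relationOf⁻ : {R : Fin n → Fin n → Set p} (R? : ∀ α β → Dec (R α β)) {α β : Fin n} →
                relationOf R? ⟨ α , β ⟩ → R α β
∈-relationOf⁻ {n = n} {R = R} R? {α} {β} r =
  subst (λ q → R (proj₁ q) (proj₂ q)) (unpair-pair α β)
    (∈-subsetOf⁻ (λ x → R? (proj₁ (unpair x)) (proj₂ (unpair x))) r)

relation-ext : {r s : Relation n} → (∀ {α β} → r ⟨ α , β ⟩ → s ⟨ α , β ⟩) →
               (∀ {α β} → s ⟨ α , β ⟩ → r ⟨ α , β ⟩) → r ≡ s
relation-ext {n = n} {r} {s} f g = ⊆-antisym (lift f) (lift g)
  where
  lift : {r s : Relation n} → (∀ {α β} → r ⟨ α , β ⟩ → s ⟨ α , β ⟩) → r ⊆ s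
  lift h {x} x∈ with pair-surjective x
  ... | α , β , refl = h x∈

∈-1⁺ : {Γ : Subset n} {α : Fin n} → α ∈ Γ → 1[ Γ ] ⟨ α , α ⟩
∈-1⁺ {Γ = Γ} α∈ = ∈-relationOf⁺ (λ α β → (α ≟ β) ×-dec (α ∈? Γ)) (refl , α∈)

∈-1⁻ : {Γ : Subset n} {α β : Fin n} → 1[ Γ ] ⟨ α , β ⟩ → α ≡ β × α ∈ Γ
∈-1⁻ {Γ = Γ} = ∈-relationOf⁻ (λ α β → (α ≟ β) ×-dec (α ∈? Γ))

∈-*ʳ⁺ : {s : Relation n} {α β : Fin n} → s ⟨ β , α ⟩ → (s *ʳ) ⟨ α , β ⟩
∈-*ʳ⁺ {s = s} = ∈-relationOf⁺ (λ α β → pair β α ∈? s)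

∈-*ʳ⁻ : {s : Relation n} {α β : Fin n} → (s *ʳ) ⟨ α , β ⟩ → s ⟨ β , α ⟩
∈-*ʳ⁻ {s = s} = ∈-relationOf⁻ (λ α β → pair β α ∈? s)

∈-between⁺ : {r s : Relation n} {α β γ : Fin n} → r ⟨ α , γ ⟩ → s ⟨ γ , β ⟩ → γ ∈ between r s α β
∈-between⁺ {r = r} {s} {α} {β} p q =
  ∈-subsetOf⁺ (λ γ → (pair α γ ∈? r) ×-dec (pair γ β ∈? s)) (p , q)

∈-between⁻ : {r s : Relation n} {α β γ : Fin n} → γ ∈ between r s α β → r ⟨ α , γ ⟩ × s ⟨ γ , β ⟩
∈-between⁻ {r = r} {s} {α} {β} =
  ∈-subsetOf⁻ (λ γ → (pair α γ ∈? r) ×-dec (pair γ β ∈? s))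

singleton⁻ : {α β α′ β′ : Fin n} → ⁅ pair α β ⁆ ⟨ α′ , β′ ⟩ → α′ ≡ α × β′ ≡ β
singleton⁻ q = pair-injective (x∈⁅y⁆⇒x≡y _ q)

nonempty⊆⁅⁆ : {s : Subset k} {x : Fin k} → x ∈ s → s ⊆ ⁅ x ⁆ → s ≡ ⁅ x ⁆
nonempty⊆⁅⁆ {s = s} x∈s s⊆ =
  ⊆-antisym s⊆ λ y∈ → subst (_∈ s) (sym (x∈⁅y⁆⇒x≡y _ y∈)) x∈s

discrete : ∀ n → CoherentConfiguration n
discrete n = record
  { S = λ s → ∃ λ i → s ≡ ⁅ i ⁆
  ; isCoherent = record
    { isPartition = record
      { nonempty = λ { (i , refl) → i , x∈⁅x⁆ i }
      ; covering = λ x → ⁅ x ⁆ , (x , refl) , x∈⁅x⁆ x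
      ; disjoint = λ { (i , refl) (j , refl) x∈ x∈′ →
          cong ⁅_⁆ (trans (sym (x∈⁅y⁆⇒x≡y i x∈)) (x∈⁅y⁆⇒x≡y j x∈′)) }
      }
    ; diagonal = pointwise⇒isUnionOf λ {x} x∈ →
        ⁅ x ⁆ , (x , refl) , x∈⁅x⁆ x , λ y∈ → subst (_∈ 1[ ⊤ ]) (sym (x∈⁅y⁆⇒x≡y x y∈)) x∈
    ; converse = λ { (i , refl) → conv i }
    ; regular = λ { {r} {s} _ _ (i , refl) p q →
        let e = pair-injective (trans (x∈⁅y⁆⇒x≡y i p) (sym (x∈⁅y⁆⇒x≡y i q)))
        in cong₂ (λ α β → ∣ between r s α β ∣) (proj₁ e) (proj₂ e) }
    }
  }
  where
  conv : ∀ i → ∃ λ j → ⁅ i ⁆ *ʳ ≡ ⁅ j ⁆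
  conv i with pair-surjective i
  ... | α , β , refl = pair β α , relation-ext
    (λ q → case singleton⁻ (∈-*ʳ⁻ {s = ⁅ pair α β ⁆} q) of λ { (refl , refl) → x∈⁅x⁆ _ })
    (λ q → case singleton⁻ q of λ { (refl , refl) → ∈-*ʳ⁺ {s = ⁅ pair α β ⁆} (x∈⁅x⁆ _) })

module _ {X : CoherentConfiguration n} {Π : List (Subset n)} where

  isGeneralizedBase⇒complete :
    IsGeneralizedBase X Π →
    ∀ Z → X ⊑ Z → All (IsUnionOf (IsFiber Z)) Π → IsComplete Z
  isGeneralizedBase⇒complete (Y , isF , cY) Z X⊑Z sep {s} ss with Z.nonempty ss
    where module Z = CoherentConfiguration Z
  ... | x , x∈s with CoherentConfiguration.covering Y x
  ...   | t , tt , x∈t with cY tt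
  ...     | i , refl with isUnionOf⇒pointwise (IsΠFission.smallest isF {Z} X⊑Z sep
                          {⁅ i ⁆} (⁅ i ⁆ ∷ [] , tt ∷ [] , ⊆-antisym (p⊆p∪q _)
                             (λ y∈ → case x∈p∪q⁻ ⁅ i ⁆ _ y∈ of
                                λ { (inj₁ q) → q ; (inj₂ q) → contradiction q ∉⊥ }))) x∈t
  ...       | s′ , ss′ , x∈s′ , s′⊆ with CoherentConfiguration.disjoint Z ss ss′ x∈s x∈s′ | x∈⁅y⁆⇒x≡y i x∈t
  ...         | refl | refl = i , nonempty⊆⁅⁆ x∈s s′⊆

  complete⇒isGeneralizedBase :
    (∀ Z → X ⊑ Z → All (IsUnionOf (IsFiber Z)) Π → IsComplete Z) →
    IsGeneralizedBase X Π
  complete⇒isGeneralizedBase h = discrete _ , record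
    { fission   = λ _ → union
    ; separates = All.universal (λ Γ → pointwise⇒isUnionOf λ {α} α∈ →
        ⁅ α ⁆ , (pair α α , fiber α) , x∈⁅x⁆ α
        , λ y∈ → subst (_∈ Γ) (sym (x∈⁅y⁆⇒x≡y α y∈)) α∈) Π
    ; smallest  = λ {Z} X⊑Z sep _ → pointwise⇒isUnionOf λ {x} x∈ → cell Z (h Z X⊑Z sep) x∈
    } , λ ss → ss
    where
    union : {r : Relation n} → IsRelationOf (discrete n) r
    union {r} = pointwise⇒isUnionOf λ {x} x∈ →
      ⁅ x ⁆ , (x , refl) , x∈⁅x⁆ x , λ y∈ → subst (_∈ r) (sym (x∈⁅y⁆⇒x≡y x y∈)) x∈
    fiber : (α : Fin n) → 1[ ⁅ α ⁆ ] ≡ ⁅ pair α α ⁆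
    fiber α = relation-ext
      (λ q → case ∈-1⁻ q of λ { (refl , e) → case x∈⁅y⁆⇒x≡y α e of λ { refl → x∈⁅x⁆ _ } })
      (λ q → case singleton⁻ q of λ { (refl , refl) → ∈-1⁺ (x∈⁅x⁆ α) })
    cell : ∀ Z → IsComplete Z → ∀ {r : Relation n} {x} → x ∈ r → ∃ λ s → S Z s × x ∈ s × s ⊆ r
    cell Z cZ {r} {x} x∈ with CoherentConfiguration.covering Z x
    ... | s , ss , x∈s with cZ ss
    ...   | i , refl = ⁅ i ⁆ , ss , x∈s , λ y∈ →
            subst (_∈ r) (trans (x∈⁅y⁆⇒x≡y i x∈s) (sym (x∈⁅y⁆⇒x≡y i y∈))) x∈

S? : (X : CoherentConfiguration n) → Decidable (S X)
S? X s with nonempty? s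
... | no ¬ne = no λ ss → ¬ne (CoherentConfiguration.nonempty X ss)
... | yes (x , x∈s) with CoherentConfiguration.covering X x
...   | t , tt , x∈t with s ≟ₛ t
...     | yes refl = yes tt
...     | no s≢t   = no λ ss → s≢t (CoherentConfiguration.disjoint X ss tt x∈s x∈t)

private
  isUnionOf? : {S : Pred (Subset k) p} → Decidable S → Decidable (IsUnionOf S)
  isUnionOf? {S = S} S? r =
    map′ (λ f → pointwise⇒isUnionOf λ {x} → f x) (λ u x → isUnionOf⇒pointwise u)
      (all? λ x → (x ∈? r) →-dec anySubset? λ s → S? s ×-dec (x ∈? s) ×-dec (s ⊆? r))

  isPartition? : {S : Pred (Subset k) p} → Decidable S → Dec (IsPartition S)
  isPartition? {S = S} S? =
    map′ (λ { (f , g , h) → record { nonempty = f _ ; covering = g ; disjoint = λ a b c d → h _ _ a b _ c d } })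
         (λ P → let open IsPartition P in (λ _ → nonempty) , covering , λ _ _ a b x c d → disjoint a b c d)
      ((allSubsets? λ s → S? s →-dec nonempty? s)
       ×-dec (all? λ x → anySubset? λ s → S? s ×-dec (x ∈? s))
       ×-dec (allSubsets? λ s → allSubsets? λ t → S? s →-dec (S? t →-dec
                all? λ x → (x ∈? s) →-dec ((x ∈? t) →-dec (s ≟ₛ t)))))

  isCoherent? : {S : Pred (Relation n) 0ℓ} → Decidable S → Dec (IsCoherent S)
  isCoherent? {S = S} S? =
    map′ (λ { (a , b , c , d) → record
              { isPartition = a ; diagonal = b ; converse = c _
              ; regular = λ x y z p q → d _ _ _ x y z _ _ _ _ p q } })
         (λ C → let open IsCoherent C in
            isPartition , diagonal , (λ _ → converse) , λ _ _ _ x y z _ _ _ _ p q → regular x y z p q)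
      (isPartition? S? ×-dec isUnionOf? S? 1[ ⊤ ]
       ×-dec (allSubsets? λ s → S? s →-dec S? (s *ʳ))
       ×-dec (allSubsets? λ r → allSubsets? λ s → allSubsets? λ t →
                S? r →-dec (S? s →-dec (S? t →-dec
                all? λ α → all? λ β → all? λ α′ → all? λ β′ →
                  (pair α β ∈? t) →-dec ((pair α′ β′ ∈? t) →-dec
                  (∣ between r s α β ∣ ℕ.≟ ∣ between r s α′ β′ ∣)))))
      )

  isComplete? : (X : CoherentConfiguration n) → Dec (IsComplete X)
  isComplete? X = map′ (λ f {s} → f s) (λ f s → f {s}) (allSubsets? λ s → S? X s →-dec any? λ i → s ≟ₛ ⁅ i ⁆)

  ⊑? : (X Y : CoherentConfiguration n) → Dec (X ⊑ Y)
  ⊑? X Y = map′ (λ f {r} → f r) (λ f r → f {r}) (allSubsets? λ r → isUnionOf? (S? X) r →-dec isUnionOf? (S? Y) r)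

  isUnionOf-mono : {S T : Pred (Subset k) 0ℓ} → (∀ {s} → S s → T s) →
                   ∀ {r} → IsUnionOf S r → IsUnionOf T r
  isUnionOf-mono f (L , sL , e) = L , All.map f sL , e

  -- Every coherent configuration has, as its set of basic relations, the set
  -- of entries of a vector listing the class of each pair; so the search over
  -- all configurations is a finite one.
  Entries : ∀ {m} → Vec (Subset k) m → Pred (Subset k) 0ℓ
  Entries v s = ∃ λ i → s ≡ lookup v i

  entries? : ∀ {m} (v : Vec (Subset k) m) → Decidable (Entries v)
  entries? v s = any? λ i → s ≟ₛ lookup v i

  module _ (X : CoherentConfiguration n) (Π : List (Subset n)) where

    Refutes : CoherentConfiguration n → Set
    Refutes Z = X ⊑ Z × All (IsUnionOf (IsFiber Z)) Π × ¬ IsComplete Z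

    refutes? : ∀ Z → Dec (Refutes Z)
    refutes? Z = ⊑? X Z ×-dec All.all? (isUnionOf? (S? Z ∘ 1[_])) Π ×-dec ¬? (isComplete? Z)

    Coded : Vec (Relation n) (square n) → Set
    Coded v = Σ (IsCoherent (Entries v)) λ C → Refutes (record { S = Entries v ; isCoherent = C })

    coded? : Decidable Coded
    coded? v with isCoherent? (entries? v)
    ... | no ¬C = no (¬C ∘ proj₁)
    ... | yes C with refutes? (record { S = Entries v ; isCoherent = C })
    ...   | yes R = yes (C , R)
    ...   | no ¬R = no λ { (_ , R) → ¬R R }

    encode : ∀ Z → Refutes Z → ∃ Coded
    encode Z (X⊑Z , sep , ¬c) = v , coherent , (isUnionOf-mono from ∘ X⊑Z)
                              , All.map (isUnionOf-mono from) sep , λ c → ¬c (λ ss → c (from ss))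
      where
      module Z = CoherentConfiguration Z
      v = tabulate (proj₁ ∘ Z.covering)
      to : ∀ {s} → Entries v s → Z.S s
      to (i , refl) = subst Z.S (sym (lookup∘tabulate (proj₁ ∘ Z.covering) i))
                        (proj₁ (proj₂ (Z.covering i)))
      from : ∀ {s} → Z.S s → Entries v s
      from ss with Z.nonempty ss
      ... | x , x∈ = x , trans
        (Z.disjoint ss (proj₁ (proj₂ (Z.covering x))) x∈ (proj₂ (proj₂ (Z.covering x))))
        (sym (lookup∘tabulate (proj₁ ∘ Z.covering) x))
      coherent : IsCoherent (Entries v)
      coherent = record
        { isPartition = record
          { nonempty = Z.nonempty ∘ to
          ; covering = λ x → let (s , ss , x∈) = Z.covering x in s , from ss , x∈
          ; disjoint = λ a b → Z.disjoint (to a) (to b)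
          }
        ; diagonal = isUnionOf-mono from Z.diagonal
        ; converse = from ∘ Z.converse ∘ to
        ; regular = λ a b c → Z.regular (to a) (to b) (to c)
        }

isGeneralizedBase? : (X : CoherentConfiguration n) → Decidable (IsGeneralizedBase X)
isGeneralizedBase? X Π with anyVec? (coded? X Π)
... | yes (v , C , X⊑Z , sep , ¬c) = no λ gb → ¬c (isGeneralizedBase⇒complete gb (record { S = Entries v ; isCoherent = C }) X⊑Z sep)
... | no ¬∃ = yes (complete⇒isGeneralizedBase λ Z X⊑Z sep →
  decidable-stable (isComplete? Z) λ ¬c → ¬∃ (encode X Π Z (X⊑Z , sep , ¬c)))

private
  ∣p∣≢0 : {s : Subset k} → ¬ (∣ s ∣ ≡ 0) → Nonempty s
  ∣p∣≢0 {s = []} h = contradiction refl h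
  ∣p∣≢0 {s = true ∷ s} h = zero , Vec.here
  ∣p∣≢0 {s = false ∷ s} h with ∣p∣≢0 h
  ... | i , i∈ = suc i , Vec.there i∈

  ∣p∣≡0⇒∉ : {s : Subset k} {x : Fin k} → ∣ s ∣ ≡ 0 → x ∉ s
  ∣p∣≡0⇒∉ {s = false ∷ s} e (Vec.there x∈) = ∣p∣≡0⇒∉ e x∈

allPoints-complete : (Z : CoherentConfiguration n) → (∀ α → IsFiber Z ⁅ α ⁆) → IsComplete Z
allPoints-complete {n = n} Z fib {s} ss with CoherentConfiguration.nonempty Z ss
... | x , x∈ with pair-surjective x
...   | α , β , refl = pair α β , nonempty⊆⁅⁆ x∈ only
  where
  module Z = CoherentConfiguration Z
  left : ∀ {α′ β′} → s ⟨ α′ , β′ ⟩ → α′ ≡ α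
  left {α′} {β′} q with ∣p∣≢0 {s = between 1[ ⁅ α ⁆ ] s α′ β′}
      (λ e → ∣p∣≡0⇒∉ (trans (Z.regular (fib α) ss ss x∈ q) e) (∈-between⁺ {s = s} (∈-1⁺ (x∈⁅x⁆ α)) x∈))
  ... | γ , γ∈ = x∈⁅y⁆⇒x≡y α (proj₂ (∈-1⁻ (proj₁ (∈-between⁻ {s = s} γ∈))))
  right : ∀ {α′ β′} → s ⟨ α′ , β′ ⟩ → β′ ≡ β
  right {α′} {β′} q with ∣p∣≢0 {s = between s 1[ ⁅ β ⁆ ] α′ β′}
      (λ e → ∣p∣≡0⇒∉ (trans (Z.regular ss (fib β) ss x∈ q) e) (∈-between⁺ {r = s} x∈ (∈-1⁺ (x∈⁅x⁆ β))))
  ... | γ , γ∈ with ∈-1⁻ (proj₂ (∈-between⁻ {r = s} γ∈))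
  ...   | e , γ∈β = trans (sym e) (x∈⁅y⁆⇒x≡y β γ∈β)
  only : s ⊆ ⁅ pair α β ⁆
  only {y} y∈ with pair-surjective y
  ... | α′ , β′ , refl with left y∈ | right y∈
  ...   | refl | refl = x∈⁅x⁆ _

isBase-⊤ : (X : CoherentConfiguration n) → IsBase X ⊤
isBase-⊤ X = complete⇒isGeneralizedBase λ Z _ sep → allPoints-complete Z λ α →
  case isUnionOf⇒pointwise (All.lookup sep (∈-map⁺ ⁅_⁆ (∈-filter⁺ (_∈? ⊤) (∈-allFin α) ∈⊤))) (x∈⁅x⁆ α)
  of λ { (Γ , fΓ , α∈ , Γ⊆) → subst (IsFiber Z) (nonempty⊆⁅⁆ α∈ Γ⊆) fΓ }

hasGeneralizedBaseOfSize? : (X : CoherentConfiguration n) → Decidable (HasGeneralizedBaseOfSize X)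
hasGeneralizedBaseOfSize? X k =
  map′ (λ { (v , u , g) → toList v , u , length-toList v , g })
       (λ { (Π , u , refl , g) → fromList Π , subst Unique (sym (toList∘fromList Π)) u
                                , subst (IsGeneralizedBase X) (sym (toList∘fromList Π)) g })
    (anyVec? λ v → DecUnique.unique? _≟ₛ_ (toList v) ×-dec isGeneralizedBase? X (toList v))

hasBaseOfSize? : (X : CoherentConfiguration n) → Decidable (HasBaseOfSize X)
hasBaseOfSize? X k = anySubset? λ B → (∣ B ∣ ℕ.≟ k) ×-dec isGeneralizedBase? X _

gb-exists : (X : CoherentConfiguration n) → ∃ (IsMinimum (HasGeneralizedBaseOfSize X))
gb-exists {n = n} X = minimum (hasGeneralizedBaseOfSize? X) _
  ( map ⁅_⁆ (elements ⊤)
  , Unique.map⁺ (λ {α} e → x∈⁅y⁆⇒x≡y _ (subst (α ∈_) e (x∈⁅x⁆ α)))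
                (Unique.filter⁺ (_∈? ⊤) (Unique.allFin⁺ n))
  , refl , isBase-⊤ X )

b-exists : (X : CoherentConfiguration n) → ∃ (IsMinimum (HasBaseOfSize X))
b-exists X = minimum (hasBaseOfSize? X) _ (⊤ , refl , isBase-⊤ X)

gb : CoherentConfiguration n → ℕ
gb X = proj₁ (gb-exists X)

b : CoherentConfiguration n → ℕ
b X = proj₁ (b-exists X)

gb-isMinimum : (X : CoherentConfiguration n) → IsMinimum (HasGeneralizedBaseOfSize X) (gb X)
gb-isMinimum X = proj₂ (gb-exists X)

b-isMinimum : (X : CoherentConfiguration n) → IsMinimum (HasBaseOfSize X) (b X)
b-isMinimum X = proj₂ (b-exists X)

------------------------------------------------------------------------
-- The coherent configuration of a permutation group

record PermutationGroup (n : ℕ) : Set₁ where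
  field
    Member         : Pred (Permutation′ n) 0ℓ
    id-closed      : Member Perm.id
    ∘-closed       : ∀ {π ρ} → Member π → Member ρ → Member (π ∘ₚ ρ)
    inverse-closed : ∀ {π} → Member π → Member (Perm.flip π)

  SameOrbit : Fin n → Fin n → Fin n → Fin n → Set
  SameOrbit α β α′ β′ = ∃ λ π → Member π × π ⟨$⟩ʳ α ≡ α′ × π ⟨$⟩ʳ β ≡ β′

  -- Needed to form orbits as Subsets; classically automatic.
  field
    sameOrbit? : ∀ α β α′ β′ → Dec (SameOrbit α β α′ β′)

  orbit : Fin n → Fin n → Relation n
  orbit α β = relationOf (sameOrbit? α β)

  IsOrbit : Pred (Relation n) 0ℓ
  IsOrbit s = ∃₂ λ α β → s ≡ orbit α β

private
  ∣∣-cong : {s t : Subset k} → (∀ {x} → x ∈ s → x ∈ t) → (∀ {x} → x ∈ t → x ∈ s) → ∣ s ∣ ≡ ∣ t ∣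
  ∣∣-cong f g = cong ∣_∣ (⊆-antisym f g)

  toNat : Bool → ℕ
  toNat true  = 1
  toNat false = 0

  ∣∣-sum : (s : Subset k) → ∣ s ∣ ≡ sum (toNat ∘ lookup s)
  ∣∣-sum []          = refl
  ∣∣-sum (true ∷ s)  = cong suc (∣∣-sum s)
  ∣∣-sum (false ∷ s) = ∣∣-sum s

  ∣∣-permute : (s : Subset k) (π : Permutation′ k) → ∣ s ∣ ≡ ∣ subsetOf (λ x → (π ⟨$⟩ʳ x) ∈? s) ∣
  ∣∣-permute s π = begin
    ∣ s ∣                                      ≡⟨ ∣∣-sum s ⟩
    sum (toNat ∘ lookup s)                     ≡⟨ sum-permute (toNat ∘ lookup s) π ⟩
    sum (toNat ∘ lookup s ∘ (π ⟨$⟩ʳ_))         ≡⟨ sum-tab (lookup s ∘ (π ⟨$⟩ʳ_)) ⟨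
    ∣ tabulate (lookup s ∘ (π ⟨$⟩ʳ_)) ∣        ≡⟨ cong ∣_∣ (tabulate-cong λ x → does≡ (π ⟨$⟩ʳ x)) ⟨
    ∣ subsetOf (λ x → (π ⟨$⟩ʳ x) ∈? s) ∣      ∎
    where
    open ≡-Reasoning
    sum-tab : ∀ {m} (f : Fin m → Bool) → ∣ tabulate f ∣ ≡ sum (toNat ∘ f)
    sum-tab {zero}  f = refl
    sum-tab {suc m} f with f zero
    ... | true  = cong suc (sum-tab (f ∘ suc))
    ... | false = sum-tab (f ∘ suc)
    does≡ : ∀ y → does (y ∈? s) ≡ lookup s y
    does≡ y with lookup s y in e
    ... | true  = dec-true (y ∈? s) (lookup⇒[]= y s e)
    ... | false = dec-false (y ∈? s) λ y∈ → case trans (sym e) ([]=⇒lookup y∈) of λ ()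

Inv : PermutationGroup n → CoherentConfiguration n
Inv {n = n} G = record
  { S = IsOrbit
  ; isCoherent = record
    { isPartition = record
      { nonempty = λ { (α , β , refl) → pair α β , orbit⁺ self }
      ; covering = cover
      ; disjoint = λ { {x = x} (α , β , refl) (α′ , β′ , refl) p q → same x p q }
      }
    ; diagonal = pointwise⇒isUnionOf diag
    ; converse = λ { (α , β , refl) → β , α , relation-ext
        (λ q → case orbit⁻ (∈-*ʳ⁻ {s = orbit α β} q) of λ { (π , m , e , f) → orbit⁺ (π , m , f , e) })
        (λ q → case orbit⁻ q of λ { (π , m , e , f) → ∈-*ʳ⁺ {s = orbit α β} (orbit⁺ (π , m , f , e)) }) }
    ; regular = λ { {r} {s} sr ss (α , β , refl) p q →
        case compose (flipOrbit (orbit⁻ p)) (orbit⁻ q) of λ { (π , m , refl , refl) →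
          sym (trans (∣∣-permute (between r s _ _) π) (∣∣-cong
            (λ x∈ → case ∈-between⁻ {r = r} {s} (∈-subsetOf⁻ (λ x → (π ⟨$⟩ʳ x) ∈? between r s _ _) x∈) of
               λ { (a , b) → ∈-between⁺ {r = r} {s} (reflect sr m a) (reflect ss m b) })
            (λ x∈ → case ∈-between⁻ {r = r} {s} x∈ of
               λ { (a , b) → ∈-subsetOf⁺ (λ x → (π ⟨$⟩ʳ x) ∈? between r s _ _)
                     (∈-between⁺ {r = r} {s} (preserve sr m a) (preserve ss m b)) }))) } }
    }
  }
  where
  open PermutationGroup G
  orbit⁺ : ∀ {α β α′ β′} → SameOrbit α β α′ β′ → orbit α β ⟨ α′ , β′ ⟩
  orbit⁺ {α} {β} = ∈-relationOf⁺ (sameOrbit? α β)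
  orbit⁻ : ∀ {α β α′ β′} → orbit α β ⟨ α′ , β′ ⟩ → SameOrbit α β α′ β′
  orbit⁻ {α} {β} = ∈-relationOf⁻ (sameOrbit? α β)
  self : ∀ {α β} → SameOrbit α β α β
  self = Perm.id , id-closed , refl , refl
  flipOrbit : ∀ {α β α′ β′} → SameOrbit α β α′ β′ → SameOrbit α′ β′ α β
  flipOrbit (π , m , refl , refl) = Perm.flip π , inverse-closed m , Perm.inverseˡ π , Perm.inverseˡ π
  compose : ∀ {α β α′ β′ α″ β″} → SameOrbit α β α′ β′ → SameOrbit α′ β′ α″ β″ → SameOrbit α β α″ β″
  compose (π , m , refl , refl) (ρ , l , refl , refl) = π ∘ₚ ρ , ∘-closed m l , refl , refl
  preserve : ∀ {s π α β} → IsOrbit s → Member π → s ⟨ α , β ⟩ → s ⟨ π ⟨$⟩ʳ α , π ⟨$⟩ʳ β ⟩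
  preserve {π = π} (_ , _ , refl) m p = orbit⁺ (compose (orbit⁻ p) (π , m , refl , refl))
  reflect : ∀ {s π α β} → IsOrbit s → Member π → s ⟨ π ⟨$⟩ʳ α , π ⟨$⟩ʳ β ⟩ → s ⟨ α , β ⟩
  reflect {π = π} (_ , _ , refl) m p = orbit⁺ (compose (orbit⁻ p) (flipOrbit (π , m , refl , refl)))
  cover : ∀ x → ∃ λ s → IsOrbit s × x ∈ s
  cover x with pair-surjective x
  ... | α , β , refl = orbit α β , (α , β , refl) , orbit⁺ self
  same : ∀ {α β α′ β′} x → x ∈ orbit α β → x ∈ orbit α′ β′ → orbit α β ≡ orbit α′ β′
  same x p q with pair-surjective x
  ... | _ , _ , refl = relation-ext
    (λ z → orbit⁺ (compose (compose (orbit⁻ q) (flipOrbit (orbit⁻ p))) (orbit⁻ z)))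
    (λ z → orbit⁺ (compose (compose (orbit⁻ p) (flipOrbit (orbit⁻ q))) (orbit⁻ z)))
  diag : Pointwise IsOrbit 1[ ⊤ ]
  diag {x} x∈ with pair-surjective x
  ... | α , β , refl with ∈-1⁻ x∈
  ...   | refl , _ = orbit α α , (α , α , refl) , orbit⁺ self , sub
    where
    sub : orbit α α ⊆ 1[ ⊤ ]
    sub {y} y∈ with pair-surjective y
    ... | _ , _ , refl with orbit⁻ y∈
    ...   | _ , _ , refl , refl = ∈-1⁺ ∈⊤

------------------------------------------------------------------------
-- Finite fields and cyclotomic schemes

record FiniteField c ℓ : Set (lsuc (c ⊔ ℓ)) where
  field
    commutativeRing : CommutativeRing c ℓ

  open CommutativeRing commutativeRing renaming (setoid to F-setoid; _+_ to infixl 6 _+ᶠ_; _*_ to infixl 7 _*ᶠ_; refl to ≈-refl; sym to ≈-sym; trans to ≈-trans) public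

  field
    0≉1         : ¬ (0# ≈ 1#)
    invertible  : ∀ {x} → ¬ (x ≈ 0#) → ∃ λ y → x *ᶠ y ≈ 1#
    size        : ℕ
    enumeration : Inverse F-setoid (setoid (Fin size))

  index : Carrier → Fin size
  index = Inverse.to enumeration

  element : Fin size → Carrier
  element = Inverse.from enumeration

-- A subgroup of the multiplicative group, as a set of (indices of) elements.
record MultiplicativeSubgroup {c ℓ} (F : FiniteField c ℓ) : Set (c ⊔ ℓ) where
  open FiniteField F

  field
    members : Subset size

  infix 4 _∈K
  _∈K : Carrier → Set
  x ∈K = index x ∈ members

  field
    nonzero    : ∀ {x} → x ∈K → ¬ (x ≈ 0#)
    1∈K        : 1# ∈K
    *-closed   : ∀ {x y} → x ∈K → y ∈K → x *ᶠ y ∈K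
    ⁻¹-closed  : ∀ {x y} → x ∈K → x *ᶠ y ≈ 1# → y ∈K

module _ {c ℓ} (F : FiniteField c ℓ) (K : MultiplicativeSubgroup F) where
  open FiniteField F
  open MultiplicativeSubgroup K

  private
    open import Relation.Binary.Reasoning.Setoid F-setoid

    element-index : ∀ x → element (index x) ≈ x
    element-index x = Inverse.strictlyInverseʳ enumeration x

    index-element : ∀ i → index (element i) ≡ i
    index-element i = Inverse.strictlyInverseˡ enumeration i

    index-cong : ∀ {x y} → x ≈ y → index x ≡ index y
    index-cong = Inverse.to-cong enumeration

    module _ {a a′ : Carrier} (aa′ : a *ᶠ a′ ≈ 1#) (t : Carrier) where
      undo : ∀ x → a′ *ᶠ (a *ᶠ x +ᶠ t) +ᶠ - (a′ *ᶠ t) ≈ x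
      undo x = begin
        a′ *ᶠ (a *ᶠ x +ᶠ t) +ᶠ - (a′ *ᶠ t)           ≈⟨ +-congʳ (distribˡ a′ (a *ᶠ x) t) ⟩
        a′ *ᶠ (a *ᶠ x) +ᶠ a′ *ᶠ t +ᶠ - (a′ *ᶠ t)     ≈⟨ +-assoc _ _ _ ⟩
        a′ *ᶠ (a *ᶠ x) +ᶠ (a′ *ᶠ t +ᶠ - (a′ *ᶠ t))   ≈⟨ +-cong (≈-sym (*-assoc a′ a x)) (-‿inverseʳ _) ⟩
        a′ *ᶠ a *ᶠ x +ᶠ 0#                           ≈⟨ +-identityʳ _ ⟩
        a′ *ᶠ a *ᶠ x                                 ≈⟨ *-congʳ (≈-trans (*-comm a′ a) aa′) ⟩
        1# *ᶠ x                                      ≈⟨ *-identityˡ x ⟩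
        x                                            ∎

      redo : ∀ y → a *ᶠ (a′ *ᶠ y +ᶠ - (a′ *ᶠ t)) +ᶠ t ≈ y
      redo y = begin
        a *ᶠ (a′ *ᶠ y +ᶠ - (a′ *ᶠ t)) +ᶠ t           ≈⟨ +-congʳ (distribˡ a _ _) ⟩
        a *ᶠ (a′ *ᶠ y) +ᶠ a *ᶠ - (a′ *ᶠ t) +ᶠ t      ≈⟨ +-assoc _ _ _ ⟩
        a *ᶠ (a′ *ᶠ y) +ᶠ (a *ᶠ - (a′ *ᶠ t) +ᶠ t)    ≈⟨ +-cong (cancel y) (+-congʳ (≈-trans (≈-sym (-‿distribʳ-* a _)) (-‿cong (cancel t)))) ⟩
        y +ᶠ (- t +ᶠ t)                              ≈⟨ +-congˡ (-‿inverseˡ t) ⟩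
        y +ᶠ 0#                                      ≈⟨ +-identityʳ y ⟩
        y                                            ∎
        where
        open import Algebra.Properties.Ring ring using (-‿distribʳ-*)
        cancel : ∀ z → a *ᶠ (a′ *ᶠ z) ≈ z
        cancel z = ≈-trans (≈-sym (*-assoc a a′ z)) (≈-trans (*-congʳ aa′) (*-identityˡ z))

  affine : Fin size → Fin size → Fin size → Fin size
  affine a b x = index (element a *ᶠ element x +ᶠ element b)

  private
    K-inverse : ∀ {a} → a ∈ members → ∃ λ y → element a *ᶠ y ≈ 1#
    K-inverse {a} a∈ = invertible (nonzero (subst (_∈ members) (sym (index-element a)) a∈))

    affine-permutation : ∀ {a} → a ∈ members → Fin size → Permutation′ size
    affine-permutation {a} a∈ b with K-inverse a∈
    ... | a′ , aa′ = Perm.permutation (affine a b)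
      (λ y → index (a′ *ᶠ element y +ᶠ - (a′ *ᶠ element b)))
      (λ y → trans (index-cong (≈-trans (+-congʳ (*-congˡ (element-index _))) (redo aa′ (element b) (element y)))) (index-element y))
      (λ x → trans (index-cong (≈-trans (+-congʳ (*-congˡ (element-index _))) (undo aa′ (element b) (element x)))) (index-element x))

    affine-permutation-to : ∀ {a} (a∈ : a ∈ members) b x → affine-permutation a∈ b ⟨$⟩ʳ x ≡ affine a b x
    affine-permutation-to a∈ b x with K-inverse a∈
    ... | _ = refl

  IsAffine : Pred (Permutation′ size) 0ℓ
  IsAffine π = ∃₂ λ a b → a ∈ members × (∀ x → π ⟨$⟩ʳ x ≡ affine a b x)

  affineGroup : PermutationGroup size
  affineGroup = record
    { Member         = IsAffine
    ; id-closed      = index 1# , index 0# , 1∈K , λ x → sym (trans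
        (index-cong (≈-trans (+-cong (*-congʳ (element-index 1#)) (element-index 0#))
                    (≈-trans (+-identityʳ _) (*-identityˡ _)))) (index-element x))
    ; ∘-closed       = λ { {π} {ρ} (a , b , a∈ , e) (a₂ , b₂ , a₂∈ , e₂) →
          index (element a₂ *ᶠ element a)
        , index (element a₂ *ᶠ element b +ᶠ element b₂)
        , *-closed (subst (_∈ members) (sym (index-element a₂)) a₂∈)
                   (subst (_∈ members) (sym (index-element a)) a∈)
        , λ x → trans (e₂ (π ⟨$⟩ʳ x)) (trans (cong (affine a₂ b₂) (e x)) (index-cong (comp a b a₂ b₂ x))) }
    ; inverse-closed = λ { {π} (a , b , a∈ , e) → inv π a b a∈ e }
    ; sameOrbit?     = λ α β α′ β′ → map′
        (λ { (a , b , a∈ , e , f) → affine-permutation a∈ b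
             , (a , b , a∈ , affine-permutation-to a∈ b)
             , trans (affine-permutation-to a∈ b α) e , trans (affine-permutation-to a∈ b β) f })
        (λ { (π , (a , b , a∈ , h) , e , f) → a , b , a∈ , trans (sym (h α)) e , trans (sym (h β)) f })
        (any? λ a → any? λ b → (a ∈? members) ×-dec (affine a b α ≟ α′) ×-dec (affine a b β ≟ β′))
    }
    where
    comp : ∀ a b a₂ b₂ x →
      element a₂ *ᶠ element (affine a b x) +ᶠ element b₂ ≈
      element (index (element a₂ *ᶠ element a)) *ᶠ element x +ᶠ element (index (element a₂ *ᶠ element b +ᶠ element b₂))
    comp a b a₂ b₂ x = begin
      A₂ *ᶠ element (affine a b x) +ᶠ B₂        ≈⟨ +-congʳ (*-congˡ (element-index _)) ⟩
      A₂ *ᶠ (A *ᶠ X +ᶠ B) +ᶠ B₂                 ≈⟨ +-congʳ (distribˡ _ _ _) ⟩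
      A₂ *ᶠ (A *ᶠ X) +ᶠ A₂ *ᶠ B +ᶠ B₂           ≈⟨ +-assoc _ _ _ ⟩
      A₂ *ᶠ (A *ᶠ X) +ᶠ (A₂ *ᶠ B +ᶠ B₂)         ≈⟨ +-congʳ (≈-sym (*-assoc _ _ _)) ⟩
      A₂ *ᶠ A *ᶠ X +ᶠ (A₂ *ᶠ B +ᶠ B₂)           ≈⟨ +-cong (*-congʳ (≈-sym (element-index _))) (≈-sym (element-index _)) ⟩
      element (index (A₂ *ᶠ A)) *ᶠ X +ᶠ element (index (A₂ *ᶠ B +ᶠ B₂)) ∎
      where
      A = element a
      A₂ = element a₂
      B = element b
      B₂ = element b₂
      X = element x
    inv : ∀ π a b → a ∈ members → (∀ x → π ⟨$⟩ʳ x ≡ affine a b x) → IsAffine (Perm.flip π)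
    inv π a b a∈ e with K-inverse a∈
    ... | a′ , aa′ = index a′ , index (- (a′ *ᶠ element b))
      , ⁻¹-closed (subst (_∈ members) (sym (index-element a)) a∈) aa′
      , λ y → sym (trans (index-cong (step y)) (index-element (π ⟨$⟩ˡ y)))
      where
      step : ∀ y → element (index a′) *ᶠ element y +ᶠ element (index (- (a′ *ᶠ element b))) ≈ element (π ⟨$⟩ˡ y)
      step y = begin
        element (index a′) *ᶠ element y +ᶠ element (index (- (a′ *ᶠ element b)))
          ≈⟨ +-cong (*-congʳ (element-index a′)) (element-index _) ⟩
        a′ *ᶠ element y +ᶠ - (a′ *ᶠ element b)
          ≡⟨ cong (λ z → a′ *ᶠ element z +ᶠ - (a′ *ᶠ element b)) (trans (sym (Perm.inverseʳ π)) (e (π ⟨$⟩ˡ y))) ⟩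
        a′ *ᶠ element (affine a b (π ⟨$⟩ˡ y)) +ᶠ - (a′ *ᶠ element b)
          ≈⟨ +-congʳ (*-congˡ (element-index _)) ⟩
        a′ *ᶠ (element a *ᶠ element (π ⟨$⟩ˡ y) +ᶠ element b) +ᶠ - (a′ *ᶠ element b)
          ≈⟨ undo aa′ (element b) (element (π ⟨$⟩ˡ y)) ⟩
        element (π ⟨$⟩ˡ y) ∎

  -- The field is identified with Fin size along its enumeration.
  cyclotomicScheme : CoherentConfiguration size
  cyclotomicScheme = Inv affineGroup

{-# OPTIONS --safe #-}
module Submission where

-- Since - 1 ∉ K, we have κᵒ = 1 for all κ ∈ K, where q - 1 = 2ᵉ o with o odd.
-- Let g generate the multiplicative group and put c = - g.
--
-- Let Z be a fission in which 0 is fixed.  The functions f with values in the field for which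
-- f(x / y) is constant on the basic relations of Z are closed under products of values and, by
-- convolution over the multiplicative group, under products of coefficients.  They contain
-- (1 - s)^((q - 1)/2) = ∏ₜ (1 - s^(pᵗ))ʰ with h = (p - 1)/2, and combining the two products lowers
-- h step by step to 1.  This yields E(s) = ∑ sᴬ, the sum over all A with base-p digits 0 and 1
-- and an odd number of ones.  These A contain no three-term arithmetic progression.
--
-- The parity of the number of paths x → w → y inside one class detects whether x / y has a square
-- root in that class, because w ↦ x y / w is an involution.  Therefore Ê(a²) = aᵒ E(a) is
-- also constant on basic relations, where it is defined.  Let 1 and c be fixed as well.  Convolving
-- with E and Ê and using the absence of progressions one finds, for x ranging over the squares:
-- if E(b x) and E(b′ x) are constant on fibers, then so is E(b b′ x).  Hence E(z x) is constant on
-- fibers for every z; its coefficient at z is x, so all squares are fixed, and then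
-- all points are.
--
-- Finally cᵒ ≠ - 1 implies that a fission in which {0, 1, c} is a union of fibers fixes 0, 1 and c,
-- since otherwise the colours (x - y)ᵒ on this triple would have to be cyclically symmetric.

open import Defs
open import Level using (Level)
open import Data.Nat.Base using (_≤_)
open import Data.Product.Base using (_×_)

open import Algebra.Bundles using (CommutativeRing; RawRing)
import Algebra.Morphism.RingMonomorphism as RingMonomorphism
open import Algebra.Morphism.Structures using (IsRingMonomorphism)
import Algebra.Solver.Ring
import Algebra.Solver.Ring.AlmostCommutativeRing as ACR
open import Algebra.Structures using (IsCommutativeRing)
open import Data.Bool.Base using (Bool; true; false; _∧_; _xor_; not; if_then_else_)
import Data.Bool.Properties as Bool
open import Data.Fin.Base as Fin using (Fin; zero; suc; toℕ; fromℕ<; punchIn; combine; remQuot)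
open import Data.Fin.Permutation as Perm using (Permutation′; _⟨$⟩ʳ_; _∘ₚ_)
import Data.Fin.Properties as Fin
open import Data.Fin.Properties using (_≟_; _<?_; any?; all?)
open import Data.Fin.Subset using (Subset; _∈_; _∪_; ∣_∣; ⁅_⁆)
open import Data.Fin.Subset.Properties using (_∈?_; x∈⁅x⁆; x∈⁅y⁆⇒x≡y; x∈p∪q⁻; ∣⁅x⁆∣≡1; p⊆p∪q; q⊆p∪q; ∈⊤)
open import Data.List.Base using ([]; _∷_)
open import Data.List.Membership.Propositional.Properties using (∈-map⁺; ∈-filter⁺; ∈-allFin)
open import Data.List.Relation.Unary.All as All using (All; []; _∷_)
open import Data.List.Relation.Unary.AllPairs using ([]; _∷_)
open import Data.Maybe.Base using (Maybe; just; nothing)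
open import Data.Nat.Base as ℕ using (ℕ; zero; suc; _<_; z≤n; s≤s; _∸_; ⌊_/2⌋; NonZero)
open import Data.Nat.Coprimality using (Coprime; coprime-divisor)
open import Data.Nat.DivMod using (_%_; _/_; m≡m%n+[m/n]*n; m%n<n; [m+kn]%n≡m%n; m<n⇒m%n≡m; m<n⇒m/n≡0; m<n*o⇒m/o<n)
open import Data.Nat.Divisibility using (_∣_; _∤_; divides; _∣?_; ∣⇒≤; ∣-trans; m∣m*n; *-cancelˡ-∣; *-pres-∣; *-monoʳ-∣)
open import Data.Nat.GCD using (gcd; gcd[m,n]∣m; gcd[m,n]∣n; gcd-greatest)
open import Data.Nat.Induction using (<-wellFounded; Acc; acc)
open import Data.Nat.Primality using (Prime; prime⇒nonZero; prime⇒nonTrivial; prime⇒irreducible; euclidsLemma)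
open import Data.Nat.Primality.Factorisation using (factorise)
import Data.Nat.Properties as ℕ
open import Data.Nat.Solver using (module +-*-Solver)
open import Data.Product.Base using (∃; ∃₂; _,_; proj₁; proj₂)
open import Data.Product.Properties using () renaming (≡-dec to ×-≡-dec)
open import Data.Sum.Base using (_⊎_; inj₁; inj₂)
open import Data.Vec.Base using (Vec; []; _∷_; replicate)
open import Data.Vec.Properties using (≡-dec)
open import Function.Base using (_∘_; case_of_)
open import Function.Bundles using (Inverse)
open import Relation.Binary.Definitions using (DecidableEquality; tri<; tri≈; tri>)
open import Relation.Binary.PropositionalEquality using (_≡_; _≢_; refl; sym; trans; cong; cong₂; subst; module ≡-Reasoning)
open import Relation.Nullary using (¬_; Dec; yes; no; does; contradiction)
open import Relation.Nullary.Decidable using (¬?; _×-dec_; dec-true; dec-false; decidable-stable)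
open import Relation.Unary using (Pred; Decidable)

-- The functions E(b x) cannot be combined directly: convolving E with E(b w) E(b′ w) selects A + B
-- = C. With halved exponents the condition becomes A + B = 2 C modulo q - 1, and in a set without
-- progressions this leaves only A = B = C. Halving is what forces the restriction to squares, the
-- twist by aᵒ that makes A + o even, and the parity argument for square roots.
--
-- The set of exponents is chosen for several reasons. An odd number of ones makes A odd, so (A +
-- o)/2 is an integer and E is an odd function. It excludes A = 0, and 2 A ≤ q - 1, so a congruence
-- modulo q - 1 between sums of two exponents is an equality. It admits A = 1, through which x is
-- recovered.
--
-- The sign in c = - g is there because gᵒ = - 1 when q is 3 modulo 4, and then the argument against
-- a cyclic symmetry of 0, 1, g breaks down. Since E is odd, fixing - g serves as well as fixing g.

module IntegerSolver {c ℓ} (R : CommutativeRing c ℓ) where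

  open import Data.Integer.Base as ℤ using (ℤ; +_; -[1+_]; _⊖_)
  import Data.Integer.Properties as ℤ
  open CommutativeRing R renaming (refl to ≈-refl; sym to ≈-sym; trans to ≈-trans)
  open import Algebra.Properties.Ring ring
  open import Algebra.Properties.Semiring.Mult semiring using (×-homo-+; ×1-homo-*) renaming (_×_ to infixr 8 _×ₙ_)
  open import Algebra.Properties.Monoid.Mult.TCOptimised +-monoid using (×ᵤ≈×) renaming (_×_ to infixr 8 _×′_)
  open import Relation.Binary.Reasoning.Setoid setoid

  ⟦_⟧ℤ : ℤ → Carrier
  ⟦ + n ⟧ℤ      = n ×ₙ 1#
  ⟦ -[1+ n ] ⟧ℤ = - (suc n ×ₙ 1#)

  private
    ×′≈× : ∀ n → n ×′ 1# ≈ n ×ₙ 1#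
    ×′≈× n = ≈-sym (×ᵤ≈× n 1#)

    cancel : ∀ a b → (1# + a) + - (1# + b) ≈ a + - b
    cancel a b = begin
      (1# + a) + - (1# + b)      ≈⟨ +-cong (+-comm 1# a) (≈-sym (-‿+-comm 1# b)) ⟩
      (a + 1#) + (- 1# + - b)    ≈⟨ +-assoc a 1# _ ⟩
      a + (1# + (- 1# + - b))    ≈⟨ +-congˡ (≈-sym (+-assoc 1# (- 1#) (- b))) ⟩
      a + ((1# + - 1#) + - b)    ≈⟨ +-congˡ (+-congʳ (-‿inverseʳ 1#)) ⟩
      a + (0# + - b)             ≈⟨ +-congˡ (+-identityˡ (- b)) ⟩
      a + - b  ∎

    ⊖-homo : ∀ m n → ⟦ m ⊖ n ⟧ℤ ≈ m ×ₙ 1# + - (n ×ₙ 1#)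
    ⊖-homo zero    zero    = ≈-sym (-‿inverseʳ 0#)
    ⊖-homo zero    (suc n) = ≈-sym (+-identityˡ _)
    ⊖-homo (suc m) zero    = ≈-sym (≈-trans (+-congˡ -0#≈0#) (+-identityʳ _))
    ⊖-homo (suc m) (suc n) = begin
      ⟦ suc m ⊖ suc n ⟧ℤ  ≡⟨ cong ⟦_⟧ℤ (ℤ.[1+m]⊖[1+n]≡m⊖n m n) ⟩
      ⟦ m ⊖ n ⟧ℤ                          ≈⟨ ⊖-homo m n ⟩
      m ×ₙ 1# + - (n ×ₙ 1#)                 ≈⟨ cancel _ _ ⟨
      suc m ×ₙ 1# + - (suc n ×ₙ 1#)  ∎

    +-homo : ∀ i j → ⟦ i ℤ.+ j ⟧ℤ ≈ ⟦ i ⟧ℤ + ⟦ j ⟧ℤ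
    +-homo (+ m)      (+ n)      = ×-homo-+ 1# m n
    +-homo (+ m)      -[1+ n ]   = ⊖-homo m (suc n)
    +-homo -[1+ m ]   (+ n)      = ≈-trans (⊖-homo n (suc m)) (+-comm _ _)
    +-homo -[1+ m ]   -[1+ n ]   = begin
      - (suc (suc (m ℕ.+ n)) ×ₙ 1#)  ≡⟨ cong (λ k → - (suc k ×ₙ 1#)) (sym (ℕ.+-suc m n)) ⟩
      - ((suc m ℕ.+ suc n) ×ₙ 1#)                ≈⟨ -‿cong (×-homo-+ 1# (suc m) (suc n)) ⟩
      - (suc m ×ₙ 1# + suc n ×ₙ 1#)               ≈⟨ -‿+-comm _ _ ⟨
      - (suc m ×ₙ 1#) + - (suc n ×ₙ 1#)  ∎

    neg-homo : ∀ i → ⟦ ℤ.- i ⟧ℤ ≈ - ⟦ i ⟧ℤ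
    neg-homo (+ zero)  = ≈-sym -0#≈0#
    neg-homo (+ suc n) = ≈-refl
    neg-homo -[1+ n ]  = ≈-sym (-‿involutive _)

    *-homo⁺ : ∀ m j → ⟦ + m ℤ.* j ⟧ℤ ≈ m ×ₙ 1# * ⟦ j ⟧ℤ
    *-homo⁺ m (+ n) = begin
      ⟦ + m ℤ.* + n ⟧ℤ  ≡⟨ cong ⟦_⟧ℤ (sym (ℤ.pos-* m n)) ⟩
      (m ℕ.* n) ×ₙ 1#        ≈⟨ ×1-homo-* m n ⟩
      m ×ₙ 1# * n ×ₙ 1#  ∎
    *-homo⁺ m -[1+ n ] = begin
      ⟦ + m ℤ.* -[1+ n ] ⟧ℤ  ≡⟨ cong ⟦_⟧ℤ (sym (ℤ.neg-distribʳ-* (+ m) (+ suc n))) ⟩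
      ⟦ ℤ.- (+ m ℤ.* + suc n) ⟧ℤ   ≈⟨ neg-homo (+ m ℤ.* + suc n) ⟩
      - ⟦ + m ℤ.* + suc n ⟧ℤ       ≈⟨ -‿cong (*-homo⁺ m (+ suc n)) ⟩
      - (m ×ₙ 1# * suc n ×ₙ 1#)      ≈⟨ -‿distribʳ-* _ _ ⟩
      m ×ₙ 1# * - (suc n ×ₙ 1#)  ∎

    *-homo : ∀ i j → ⟦ i ℤ.* j ⟧ℤ ≈ ⟦ i ⟧ℤ * ⟦ j ⟧ℤ
    *-homo (+ m)    j = *-homo⁺ m j
    *-homo -[1+ m ] j = begin
      ⟦ -[1+ m ] ℤ.* j ⟧ℤ  ≡⟨ cong ⟦_⟧ℤ (sym (ℤ.neg-distribˡ-* (+ suc m) j)) ⟩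
      ⟦ ℤ.- (+ suc m ℤ.* j) ⟧ℤ     ≈⟨ neg-homo (+ suc m ℤ.* j) ⟩
      - ⟦ + suc m ℤ.* j ⟧ℤ         ≈⟨ -‿cong (*-homo⁺ (suc m) j) ⟩
      - (suc m ×ₙ 1# * ⟦ j ⟧ℤ)      ≈⟨ -‿distribˡ-* _ _ ⟩
      - (suc m ×ₙ 1#) * ⟦ j ⟧ℤ  ∎

    -- The solver evaluates its constants with the values below, for which
    -- con (+ 1) is definitionally 1#.
    value : ℤ → Carrier
    value (+ n)    = n ×′ 1#
    value -[1+ n ] = - (suc n ×′ 1#)

    value≈ : ∀ i → value i ≈ ⟦ i ⟧ℤ
    value≈ (+ n)    = ×′≈× n
    value≈ -[1+ n ] = -‿cong (×′≈× (suc n))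

    morphism : ℤ.+-*-rawRing ACR.-Raw-AlmostCommutative⟶ ACR.fromCommutativeRing R
    morphism = record
      { ⟦_⟧    = value
      ; +-homo = λ i j → ≈-trans (value≈ (i ℤ.+ j)) (≈-trans (+-homo i j) (≈-sym (+-cong (value≈ i) (value≈ j))))
      ; *-homo = λ i j → ≈-trans (value≈ (i ℤ.* j)) (≈-trans (*-homo i j) (≈-sym (*-cong (value≈ i) (value≈ j))))
      ; -‿homo = λ i → ≈-trans (value≈ (ℤ.- i)) (≈-trans (neg-homo i) (≈-sym (-‿cong (value≈ i))))
      ; 0-homo = ≈-refl
      ; 1-homo = ≈-refl
      }

    coeff≟ : ∀ i j → Maybe (value i ≈ value j)
    coeff≟ i j with i ℤ.≟ j
    ... | yes e = just (reflexive (cong value e))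
    ... | no _  = nothing

  open Algebra.Solver.Ring ℤ.+-*-rawRing (ACR.fromCommutativeRing R) morphism coeff≟ public
    using (Polynomial; con; solve; _:=_; _:+_; _:*_; _:-_; :-_)

  :0 :1 : ∀ {n} → Polynomial n
  :0 = con (+ 0)
  :1 = con (+ 1)

-- Coherent configurations as colourings of the pairs

private
  variable
    n : ℕ

module ℕΣ where
  open import Algebra.Properties.CommutativeMonoid.Sum ℕ.+-0-commutativeMonoid public

module 𝔹Σ where
  open import Algebra.Bundles using (CommutativeRing)
  open import Algebra.Properties.CommutativeMonoid.Sum
    (CommutativeRing.+-commutativeMonoid Bool.xor-∧-commutativeRing) public

⟦_⟧ᵇ : Bool → ℕ
⟦ b ⟧ᵇ = if b then 1 else 0

∣subsetOf∣ : ∀ {ℓ} {P : Pred (Fin n) ℓ} (P? : Decidable P) →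
             ∣ subsetOf P? ∣ ≡ ℕΣ.sum (λ i → ⟦ does (P? i) ⟧ᵇ)
∣subsetOf∣ {zero}  P? = refl
∣subsetOf∣ {suc n} P? with does (P? zero)
... | true  = cong suc (∣subsetOf∣ (P? ∘ suc))
... | false = ∣subsetOf∣ (P? ∘ suc)

sum≢0⇒∃ : (f : Fin n → ℕ) → ℕΣ.sum f ≢ 0 → ∃ λ i → f i ≢ 0
sum≢0⇒∃ {zero}  f s≢0 = contradiction refl s≢0
sum≢0⇒∃ {suc n} f s≢0 with f zero in eq
... | suc _ = zero , λ e → case trans (sym eq) e of λ ()
... | zero  with sum≢0⇒∃ (f ∘ suc) s≢0
...   | i , fi≢0 = suc i , fi≢0

does≢0⇒ : {P : Set} (P? : Dec P) → ⟦ does P? ⟧ᵇ ≢ 0 → P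
does≢0⇒ (yes q) _ = q
does≢0⇒ (no _)  h = contradiction refl h

module _ {T : Set} (_≟ₜ_ : DecidableEquality T) where

  occurrences : (Fin n → T) → T → ℕ
  occurrences u t = ℕΣ.sum (λ i → ⟦ does (u i ≟ₜ t) ⟧ᵇ)

  -- Induction on `n`: the value `u zero` occurs in `v`, at `j` say, and this entry is removed from
  -- both families. Comparing multiplicities at the values of `u` suffices because both families
  -- have `n` members.
  occurrences⇒permutation :
    (u v : Fin n → T) → (∀ w → occurrences u (u w) ≡ occurrences v (u w)) →
    ∃ λ (π : Permutation′ n) → ∀ w → v (π ⟨$⟩ʳ w) ≡ u w
  occurrences⇒permutation {zero}  u v eq = Perm.id , λ ()
  occurrences⇒permutation {suc n} u v eq with sum≢0⇒∃ _ positive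
    where
    positive : occurrences v (u zero) ≢ 0
    positive e with trans (eq zero) e
    ... | q rewrite dec-true (u zero ≟ₜ u zero) refl = case q of λ ()
  ... | j , vj≢ = Perm.insert zero j (proj₁ rest) , matches
    where
    vj≡ : v j ≡ u zero
    vj≡ = does≢0⇒ (v j ≟ₜ u zero) vj≢
    rest = occurrences⇒permutation (u ∘ suc) (v ∘ punchIn j) λ w →
      ℕ.+-cancelˡ-≡ ⟦ does (u zero ≟ₜ u (suc w)) ⟧ᵇ _ _
        (trans (eq (suc w)) (trans (ℕΣ.sum-remove {i = j} (λ i → ⟦ does (v i ≟ₜ u (suc w)) ⟧ᵇ))
          (cong (λ t → ⟦ does (t ≟ₜ u (suc w)) ⟧ᵇ ℕ.+ occurrences (v ∘ punchIn j) (u (suc w))) vj≡)))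
    matches : ∀ w → v (Perm.insert zero j (proj₁ rest) ⟨$⟩ʳ w) ≡ u w
    matches zero    = vj≡
    matches (suc w) = trans (cong v (Perm.insert-punchIn zero j (proj₁ rest) w)) (proj₂ rest w)

module _ (ι : Fin n → Fin n) (involutive : ∀ w → ι (ι w) ≡ w) where

  involution : Permutation′ n
  involution = Perm.permutation ι ι involutive involutive

  -- `ι` exchanges the marked `w` with `w < ι w` and the marked `w` with `ι w < w`, so both kinds
  -- have the same parity.
  fixedPointFree⇒even : (β : Fin n → Bool) → (∀ w → β (ι w) ≡ β w) →
                        (∀ w → β w ≡ true → ι w ≢ w) → 𝔹Σ.sum β ≡ false
  fixedPointFree⇒even β inv free = begin
    𝔹Σ.sum β  ≡⟨ 𝔹Σ.sum-cong-≗ split ⟩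
    𝔹Σ.sum (λ w → γ w xor δ w)  ≡⟨ 𝔹Σ.∑-distrib-+ γ δ ⟩
    𝔹Σ.sum γ xor 𝔹Σ.sum δ  ≡⟨ cong (𝔹Σ.sum γ xor_) (𝔹Σ.sum-permute δ involution) ⟩
    𝔹Σ.sum γ xor 𝔹Σ.sum (δ ∘ ι)  ≡⟨ cong (𝔹Σ.sum γ xor_) (𝔹Σ.sum-cong-≗ δι) ⟩
    𝔹Σ.sum γ xor 𝔹Σ.sum γ  ≡⟨ Bool.xor-same (𝔹Σ.sum γ) ⟩
    false  ∎
    where
    open ≡-Reasoning
    γ δ : Fin n → Bool
    γ w = β w ∧ does (w <? ι w)
    δ w = β w ∧ does (ι w <? w)
    split : ∀ w → β w ≡ γ w xor δ w
    split w with β w in eq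
    ... | false = refl
    ... | true with Fin.<-cmp w (ι w)
    ...   | tri< a _ c = sym (cong₂ _xor_ (dec-true (w <? ι w) a) (dec-false (ι w <? w) c))
    ...   | tri≈ _ b _ = contradiction (sym b) (free w eq)
    ...   | tri> a _ c = sym (cong₂ _xor_ (dec-false (w <? ι w) a) (dec-true (ι w <? w) c))
    δι : ∀ w → δ (ι w) ≡ γ w
    δι w = cong₂ (λ b v → b ∧ does (v <? ι w)) (inv w) (involutive w)

  uniqueFixedPoint⇒odd : (β : Fin n → Bool) → (∀ w → β (ι w) ≡ β w) →
                         ∀ w₀ → β w₀ ≡ true → ι w₀ ≡ w₀ →
                         (∀ w → β w ≡ true → ι w ≡ w → w ≡ w₀) → 𝔹Σ.sum β ≡ true
  uniqueFixedPoint⇒odd β inv w₀ βw₀ fix unique = begin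
    𝔹Σ.sum β  ≡⟨ 𝔹Σ.sum-cong-≗ split ⟩
    𝔹Σ.sum (λ w → ε w xor β′ w)  ≡⟨ 𝔹Σ.∑-distrib-+ ε β′ ⟩
    𝔹Σ.sum ε xor 𝔹Σ.sum β′  ≡⟨ cong₂ _xor_ (singleton w₀) (fixedPointFree⇒even β′ inv′ free) ⟩
    true  ∎
    where
    open ≡-Reasoning
    ε β′ : Fin n → Bool
    ε w = does (w ≟ w₀)
    β′ w = β w ∧ not (does (w ≟ w₀))
    singleton : ∀ {k} (v : Fin k) → 𝔹Σ.sum (λ w → does (w ≟ v)) ≡ true
    singleton {suc k} zero    = cong not (𝔹Σ.sum-replicate-zero k)
    singleton {suc k} (suc v) = singleton v
    split : ∀ w → β w ≡ ε w xor β′ w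
    split w with w ≟ w₀
    ... | yes refl = trans βw₀ (cong not (sym (Bool.∧-zeroʳ (β w))))
    ... | no  _    = sym (Bool.∧-identityʳ (β w))
    inv′ : ∀ w → β′ (ι w) ≡ β′ w
    inv′ w with w ≟ w₀
    ... | yes refl rewrite dec-true (ι w ≟ w) fix = cong (_∧ false) (inv w)
    ... | no  w≢ rewrite dec-false (ι w ≟ w₀) (λ e → w≢ (trans (sym (involutive w)) (trans (cong ι e) fix)))
        = cong (_∧ true) (inv w)
    free : ∀ w → β′ w ≡ true → ι w ≢ w
    free w e fixed with w ≟ w₀ | β w in βw
    ... | yes _  | true  = case e of λ ()
    ... | yes _  | false = case e of λ ()
    ... | no w≢  | true  = w≢ (unique w βw fixed)
    ... | no _   | false = case e of λ ()

module Colouring (Z : CoherentConfiguration n) where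

  open CoherentConfiguration Z

  infix 4 _≟ᵣ_
  _≟ᵣ_ : DecidableEquality (Relation n)
  _≟ᵣ_ = ≡-dec Bool._≟_

  colour : Fin n → Fin n → Relation n
  colour x y = proj₁ (covering (pair x y))

  colour-basic : ∀ x y → S (colour x y)
  colour-basic x y = proj₁ (proj₂ (covering (pair x y)))

  colour-∋ : ∀ x y → colour x y ⟨ x , y ⟩
  colour-∋ x y = proj₂ (proj₂ (covering (pair x y)))

  colour-unique : ∀ {s x y} → S s → s ⟨ x , y ⟩ → colour x y ≡ s
  colour-unique {x = x} {y} ss xy∈ = disjoint (colour-basic x y) ss (colour-∋ x y) xy∈

  colour-≡⁺ : ∀ {x y x′ y′} → colour x y ⟨ x′ , y′ ⟩ → colour x y ≡ colour x′ y′
  colour-≡⁺ {x} {y} q = sym (colour-unique (colour-basic x y) q)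

  colour-≡⁻ : ∀ {x y x′ y′} → colour x y ≡ colour x′ y′ → colour x y ⟨ x′ , y′ ⟩
  colour-≡⁻ {x′ = x′} {y′} e = subst (_⟨ x′ , y′ ⟩) (sym e) (colour-∋ x′ y′)

  relation-respects : ∀ {r} → IsUnionOf S r → ∀ {x y x′ y′} → colour x y ≡ colour x′ y′ →
                      r ⟨ x , y ⟩ → r ⟨ x′ , y′ ⟩
  relation-respects u {x} {y} {x′} {y′} e xy∈ with isUnionOf⇒pointwise u xy∈
  ... | s , ss , xy∈s , s⊆ = s⊆ (subst (_⟨ x′ , y′ ⟩) (colour-unique ss xy∈s) (colour-≡⁻ e))

  colour-diagonal : ∀ {x y z} → colour x x ≡ colour y z → y ≡ z
  colour-diagonal e = proj₁ (∈-1⁻ (relation-respects diagonal e (∈-1⁺ ∈⊤)))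

  colour-converse : ∀ {x y x′ y′} → colour x y ≡ colour x′ y′ → colour y x ≡ colour y′ x′
  colour-converse {x} {y} {x′} {y′} e = begin
    colour y x  ≡⟨ colour-unique (converse (colour-basic x y)) (∈-*ʳ⁺ {s = colour x y} (colour-∋ x y)) ⟩
    colour x y *ʳ  ≡⟨ cong _*ʳ e ⟩
    colour x′ y′ *ʳ  ≡⟨ colour-unique (converse (colour-basic x′ y′)) (∈-*ʳ⁺ {s = colour x′ y′} (colour-∋ x′ y′)) ⟨
    colour y′ x′  ∎
    where open ≡-Reasoning

  Matching : Fin n → Fin n → Fin n → Fin n → Set
  Matching x y x′ y′ = ∃ λ (π : Permutation′ n) →
    ∀ w → colour x w ≡ colour x′ (π ⟨$⟩ʳ w) × colour w y ≡ colour (π ⟨$⟩ʳ w) y′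

  opaque
    -- The intersection numbers say that the paths x → w → y and x′ → w → y′ carry the same pairs of
    -- colours with the same multiplicities. Every later comparison of sums over intermediate points
    -- goes through this permutation.
    colour-permutation : ∀ {x y x′ y′} → colour x y ≡ colour x′ y′ → Matching x y x′ y′
    colour-permutation {x} {y} {x′} {y′} e =
      let π , eq = occurrences⇒permutation _≟²_ (paths x y) (paths x′ y′) same
      in π , λ w → sym (cong proj₁ (eq w)) , sym (cong proj₂ (eq w))
      where
      _≟²_ : DecidableEquality (Relation n × Relation n)
      _≟²_ = ×-≡-dec _≟ᵣ_ _≟ᵣ_
      paths : Fin n → Fin n → Fin n → Relation n × Relation n
      paths a b w = colour a w , colour w b
      count : ∀ a b c d e f → occurrences _≟²_ (paths a b) (colour c d , colour e f) ≡ ∣ between (colour c d) (colour e f) a b ∣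
      count a b c d e f = trans (ℕΣ.sum-cong-≗ agree) (sym (∣subsetOf∣ via?))
        where
        via? : ∀ γ → Dec (colour c d ⟨ a , γ ⟩ × colour e f ⟨ γ , b ⟩)
        via? γ = (pair a γ ∈? colour c d) ×-dec (pair γ b ∈? colour e f)
        agree : ∀ i → ⟦ does (paths a b i ≟² (colour c d , colour e f)) ⟧ᵇ ≡ ⟦ does (via? i) ⟧ᵇ
        agree i = cong ⟦_⟧ᵇ (does-⇔ (paths a b i ≟² (colour c d , colour e f)) (via? i)
          (λ q → colour-≡⁻ (sym (cong proj₁ q)) , colour-≡⁻ (sym (cong proj₂ q)))
          (λ { (q₁ , q₂) → cong₂ _,_ (sym (colour-≡⁺ q₁)) (sym (colour-≡⁺ q₂)) }))
          where
          does-⇔ : {A B : Set} (A? : Dec A) (B? : Dec B) → (A → B) → (B → A) → does A? ≡ does B?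
          does-⇔ (yes a) B? f g = sym (dec-true B? (f a))
          does-⇔ (no ¬a) B? f g = sym (dec-false B? (¬a ∘ g))
      same : ∀ w → occurrences _≟²_ (paths x y) (paths x y w) ≡ occurrences _≟²_ (paths x′ y′) (paths x y w)
      same w = trans (count x y x w w y) (trans (regular (colour-basic x w) (colour-basic w y) (colour-basic x y)
          (colour-∋ x y) (colour-≡⁻ e)) (sym (count x′ y′ x w w y)))

  -- For the intermediate point w = x the first arc is diagonal, so the permutation must send `x` to
  -- `x′`.
  colour-left : ∀ {x y x′ y′} → colour x y ≡ colour x′ y′ → colour x x ≡ colour x′ x′
  colour-left {x} {x′ = x′} e with colour-permutation e
  ... | π , eq = trans (proj₁ (eq x)) (cong (colour x′) (sym (colour-diagonal (proj₁ (eq x)))))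

  colour-right : ∀ {x y x′ y′} → colour x y ≡ colour x′ y′ → colour y y ≡ colour y′ y′
  colour-right e = colour-left (colour-converse e)

  IsFixed : Fin n → Set
  IsFixed b = ∀ {z} → colour b b ≡ colour z z → z ≡ b

  -- The permutation matching the paths x → w → x with those at `x′` keeps `b` in its own fiber,
  -- hence in place.
  colour-fixed : ∀ {b x x′} → IsFixed b → colour x x ≡ colour x′ x′ → colour x b ≡ colour x′ b
  colour-fixed {b} {x′ = x′} fb e with colour-permutation e
  ... | π , eq = trans (proj₁ (eq b)) (cong (colour x′) (fb (colour-right (proj₁ (eq b)))))

  fiber-respects : ∀ {Γ} → IsUnionOf (IsFiber Z) Γ → ∀ {x x′} → colour x x ≡ colour x′ x′ → x ∈ Γ → x′ ∈ Γ
  fiber-respects u {x} {x′} e x∈ with isUnionOf⇒pointwise u x∈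
  ... | Γ′ , f , x∈Γ′ , Γ′⊆ = Γ′⊆ (proj₂ (∈-1⁻ (subst (_⟨ x′ , x′ ⟩) (colour-unique f (∈-1⁺ x∈Γ′)) (colour-≡⁻ e))))

  allFixed⇒complete : (∀ x → IsFixed x) → IsComplete Z
  allFixed⇒complete fixed = allPoints-complete Z λ x → subst S (fiber x) (colour-basic x x)
    where
    fiber : ∀ x → colour x x ≡ 1[ ⁅ x ⁆ ]
    fiber x = relation-ext
      (λ {α} {β} q → case colour-≡⁺ q of λ e → case colour-diagonal e of λ { refl →
        subst (1[ ⁅ x ⁆ ] ⟨ α ,_⟩) refl (∈-1⁺ (subst (_∈ ⁅ x ⁆) (sym (fixed x e)) (x∈⁅x⁆ x))) })
      (λ q → case ∈-1⁻ q of λ { (refl , α∈) → case x∈⁅y⁆⇒x≡y x α∈ of λ { refl → colour-∋ x x } })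

-- Finite fields

least : {P : ℕ → Set} → Decidable P → ∀ n → P n → ∃ λ k → P k × (∀ {j} → j < k → ¬ P j)
least P? zero    pn = 0 , pn , λ ()
least P? (suc n) pn with P? 0
... | yes p₀ = 0 , p₀ , λ ()
... | no ¬p₀ with least (P? ∘ suc) n pn
...   | k , pk , k-least = suc k , pk , λ { {zero} _ → ¬p₀ ; {suc j} (s≤s j<k) → k-least j<k }

-- Prime divisors and prime powers

primeDivisor : ∀ n → 1 < n → ∃ λ l → Prime l × l ∣ n
primeDivisor (suc n) 1<n with factorise (suc n)
... | record { factors = [] ; isFactorisation = refl } = contradiction 1<n λ { (s≤s ()) }
... | record { factors = l ∷ ls ; isFactorisation = e ; factorsPrime = pl ∷ _ } =
  l , pl , subst (l ∣_) (sym e) (m∣m*n _)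

splitPower : ∀ l → 1 < l → ∀ n → n ≢ 0 → ∃₂ λ j n₀ → n ≡ l ℕ.^ j ℕ.* n₀ × l ∤ n₀
splitPower l 1<l n n≢0 = go n n≢0 (<-wellFounded n)
  where
  go : ∀ n → n ≢ 0 → Acc _<_ n → ∃₂ λ j n₀ → n ≡ l ℕ.^ j ℕ.* n₀ × l ∤ n₀
  go n n≢0 (acc rec) with l ∣? n
  ... | no l∤n = 0 , n , sym (ℕ.+-identityʳ n) , l∤n
  ... | yes (divides zero e) = contradiction e n≢0
  ... | yes (divides c@(suc _) e) with go c (λ ()) (rec (subst (c <_) (sym e) (ℕ.m<m*n c l 1<l)))
  ...   | j , n₀ , eq , l∤n₀ = suc j , n₀ , eq′ , l∤n₀
    where
    eq′ : n ≡ l ℕ.^ suc j ℕ.* n₀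
    eq′ = trans e (trans (ℕ.*-comm c l) (trans (cong (l ℕ.*_) eq) (sym (ℕ.*-assoc l (l ℕ.^ j) n₀))))

module _ {l} (pl : Prime l) where

  private instance
    l≢0 : NonZero l
    l≢0 = prime⇒nonZero pl

  prime-power-divisor : ∀ j {a b} → l ∤ a → l ℕ.^ j ∣ a ℕ.* b → l ℕ.^ j ∣ b
  prime-power-divisor zero    {b = b} l∤a d = divides b (sym (ℕ.*-identityʳ b))
  prime-power-divisor (suc j) {a} {b} l∤a d with euclidsLemma a b pl (∣-trans (m∣m*n (l ℕ.^ j)) d)
  ... | inj₁ l∣a = contradiction l∣a l∤a
  ... | inj₂ (divides b′ refl) = subst (l ℕ.* l ℕ.^ j ∣_) (ℕ.*-comm l b′)
    (*-monoʳ-∣ l (prime-power-divisor j l∤a (*-cancelˡ-∣ l (subst (l ℕ.* l ℕ.^ j ∣_) shuffle d))))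
    where
    shuffle : a ℕ.* (b′ ℕ.* l) ≡ l ℕ.* (a ℕ.* b′)
    shuffle = trans (sym (ℕ.*-assoc a b′ l)) (ℕ.*-comm (a ℕ.* b′) l)

  divisor-prime-power : ∀ j {a b} → l ∤ a → a ∣ l ℕ.^ j ℕ.* b → a ∣ b
  divisor-prime-power zero    {a} {b} l∤a d = subst (a ∣_) (ℕ.+-identityʳ b) d
  divisor-prime-power (suc j) {a} {b} l∤a d =
    divisor-prime-power j l∤a (coprime-divisor coprime (subst (a ∣_) (ℕ.*-assoc l (l ℕ.^ j) b) d))
    where
    coprime : Coprime a l
    coprime (d∣a , d∣l) with prime⇒irreducible pl d∣l
    ... | inj₁ d≡1  = d≡1
    ... | inj₂ refl = contradiction d∣a l∤a

-- The points of the configuration are themselves the field elements, with decidable propositional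
-- equality, so that no setoid reasoning is needed in the main argument.
record FieldOn (n : ℕ) : Set where
  infixl 6 _+_
  infixl 7 _*_
  infix  8 -_
  field
    _+_ _*_           : Fin n → Fin n → Fin n
    -_                : Fin n → Fin n
    0# 1#             : Fin n
    isCommutativeRing : IsCommutativeRing _≡_ _+_ _*_ -_ 0# 1#
    0≢1               : 0# ≢ 1#
    invertible        : ∀ {x} → x ≢ 0# → ∃ λ y → x * y ≡ 1#

  commutativeRing : CommutativeRing _ _
  commutativeRing = record { isCommutativeRing = isCommutativeRing }

module FieldTheory {m : ℕ} (𝔽 : FieldOn (suc m)) where

  open FieldOn 𝔽 public
  open CommutativeRing commutativeRing public
    using (_-_; +-assoc; +-comm; +-identityˡ; +-identityʳ; *-assoc; *-comm; *-identityˡ; *-identityʳ; distribʳ; zeroˡ; zeroʳ; -‿inverseʳ; +-commutativeMonoid; *-commutativeMonoid; semiring; commutativeSemiring; ring)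
  open import Algebra.Properties.Ring ring public
    using (-‿involutive; -‿distribˡ-*; -‿distribʳ-*; -0#≈0#; -1*x≈-x)
  open import Algebra.Properties.CommutativeSemiring.Exp commutativeSemiring public
    using (_^_; ^-homo-*; ^-assocʳ; ^-distrib-*)
  private
    module Σ where
      open import Algebra.Properties.Semiring.Sum semiring public
  open import Algebra.Properties.Semiring.Mult semiring public
    using (×-homo-+; ×1-homo-*; ×-assoc-*) renaming (_×_ to infixr 8 _·_)
  open IntegerSolver commutativeRing public using (solve; _:=_; _:+_; _:*_; _:-_; :-_; :0; :1)
  open ≡-Reasoning

  private
    module Π where
      open import Algebra.Properties.CommutativeMonoid.Sum *-commutativeMonoid public

  F : Set
  F = Fin (suc m)

  opaque
    ∑ : ∀ {k} → (Fin k → F) → F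
    ∑ = Σ.sum

    ∑-cong : ∀ {k} {f f′ : Fin k → F} → (∀ i → f i ≡ f′ i) → ∑ f ≡ ∑ f′
    ∑-cong = Σ.sum-cong-≗

    ∑-zero : (f : Fin 0 → F) → ∑ f ≡ 0#
    ∑-zero f = refl

    ∑-suc : ∀ {k} (f : Fin (suc k) → F) → ∑ f ≡ f zero + ∑ (f ∘ suc)
    ∑-suc f = refl

    ∑-+ : ∀ {k} (f f′ : Fin k → F) → ∑ (λ i → f i + f′ i) ≡ ∑ f + ∑ f′
    ∑-+ = Σ.∑-distrib-+

    ∑-swap : ∀ {k l} (f : Fin k → Fin l → F) → ∑ (λ i → ∑ (λ j → f i j)) ≡ ∑ (λ j → ∑ (λ i → f i j))
    ∑-swap = Σ.∑-comm

    ∑-*ˡ : ∀ {k} x (f : Fin k → F) → x * ∑ f ≡ ∑ (λ i → x * f i)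
    ∑-*ˡ = Σ.*-distribˡ-sum

    ∑-*ʳ : ∀ {k} x (f : Fin k → F) → ∑ f * x ≡ ∑ (λ i → f i * x)
    ∑-*ʳ = Σ.*-distribʳ-sum

    ∑-permute : ∀ {k} (f : Fin k → F) (π : Permutation′ k) → ∑ f ≡ ∑ (λ i → f (π ⟨$⟩ʳ i))
    ∑-permute = Σ.sum-permute

    ∑-const : ∀ k x → ∑ {k} (λ _ → x) ≡ k · x
    ∑-const k x = Σ.sum-replicate k

    ∑-0 : ∀ k → ∑ {k} (λ _ → 0#) ≡ 0#
    ∑-0 = Σ.sum-replicate-zero

    ∑-remove : ∀ {k} i (f : Fin (suc k) → F) → ∑ f ≡ f i + ∑ (λ j → f (punchIn i j))
    ∑-remove i f = Σ.sum-remove {i = i} f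

  1≢0 : 1# ≢ 0#
  1≢0 = 0≢1 ∘ sym

  opaque
    zero? : ∀ x → x ≡ 0# ⊎ x ≢ 0#
    zero? x with x ≟ 0#
    ... | yes x≡0 = inj₁ x≡0
    ... | no  x≢0 = inj₂ x≢0

  infix 9 _⁻¹
  opaque
    -- With the convention 0⁻¹ = 0 inversion is multiplicative on the whole field, and character
    -- sums can run over all elements.
    _⁻¹ : F → F
    x ⁻¹ with x ≟ 0#
    ... | yes _   = 0#
    ... | no  x≢0 = proj₁ (invertible x≢0)

    ⁻¹-inverse : ∀ {x} → x ≢ 0# → x * x ⁻¹ ≡ 1#
    ⁻¹-inverse {x} x≢0 with x ≟ 0#
    ... | yes e  = contradiction e x≢0
    ... | no x≢0 = proj₂ (invertible x≢0)

    0⁻¹≡0 : 0# ⁻¹ ≡ 0#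
    0⁻¹≡0 with 0# ≟ 0#
    ... | yes _ = refl
    ... | no ¬e = contradiction refl ¬e

  *-cancelˡ : ∀ {x y z} → x ≢ 0# → x * y ≡ x * z → y ≡ z
  *-cancelˡ {x} {y} {z} x≢0 e = trans (sym (undo y)) (trans (cong (x ⁻¹ *_) e) (undo z))
    where
    undo : ∀ w → x ⁻¹ * (x * w) ≡ w
    undo w = trans (sym (*-assoc _ x w)) (trans (cong (_* w) (trans (*-comm _ x) (⁻¹-inverse x≢0))) (*-identityˡ w))

  *-cancelʳ : ∀ {x y z} → x ≢ 0# → y * x ≡ z * x → y ≡ z
  *-cancelʳ {x} x≢0 e = *-cancelˡ x≢0 (trans (*-comm x _) (trans e (*-comm _ x)))

  opaque
    integral : ∀ {x y} → x * y ≡ 0# → x ≡ 0# ⊎ y ≡ 0#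
    integral {x} {y} e with zero? x
    ... | inj₁ x≡0 = inj₁ x≡0
    ... | inj₂ x≢0 = inj₂ (*-cancelˡ x≢0 (trans e (sym (zeroʳ x))))

  *-≢0 : ∀ {x y} → x ≢ 0# → y ≢ 0# → x * y ≢ 0#
  *-≢0 x≢0 y≢0 e with integral e
  ... | inj₁ x≡0 = x≢0 x≡0
  ... | inj₂ y≡0 = y≢0 y≡0

  factorʳ≢0 : ∀ {x y} → x * y ≢ 0# → y ≢ 0#
  factorʳ≢0 xy≢0 y≡0 = xy≢0 (trans (cong (_ *_) y≡0) (zeroʳ _))

  factorˡ≢0 : ∀ {x y} → x * y ≢ 0# → x ≢ 0#
  factorˡ≢0 xy≢0 x≡0 = xy≢0 (trans (cong (_* _) x≡0) (zeroˡ _))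

  ⁻¹-≢0 : ∀ {x} → x ≢ 0# → x ⁻¹ ≢ 0#
  ⁻¹-≢0 x≢0 = factorʳ≢0 (λ e → 1≢0 (trans (sym (⁻¹-inverse x≢0)) e))

  ⁻¹-unique : ∀ {x y} → x * y ≡ 1# → y ≡ x ⁻¹
  ⁻¹-unique {x} {y} e = *-cancelˡ x≢0 (trans e (sym (⁻¹-inverse x≢0)))
    where
    x≢0 : x ≢ 0#
    x≢0 = factorˡ≢0 (λ e₀ → 1≢0 (trans (sym e) e₀))

  ⁻¹-distrib-* : ∀ x y → (x * y) ⁻¹ ≡ x ⁻¹ * y ⁻¹
  ⁻¹-distrib-* x y with zero? x | zero? y
  ... | inj₁ refl | _ = begin
    (0# * y) ⁻¹  ≡⟨ cong _⁻¹ (zeroˡ y) ⟩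
    0# ⁻¹  ≡⟨ 0⁻¹≡0 ⟩
    0#  ≡⟨ zeroˡ _ ⟨
    0# * y ⁻¹  ≡⟨ cong (_* y ⁻¹) 0⁻¹≡0 ⟨
    0# ⁻¹ * y ⁻¹  ∎
  ... | inj₂ _ | inj₁ refl = begin
    (x * 0#) ⁻¹  ≡⟨ cong _⁻¹ (zeroʳ x) ⟩
    0# ⁻¹  ≡⟨ 0⁻¹≡0 ⟩
    0#  ≡⟨ zeroʳ _ ⟨
    x ⁻¹ * 0#  ≡⟨ cong (x ⁻¹ *_) 0⁻¹≡0 ⟨
    x ⁻¹ * 0# ⁻¹  ∎
  ... | inj₂ x≢0 | inj₂ y≢0 = sym (⁻¹-unique (begin
    (x * y) * (x ⁻¹ * y ⁻¹)  ≡⟨ solve 4 (λ a b c d → (a :* b) :* (c :* d) := (a :* c) :* (b :* d)) refl x y (x ⁻¹) (y ⁻¹) ⟩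
    (x * x ⁻¹) * (y * y ⁻¹)  ≡⟨ cong₂ _*_ (⁻¹-inverse x≢0) (⁻¹-inverse y≢0) ⟩
    1# * 1#  ≡⟨ *-identityˡ 1# ⟩
    1#  ∎))

  ⁻¹-involutive : ∀ x → x ⁻¹ ⁻¹ ≡ x
  ⁻¹-involutive x with zero? x
  ... | inj₁ refl = trans (cong _⁻¹ 0⁻¹≡0) 0⁻¹≡0
  ... | inj₂ x≢0  = sym (⁻¹-unique (trans (*-comm _ x) (⁻¹-inverse x≢0)))

  1⁻¹≡1 : 1# ⁻¹ ≡ 1#
  1⁻¹≡1 = sym (⁻¹-unique (*-identityˡ 1#))

  1^ : ∀ n → 1# ^ n ≡ 1#
  1^ zero    = refl
  1^ (suc n) = trans (*-identityˡ _) (1^ n)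

  ^-multiple : ∀ x n k → x ^ n ≡ 1# → x ^ (n ℕ.* k) ≡ 1#
  ^-multiple x n k e = trans (sym (^-assocʳ x n k)) (trans (cong (_^ k) e) (1^ k))

  ^-≢0 : ∀ {x} n → x ≢ 0# → x ^ n ≢ 0#
  ^-≢0 zero    x≢0 = 1≢0
  ^-≢0 (suc n) x≢0 = *-≢0 x≢0 (^-≢0 n x≢0)

  x-y≡0⇒x≡y : ∀ {x y} → x - y ≡ 0# → x ≡ y
  x-y≡0⇒x≡y {x} {y} e = begin
    x  ≡⟨ solve 2 (λ x y → x := (x :- y) :+ y) refl x y ⟩
    (x - y) + y  ≡⟨ cong (_+ y) e ⟩
    0# + y  ≡⟨ +-identityˡ y ⟩
    y  ∎

  [-1]^even : ∀ n → (- 1#) ^ (n ℕ.+ n) ≡ 1#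
  [-1]^even n = begin
    (- 1#) ^ (n ℕ.+ n)  ≡⟨ ^-homo-* (- 1#) n n ⟩
    (- 1#) ^ n * (- 1#) ^ n  ≡⟨ ^-distrib-* (- 1#) (- 1#) n ⟨
    (- 1# * - 1#) ^ n  ≡⟨ cong (_^ n) (solve 0 ((:- :1) :* (:- :1) := :1) refl) ⟩
    1# ^ n  ≡⟨ 1^ n ⟩
    1#  ∎

  neg-^-odd : ∀ {n k} → n ≡ suc (k ℕ.+ k) → ∀ x → (- x) ^ n ≡ - x ^ n
  neg-^-odd {n} {k} refl x = begin
    (- x) ^ n  ≡⟨ cong (_^ n) (-1*x≈-x x) ⟨
    (- 1# * x) ^ n  ≡⟨ ^-distrib-* (- 1#) x n ⟩
    (- 1#) ^ n * x ^ n  ≡⟨ cong (_* x ^ n) (trans (cong (- 1# *_) ([-1]^even k)) (*-identityʳ _)) ⟩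
    - 1# * x ^ n  ≡⟨ -1*x≈-x _ ⟩
    - x ^ n  ∎

  x≡-x⇒x≡0 : 1# + 1# ≢ 0# → ∀ {x} → x ≡ - x → x ≡ 0#
  x≡-x⇒x≡0 2≢0 {x} e = fromDouble (integral {1# + 1#} {x} (begin
      (1# + 1#) * x  ≡⟨ solve 1 (λ x → (:1 :+ :1) :* x := x :+ x) refl x ⟩
      x + x  ≡⟨ cong (x +_) e ⟩
      x - x  ≡⟨ -‿inverseʳ x ⟩
      0#  ∎))
    where
    fromDouble : 1# + 1# ≡ 0# ⊎ x ≡ 0# → x ≡ 0#
    fromDouble (inj₁ e₂) = contradiction e₂ 2≢0
    fromDouble (inj₂ e₀) = e₀

  neg-≢0 : ∀ {x} → x ≢ 0# → - x ≢ 0#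
  neg-≢0 {x} x≢0 e = x≢0 (trans (sym (-‿involutive x)) (trans (cong -_ e) -0#≈0#))

  scaling : ∀ {x} → x ≢ 0# → Permutation′ (suc m)
  scaling {x} x≢0 = Perm.permutation (x *_) (x ⁻¹ *_)
    (λ w → trans (sym (*-assoc x _ w)) (trans (cong (_* w) (⁻¹-inverse x≢0)) (*-identityˡ w)))
    (λ w → trans (sym (*-assoc _ x w)) (trans (cong (_* w) (trans (*-comm _ x) (⁻¹-inverse x≢0))) (*-identityˡ w)))

  -- Multiplication by `x` permutes the nonzero elements, so their product P satisfies xᵐ P = P. The
  -- element 0 is counted as a factor 1.
  fermat : ∀ {x} → x ≢ 0# → x ^ m ≡ 1#
  fermat {x} x≢0 = *-cancelʳ P≢0 (begin
    x ^ m * P  ≡⟨ cong (_* P) ∏c ⟨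
    Π.sum c * P  ≡⟨ Π.∑-distrib-+ c unit ⟨
    Π.sum (λ w → c w * unit w)  ≡⟨ Π.sum-cong-≗ moved ⟨
    Π.sum (λ w → unit (x * w))  ≡⟨ Π.sum-permute unit (scaling x≢0) ⟨
    P  ≡⟨ *-identityˡ P ⟨
    1# * P  ∎)
    where
    ifZero : F → F → F → F
    ifZero w a b with w ≟ 0#
    ... | yes _ = a
    ... | no _  = b
    unit c : F → F
    unit w = ifZero w 1# w
    c w = ifZero w 1# x
    P = Π.sum unit
    unit≢0 : ∀ w → unit w ≢ 0#
    unit≢0 w with w ≟ 0#
    ... | yes _ = 1≢0
    ... | no w≢0 = w≢0
    ∏≢0 : ∀ {k} (f : Fin k → F) → (∀ i → f i ≢ 0#) → Π.sum f ≢ 0#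
    ∏≢0 {zero}  f h = 1≢0
    ∏≢0 {suc k} f h = *-≢0 (h zero) (∏≢0 (f ∘ suc) (h ∘ suc))
    P≢0 : P ≢ 0#
    P≢0 = ∏≢0 unit unit≢0
    moved : ∀ w → unit (x * w) ≡ c w * unit w
    moved w with w ≟ 0# | (x * w) ≟ 0#
    ... | yes _    | yes _   = sym (*-identityˡ 1#)
    ... | yes refl | no xw≢0 = contradiction (zeroʳ x) xw≢0
    ... | no w≢0   | yes e   = contradiction e (*-≢0 x≢0 w≢0)
    ... | no _     | no _    = refl
    c-zero : c 0# ≡ 1#
    c-zero with 0# ≟ 0#
    ... | yes _ = refl
    ... | no ¬e = contradiction refl ¬e
    c-rest : ∀ i → c (punchIn 0# i) ≡ x
    c-rest i with punchIn 0# i ≟ 0#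
    ... | yes e = contradiction e (Fin.punchInᵢ≢i 0# i)
    ... | no _  = refl
    ∏c : Π.sum c ≡ x ^ m
    ∏c = begin
      Π.sum c  ≡⟨ Π.sum-remove {i = 0#} c ⟩
      c 0# * Π.sum (λ i → c (punchIn 0# i))  ≡⟨ cong₂ _*_ c-zero (Π.sum-cong-≗ c-rest) ⟩
      1# * Π.sum {m} (λ _ → x)  ≡⟨ *-identityˡ _ ⟩
      Π.sum {m} (λ _ → x)  ≡⟨ Π.sum-replicate m ⟩
      x ^ m  ∎

  m≢0 : m ≢ 0
  m≢0 refl with 0# | 1# | 0≢1
  ... | zero | zero | ¬e = ¬e refl

  -- monic cs is the monic polynomial whose lower coefficients are cs,
  -- constant term first.
  monic : ∀ {n} → Vec F n → F → F
  monic []       x = 1#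
  monic (c ∷ cs) x = c + x * monic cs x

  -- Synthetic division by X - a.
  quotient : ∀ {n} → Vec F (suc n) → F → Vec F n
  quotient (c ∷ [])         a = []
  quotient (c ∷ cs@(_ ∷ _)) a = monic cs a ∷ quotient cs a

  monic-quotient : ∀ {n} (cs : Vec F (suc n)) a x →
                   monic cs x - monic cs a ≡ (x - a) * monic (quotient cs a) x
  monic-quotient (c ∷ []) a x =
    solve 3 (λ c a x → (c :+ x :* :1) :- (c :+ a :* :1) := (x :- a) :* :1) refl c a x
  monic-quotient (c ∷ cs@(_ ∷ _)) a x = begin
    (c + x * R x) - (c + a * R a)
      ≡⟨ solve 5 (λ c a x r s → (c :+ x :* r) :- (c :+ a :* s) := x :* (r :- s) :+ (x :- a) :* s) refl c a x (R x) (R a) ⟩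
    x * (R x - R a) + (x - a) * R a
      ≡⟨ cong (λ z → x * z + (x - a) * R a) (monic-quotient cs a x) ⟩
    x * ((x - a) * Q) + (x - a) * R a
      ≡⟨ solve 4 (λ a x q s → x :* ((x :- a) :* q) :+ (x :- a) :* s := (x :- a) :* (s :+ x :* q)) refl a x Q (R a) ⟩
    (x - a) * (R a + x * Q) ∎
    where
    R = monic cs
    Q = monic (quotient cs a) x

  roots≤degree : ∀ {n k} (cs : Vec F n) (f : Fin k → F) → (∀ {i j} → f i ≡ f j → i ≡ j) →
                 (∀ i → monic cs (f i) ≡ 0#) → k ≤ n
  roots≤degree {k = zero}  cs       f inj root = z≤n
  roots≤degree {k = suc k} []       f inj root = contradiction (root zero) 1≢0
  roots≤degree {k = suc k} cs@(_ ∷ _) f inj root =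
    s≤s (roots≤degree (quotient cs (f zero)) (f ∘ suc) (Fin.suc-injective ∘ inj) λ i →
      case integral (trans (sym (monic-quotient cs (f zero) (f (suc i)))) (difference i)) of λ
        { (inj₁ e) → case inj (x-y≡0⇒x≡y e) of λ () ; (inj₂ e) → e })
    where
    difference : ∀ i → monic cs (f (suc i)) - monic cs (f zero) ≡ 0#
    difference i = trans (cong₂ _-_ (root (suc i)) (root zero)) (-‿inverseʳ 0#)

  x^n-1 : ∀ n x → monic (- 1# ∷ replicate n 0#) x ≡ x ^ suc n - 1#
  x^n-1 n x = begin
    - 1# + x * monic (replicate n 0#) x  ≡⟨ cong (λ z → - 1# + x * z) (power n) ⟩
    - 1# + x * x ^ n  ≡⟨ +-comm (- 1#) _ ⟩
    x * x ^ n - 1#  ∎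
    where
    power : ∀ n → monic (replicate n 0#) x ≡ x ^ n
    power zero    = refl
    power (suc n) = trans (+-identityˡ _) (cong (x *_) (power n))

  -- Orders of elements and a generator of the multiplicative group

  HasOrder : F → ℕ → Set
  HasOrder x n = x ^ n ≡ 1# × (∀ k → x ^ k ≡ 1# → n ∣ k)

  order : ∀ {x} → x ≢ 0# → ∃ (HasOrder x)
  order {x} x≢0 with least (λ k → (1 ℕ.≤? k) ×-dec (x ^ k ≟ 1#)) m (ℕ.n≢0⇒n>0 m≢0 , fermat x≢0)
  ... | n@(suc _) , (_ , xⁿ≡1) , n-least = n , xⁿ≡1 , divide
    where
    remainder : ∀ k → x ^ k ≡ 1# → x ^ (k % n) ≡ 1#
    remainder k e = begin
      x ^ (k % n)  ≡⟨ *-identityʳ _ ⟨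
      x ^ (k % n) * 1#  ≡⟨ cong (x ^ (k % n) *_) (1^ (k / n)) ⟨
      x ^ (k % n) * 1# ^ (k / n)  ≡⟨ cong (λ z → x ^ (k % n) * z ^ (k / n)) xⁿ≡1 ⟨
      x ^ (k % n) * (x ^ n) ^ (k / n)  ≡⟨ cong (x ^ (k % n) *_) (^-assocʳ x n (k / n)) ⟩
      x ^ (k % n) * x ^ (n ℕ.* (k / n))  ≡⟨ cong (λ z → x ^ (k % n) * x ^ z) (ℕ.*-comm n (k / n)) ⟩
      x ^ (k % n) * x ^ (k / n ℕ.* n)  ≡⟨ ^-homo-* x (k % n) _ ⟨
      x ^ (k % n ℕ.+ k / n ℕ.* n)  ≡⟨ cong (x ^_) (m≡m%n+[m/n]*n k n) ⟨
      x ^ k  ≡⟨ e ⟩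
      1#  ∎
    divide : ∀ k → x ^ k ≡ 1# → n ∣ k
    divide k e with k % n in eq | remainder k e
    ... | zero  | _ = divides (k / n) (trans (m≡m%n+[m/n]*n k n) (cong (ℕ._+ k / n ℕ.* n) eq))
    ... | suc r | e′ = contradiction (s≤s z≤n , e′) (n-least (subst (_< n) eq (m%n<n k n)))

  order-power : ∀ {x d n} → d ≢ 0 → HasOrder x (d ℕ.* n) → HasOrder (x ^ d) n
  order-power {x} {suc d-1} {n} _ (e , div) = trans (^-assocʳ x d n) e ,
    λ k e′ → *-cancelˡ-∣ d (div (d ℕ.* k) (trans (sym (^-assocʳ x d k)) e′))
    where d = suc d-1
  order-power {d = zero} d≢0 _ = contradiction refl d≢0

  order-product : ∀ {a b n l j} → Prime l → l ∤ n → HasOrder a n → HasOrder b (l ℕ.^ j) →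
                  HasOrder (a * b) (l ℕ.^ j ℕ.* n)
  order-product {a} {b} {n} {l} {j} pl l∤n (aⁿ , diva) (bᵛ , divb) = one , div
    where
    v = l ℕ.^ j
    one : (a * b) ^ (v ℕ.* n) ≡ 1#
    one = begin
      (a * b) ^ (v ℕ.* n)  ≡⟨ ^-distrib-* a b (v ℕ.* n) ⟩
      a ^ (v ℕ.* n) * b ^ (v ℕ.* n)  ≡⟨ cong (λ z → a ^ z * b ^ (v ℕ.* n)) (ℕ.*-comm v n) ⟩
      a ^ (n ℕ.* v) * b ^ (v ℕ.* n)  ≡⟨ cong₂ _*_ (^-multiple a n v aⁿ) (^-multiple b v n bᵛ) ⟩
      1# * 1#  ≡⟨ *-identityˡ 1# ⟩
      1#  ∎
    div : ∀ k → (a * b) ^ k ≡ 1# → v ℕ.* n ∣ k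
    div k e with divisor-prime-power pl j l∤n (diva (v ℕ.* k) a-part) | prime-power-divisor pl j l∤n (divb (n ℕ.* k) b-part)
      where
      both : ∀ r → a ^ (r ℕ.* k) * b ^ (r ℕ.* k) ≡ 1#
      both r = begin
        a ^ (r ℕ.* k) * b ^ (r ℕ.* k)  ≡⟨ ^-distrib-* a b (r ℕ.* k) ⟨
        (a * b) ^ (r ℕ.* k)  ≡⟨ cong ((a * b) ^_) (ℕ.*-comm r k) ⟩
        (a * b) ^ (k ℕ.* r)  ≡⟨ ^-multiple (a * b) k r e ⟩
        1#  ∎
      a-part : a ^ (v ℕ.* k) ≡ 1#
      a-part = begin
        a ^ (v ℕ.* k)  ≡⟨ *-identityʳ _ ⟨
        a ^ (v ℕ.* k) * 1#  ≡⟨ cong (a ^ (v ℕ.* k) *_) (^-multiple b v k bᵛ) ⟨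
        a ^ (v ℕ.* k) * b ^ (v ℕ.* k)  ≡⟨ both v ⟩
        1#  ∎
      b-part : b ^ (n ℕ.* k) ≡ 1#
      b-part = begin
        b ^ (n ℕ.* k)  ≡⟨ *-identityˡ _ ⟨
        1# * b ^ (n ℕ.* k)  ≡⟨ cong (_* b ^ (n ℕ.* k)) (^-multiple a n k aⁿ) ⟨
        a ^ (n ℕ.* k) * b ^ (n ℕ.* k)  ≡⟨ both n ⟩
        1#  ∎
    ... | divides c refl | v∣k = subst (v ℕ.* n ∣_) (ℕ.*-comm n c)
      (subst (_∣ n ℕ.* c) (ℕ.*-comm n v) (*-monoʳ-∣ n (prime-power-divisor pl j l∤n (subst (v ∣_) (ℕ.*-comm c n) v∣k))))

  order-≢0 : ∀ {x n} → x ≢ 0# → HasOrder x n → n ≢ 0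
  order-≢0 x≢0 (_ , div) refl with div m (fermat x≢0)
  ... | divides c e = m≢0 (trans e (ℕ.*-zeroʳ c))

  -- Choose a prime l dividing k / gcd k n, and write n = lʲ n₀ with l ∤ n₀. Then lʲ divides the
  -- gcd, so lʲ⁺¹ divides k. The element g^(lʲ) and a suitable power of `x` have the coprime orders
  -- n₀ and lʲ⁺¹, and their product has order l n.
  larger-order : ∀ {g x n k} → g ≢ 0# → x ≢ 0# → HasOrder g n → HasOrder x k → k ∤ n →
                 ∃₂ λ g′ n′ → g′ ≢ 0# × HasOrder g′ n′ × n < n′
  larger-order {g} {x} {n} {k} g≢0 x≢0 og ox k∤n
    with gcd[m,n]∣m k n | gcd[m,n]∣n k n
  ... | divides k′ ek | divides n′ en with primeDivisor k′ (1<cofactor k′ ek)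
    where
    1<cofactor : ∀ c → k ≡ c ℕ.* gcd k n → 1 < c
    1<cofactor zero          e = contradiction e (order-≢0 x≢0 ox)
    1<cofactor (suc zero)    e = contradiction (subst (_∣ n) (sym (trans e (ℕ.+-identityʳ _))) (gcd[m,n]∣n k n)) k∤n
    1<cofactor (suc (suc _)) e = s≤s (s≤s z≤n)
  ...   | l , pl , l∣k′ with splitPower l (ℕ.nonTrivial⇒n>1 l {{prime⇒nonTrivial pl}}) n (order-≢0 g≢0 og)
  ...     | j , n₀ , refl , l∤n₀ = enlarge (*-pres-∣ l∣k′ lʲ∣d)
    where
    instance
      l≢0 : NonZero l
      l≢0 = prime⇒nonZero pl
    N = l ℕ.^ j ℕ.* n₀
    d = gcd k N
    d≢0 : d ≢ 0
    d≢0 e = order-≢0 g≢0 og (trans en (trans (cong (n′ ℕ.*_) e) (ℕ.*-zeroʳ n′)))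
    l∤n′ : l ∤ n′
    l∤n′ l∣n′ = ℕ.<⇒≱ (ℕ.m<m*n d l {{ℕ.≢-nonZero d≢0}} (ℕ.nonTrivial⇒n>1 l {{prime⇒nonTrivial pl}}))
      (∣⇒≤ {{ℕ.≢-nonZero d≢0}} (gcd-greatest (subst (d ℕ.* l ∣_) (sym (trans ek (ℕ.*-comm k′ d))) (*-monoʳ-∣ d l∣k′))
                                             (subst (d ℕ.* l ∣_) (sym (trans en (ℕ.*-comm n′ d))) (*-monoʳ-∣ d l∣n′))))
    lʲ∣d : l ℕ.^ j ∣ d
    lʲ∣d = prime-power-divisor pl j l∤n′ (subst (l ℕ.^ j ∣_) en (m∣m*n n₀))
    enlarge : l ℕ.* l ℕ.^ j ∣ k′ ℕ.* d → ∃₂ λ g′ n′ → g′ ≢ 0# × HasOrder g′ n′ × N < n′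
    enlarge (divides c e) = g ^ (l ℕ.^ j) * x ^ c , l ℕ.^ suc j ℕ.* n₀
      , *-≢0 (^-≢0 (l ℕ.^ j) g≢0) (^-≢0 c x≢0)
      , order-product {j = suc j} pl l∤n₀ (order-power (ℕ.≢-nonZero⁻¹ _ {{ℕ.m^n≢0 l j}}) og)
          (order-power c≢0 (subst (HasOrder x) ek′ ox))
      , subst (N <_) (sym (ℕ.*-assoc l (l ℕ.^ j) n₀))
          (subst (N <_) (ℕ.*-comm N l) (ℕ.m<m*n N l {{ℕ.≢-nonZero (order-≢0 g≢0 og)}} (ℕ.nonTrivial⇒n>1 l {{prime⇒nonTrivial pl}})))
      where
      ek′ : k ≡ c ℕ.* l ℕ.^ suc j
      ek′ = trans ek e
      c≢0 : c ≢ 0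
      c≢0 refl = order-≢0 x≢0 ox ek′

  -- An element of order n is improved until n = m: if every nonzero x satisfies xⁿ = 1, then Xⁿ - 1
  -- has m roots and m ≤ n. The fuel bounds m - n, which drops at each improvement.
  generator : ∃ λ g → g ≢ 0# × HasOrder g m
  generator with order 1≢0
  ... | n , o1 = search m 1# n 1≢0 o1 (ℕ.m≤n+m m n)
    where
    bounded : ∀ {g n} → g ≢ 0# → HasOrder g n → n ≤ m
    bounded g≢0 (_ , div) = ∣⇒≤ {{ℕ.≢-nonZero m≢0}} (div m (fermat g≢0))
    search : ∀ fuel g n → g ≢ 0# → HasOrder g n → m ≤ n ℕ.+ fuel → ∃ λ g → g ≢ 0# × HasOrder g m
    search zero g n g≢0 og m≤n = g , g≢0 , subst (HasOrder g)
      (ℕ.≤-antisym (bounded g≢0 og) (subst (m ≤_) (ℕ.+-identityʳ n) m≤n)) og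
    search (suc fuel) g n g≢0 og m≤n with any? (λ x → ¬? (x ≟ 0#) ×-dec ¬? (x ^ n ≟ 1#))
    ... | yes (x , x≢0 , xⁿ≢1) with order x≢0
    ...   | k , ox with larger-order g≢0 x≢0 og ox (λ { (divides c refl) → xⁿ≢1
              (trans (cong (x ^_) (ℕ.*-comm c k)) (^-multiple x k c (proj₁ ox))) })
    ...     | g′ , n′ , g′≢0 , og′ , n<n′ = search fuel g′ n′ g′≢0 og′
      (ℕ.≤-trans m≤n (subst (_≤ n′ ℕ.+ fuel) (sym (ℕ.+-suc n fuel)) (ℕ.+-monoˡ-≤ fuel n<n′)))
    search (suc fuel) g n g≢0 og m≤n | no ¬∃ with n in en
    ... | zero  = contradiction refl (order-≢0 g≢0 og)
    ... | suc n′ = g , g≢0 , subst (HasOrder g) (ℕ.≤-antisym (bounded g≢0 og)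
        (roots≤degree (- 1# ∷ replicate n′ 0#) (punchIn 0#) (Fin.punchIn-injective 0# _ _) root)) og
      where
      root : ∀ i → monic (- 1# ∷ replicate n′ 0#) (punchIn 0# i) ≡ 0#
      root i = trans (x^n-1 n′ _) (trans (cong (_- 1#) (decidable-stable (_ ≟ _) λ ¬e → ¬∃ (punchIn 0# i , Fin.punchInᵢ≢i 0# i , ¬e))) (-‿inverseʳ 1#))

-- The sum 1 + p + ⋯ + pʳ⁻¹, that is (pʳ - 1)/(p - 1).
repunit : ℕ → ℕ → ℕ
repunit p zero    = 0
repunit p (suc r) = 1 ℕ.+ p ℕ.* repunit p r

repunit-power : ∀ c r → suc c ℕ.^ r ≡ suc (c ℕ.* repunit (suc c) r)
repunit-power c zero    = cong suc (sym (ℕ.*-zeroʳ c))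
repunit-power c (suc r) = begin
  p ℕ.* p ℕ.^ r  ≡⟨ cong (p ℕ.*_) (repunit-power c r) ⟩
  p ℕ.* suc (c ℕ.* R)  ≡⟨ ℕ.*-suc p (c ℕ.* R) ⟩
  suc (c ℕ.+ p ℕ.* (c ℕ.* R))  ≡⟨ cong (λ z → suc (c ℕ.+ z)) (trans (sym (ℕ.*-assoc p c R)) (trans (cong (ℕ._* R) (ℕ.*-comm p c)) (ℕ.*-assoc c p R))) ⟩
  suc (c ℕ.+ c ℕ.* (p ℕ.* R))  ≡⟨ cong suc (ℕ.*-suc c (p ℕ.* R)) ⟨
  suc (c ℕ.* suc (p ℕ.* R))  ∎
  where
  open ≡-Reasoning
  p = suc c
  R = repunit p r

halve : ∀ n → (∃ λ k → n ≡ k ℕ.+ k) ⊎ (∃ λ k → n ≡ suc (k ℕ.+ k))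
halve zero    = inj₁ (0 , refl)
halve (suc n) with halve n
... | inj₁ (k , refl) = inj₂ (k , refl)
... | inj₂ (k , refl) = inj₁ (suc k , cong suc (sym (ℕ.+-suc k k)))

-- The characteristic, and the number of elements as a power of it

module Characteristic {m : ℕ} (𝔽 : FieldOn (suc m)) where

  open FieldTheory 𝔽
  open ≡-Reasoning

  translation : F → Permutation′ (suc m)
  translation a = Perm.permutation (_+ a) (_- a)
    (λ w → solve 2 (λ w a → (w :- a) :+ a := w) refl w a)
    (λ w → solve 2 (λ w a → (w :+ a) :- a := w) refl w a)

  -- Translation by 1 permutes the field, so adding 1 to every element does not change the sum of
  -- all elements.
  size·1≡0 : suc m · 1# ≡ 0#
  size·1≡0 = begin
    suc m · 1#  ≡⟨ ∑-const (suc m) 1# ⟨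
    ∑ {suc m} (λ _ → 1#)  ≡⟨ solve 2 (λ s t → t := (s :+ t) :- s) refl (∑ {suc m} (λ w → w)) _ ⟩
    (∑ (λ w → w) + ∑ {suc m} (λ _ → 1#)) - ∑ (λ w → w)
      ≡⟨ cong (_- ∑ (λ w → w)) (trans (sym (∑-+ (λ w → w) (λ _ → 1#))) (sym (∑-permute (λ w → w) (translation 1#)))) ⟩
    ∑ (λ w → w) - ∑ {suc m} (λ w → w)  ≡⟨ -‿inverseʳ _ ⟩
    0#  ∎

  ·-* : ∀ n x → n · x ≡ n · 1# * x
  ·-* n x = sym (trans (×-assoc-* n 1# x) (cong (n ·_) (*-identityˡ x)))

  ·-^ : ∀ n k → (n ℕ.^ k) · 1# ≡ (n · 1#) ^ k
  ·-^ n zero    = +-identityʳ 1#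
  ·-^ n (suc k) = trans (×1-homo-* n (n ℕ.^ k)) (cong (n · 1# *_) (·-^ n k))

  record IsCharacteristic (p : ℕ) : Set where
    field
      p>1    : 1 < p
      p·1≡0  : p · 1# ≡ 0#
      j·1≢0  : ∀ {j} → 0 < j → j < p → j · 1# ≢ 0#

  characteristic : ∃ IsCharacteristic
  characteristic = fromLeast (least (λ k → (1 ℕ.≤? k) ×-dec (k · 1# ≟ 0#)) (suc m) (s≤s z≤n , size·1≡0))
    where
    Kills : ℕ → Set
    Kills k = 1 ≤ k × k · 1# ≡ 0#
    fromLeast : (∃ λ k → Kills k × (∀ {j} → j < k → ¬ Kills j)) → ∃ IsCharacteristic
    fromLeast (suc zero    , (_ , e) , _)       = contradiction (trans (sym (+-identityʳ 1#)) e) 1≢0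
    fromLeast (suc (suc k) , (_ , e) , k-least) = suc (suc k) , record
      { p>1 = s≤s (s≤s z≤n) ; p·1≡0 = e ; j·1≢0 = λ 0<j j<p e′ → k-least j<p (0<j , e′) }

  module _ {p : ℕ} (isChar : IsCharacteristic p) where

    open IsCharacteristic isChar

    odd-characteristic : 1# + 1# ≢ 0# → ∃ λ h → p ≡ suc (h ℕ.+ h)
    odd-characteristic 2≢0 with halve p
    ... | inj₂ odd = odd
    ... | inj₁ (k , refl) with integral (trans (sym (×1-homo-* 2 k)) (trans (cong (λ z → (k ℕ.+ z) · 1#) (ℕ.+-identityʳ k)) p·1≡0))
    ...   | inj₁ e = contradiction (trans (cong (1# +_) (sym (+-identityʳ 1#))) e) 2≢0
    ...   | inj₂ e = contradiction e (j·1≢0 0<k (ℕ.m<m+n k 0<k))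
      where
      0<k : 0 < k
      0<k = ℕ.n≢0⇒n>0 λ { refl → case p>1 of λ () }

    private
      record Subspace (i : ℕ) : Set where
        field
          vector    : Fin (p ℕ.^ i) → F
          injective : ∀ {s t} → vector s ≡ vector t → s ≡ t
          zeroed    : ∃ λ s → vector s ≡ 0#
          closed    : ∀ s t → ∃ λ u → vector u ≡ vector s + vector t

        Span : F → Set
        Span x = ∃ λ s → vector s ≡ x

        span? : ∀ x → Dec (Span x)
        span? x = any? λ s → vector s ≟ x

        span-+ : ∀ {x y} → Span x → Span y → Span (x + y)
        span-+ (s , refl) (t , refl) = closed s t

        span-· : ∀ n {x} → Span x → Span (n · x)
        span-· zero    _  = zeroed
        span-· (suc n) sx = span-+ sx (span-· n sx)

        span-neg : ∀ {x} → Span x → Span (- x)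
        span-neg {x} sx = subst Span neg (span-· m sx)
          where
          neg : m · x ≡ - x
          neg = begin
            m · x  ≡⟨ solve 2 (λ x y → y := (x :+ y) :- x) refl x (m · x) ⟩
            suc m · x - x  ≡⟨ cong (_- x) (·-* (suc m) x) ⟩
            suc m · 1# * x - x  ≡⟨ cong (λ z → z * x - x) size·1≡0 ⟩
            0# * x - x  ≡⟨ solve 1 (λ x → :0 :* x :- x := :- x) refl x ⟩
            - x  ∎

        -- The inverse of j modulo p is j ^ (m - 1), by Fermat in 𝔽.
        span-divide : ∀ {j x} → 0 < j → j < p → Span (j · x) → Span x
        span-divide {j} {x} 0<j j<p sjx = subst Span undo (span-· (j ℕ.^ m′) sjx)
          where
          m′ = ℕ.pred m
          m≡ : m ≡ suc m′
          m≡ = sym (ℕ.suc-pred m {{ℕ.≢-nonZero m≢0}})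
          undo : (j ℕ.^ m′) · (j · x) ≡ x
          undo = begin
            (j ℕ.^ m′) · (j · x)  ≡⟨ ·-* (j ℕ.^ m′) (j · x) ⟩
            (j ℕ.^ m′) · 1# * j · x  ≡⟨ cong₂ _*_ (·-^ j m′) (·-* j x) ⟩
            (j · 1#) ^ m′ * (j · 1# * x)  ≡⟨ solve 3 (λ a b c → a :* (b :* c) := (b :* a) :* c) refl ((j · 1#) ^ m′) (j · 1#) x ⟩
            (j · 1#) ^ suc m′ * x  ≡⟨ cong (λ k → (j · 1#) ^ k * x) m≡ ⟨
            (j · 1#) ^ m * x  ≡⟨ cong (_* x) (fermat (j·1≢0 0<j j<p)) ⟩
            1# * x  ≡⟨ *-identityˡ x ⟩
            x  ∎

      trivial : Subspace 0
      trivial = record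
        { vector = λ _ → 0# ; injective = λ { {zero} {zero} _ → refl }
        ; zeroed = zero , refl ; closed = λ _ _ → zero , sym (+-identityˡ 0#) }

      -- The cosets a x + V with a < p are disjoint: if two of them met, V would contain (b - a) x
      -- with 0 < b - a < p, hence also x. So adjoining x multiplies the size by exactly p.
      extend : ∀ {i} (V : Subspace i) x → ¬ Subspace.Span V x → Subspace (suc i)
      extend {i} V x x∉V = record
        { vector    = λ s → value (proj₁ (parts s)) (proj₂ (parts s))
        ; injective = λ {s} {t} e → trans (sym (Fin.combine-remQuot {p} (p ℕ.^ i) s))
            (trans (cong (λ { (a , b) → combine a b }) (value-injective _ _ _ _ e)) (Fin.combine-remQuot {p} (p ℕ.^ i) t))
        ; zeroed    = value-surjective 0 (ℕ.<-trans (s≤s z≤n) p>1) zeroed (sym (+-identityˡ 0#))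
        ; closed    = λ s t → add (proj₁ (parts s)) (proj₂ (parts s)) (proj₁ (parts t)) (proj₂ (parts t))
        }
        where
        open Subspace V
        parts : Fin (p ℕ.^ suc i) → Fin p × Fin (p ℕ.^ i)
        parts = remQuot {p} (p ℕ.^ i)
        value : Fin p → Fin (p ℕ.^ i) → F
        value a s = toℕ a · x + vector s
        value-surjective : ∀ k → k < p → ∀ {y z} → Span y → z ≡ k · x + y → ∃ λ s → value (proj₁ (parts s)) (proj₂ (parts s)) ≡ z
        value-surjective k k<p {z = z} (s , refl) e = combine (fromℕ< k<p) s , (begin
          value (proj₁ (parts (combine (fromℕ< k<p) s))) (proj₂ (parts (combine (fromℕ< k<p) s)))
            ≡⟨ cong (λ q → value (proj₁ q) (proj₂ q)) (Fin.remQuot-combine (fromℕ< k<p) s) ⟩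
          toℕ (fromℕ< k<p) · x + vector s  ≡⟨ cong (λ k → k · x + vector s) (Fin.toℕ-fromℕ< k<p) ⟩
          k · x + vector s  ≡⟨ e ⟨
          z  ∎)
        distinct : ∀ a b s t → a < b → b < p → a · x + vector s ≢ b · x + vector t
        distinct a b s t a<b b<p e = x∉V (span-divide (ℕ.m<n⇒0<n∸m a<b) (ℕ.≤-<-trans (ℕ.m∸n≤m b a) b<p)
          (subst Span difference (span-+ (s , refl) (span-neg (t , refl)))))
          where
          difference : vector s - vector t ≡ (b ∸ a) · x
          difference = begin
            vector s - vector t  ≡⟨ solve 3 (λ s t y → s :- t := (y :+ s) :- y :- t) refl (vector s) (vector t) (a · x) ⟩
            (a · x + vector s) - a · x - vector t  ≡⟨ cong (λ z → z - a · x - vector t) e ⟩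
            (b · x + vector t) - a · x - vector t  ≡⟨ cong (λ b → (b · x + vector t) - a · x - vector t) (sym (ℕ.m+[n∸m]≡n (ℕ.<⇒≤ a<b))) ⟩
            ((a ℕ.+ (b ∸ a)) · x + vector t) - a · x - vector t  ≡⟨ cong (λ z → (z + vector t) - a · x - vector t) (×-homo-+ x a (b ∸ a)) ⟩
            ((a · x + (b ∸ a) · x) + vector t) - a · x - vector t
              ≡⟨ solve 3 (λ u v t → ((u :+ v) :+ t) :- u :- t := v) refl (a · x) ((b ∸ a) · x) (vector t) ⟩
            (b ∸ a) · x  ∎
        value-injective : ∀ a s b t → value a s ≡ value b t → (a , s) ≡ (b , t)
        value-injective a s b t e with ℕ.<-cmp (toℕ a) (toℕ b)
        ... | tri< a<b _ _ = contradiction e (distinct _ _ s t a<b (Fin.toℕ<n b))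
        ... | tri> _ _ b<a = contradiction (sym e) (distinct _ _ t s b<a (Fin.toℕ<n a))
        ... | tri≈ _ a≡b _ with Fin.toℕ-injective a≡b
        ...   | refl = cong (a ,_) (injective (begin
          vector s  ≡⟨ solve 2 (λ y s → s := (y :+ s) :- y) refl (toℕ a · x) (vector s) ⟩
          (toℕ a · x + vector s) - toℕ a · x  ≡⟨ cong (_- toℕ a · x) e ⟩
          (toℕ a · x + vector t) - toℕ a · x  ≡⟨ solve 2 (λ y s → (y :+ s) :- y := s) refl (toℕ a · x) (vector t) ⟩
          vector t  ∎))
        p·x≡0 : p · x ≡ 0#
        p·x≡0 = trans (·-* p x) (trans (cong (_* x) p·1≡0) (zeroˡ x))
        combined : ∀ a b s t → (a · x + vector s) + (b · x + vector t) ≡ (a ℕ.+ b) · x + (vector s + vector t)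
        combined a b s t = trans
          (solve 4 (λ a s b t → (a :+ s) :+ (b :+ t) := (a :+ b) :+ (s :+ t)) refl (a · x) (vector s) (b · x) (vector t))
          (cong (_+ (vector s + vector t)) (sym (×-homo-+ x a b)))
        add : ∀ a s b t → ∃ λ u → value (proj₁ (parts u)) (proj₂ (parts u)) ≡ value a s + value b t
        add a s b t with toℕ a ℕ.+ toℕ b ℕ.<? p
        ... | yes lt = value-surjective (toℕ a ℕ.+ toℕ b) lt (span-+ (s , refl) (t , refl)) (combined (toℕ a) (toℕ b) s t)
        -- When the two coefficients add up to p or more, p x = 0 allows p to be subtracted.
        ... | no ≮p = value-surjective c c<p (span-+ (s , refl) (t , refl)) (begin
          value a s + value b t  ≡⟨ combined (toℕ a) (toℕ b) s t ⟩
          (toℕ a ℕ.+ toℕ b) · x + (vector s + vector t)  ≡⟨ cong (λ k → k · x + (vector s + vector t)) (sym (ℕ.m+[n∸m]≡n (ℕ.≮⇒≥ ≮p))) ⟩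
          (p ℕ.+ c) · x + (vector s + vector t)  ≡⟨ cong (_+ (vector s + vector t)) (trans (×-homo-+ x p c) (trans (cong (_+ c · x) p·x≡0) (+-identityˡ _))) ⟩
          c · x + (vector s + vector t)  ∎)
          where
          c = toℕ a ℕ.+ toℕ b ∸ p
          c<p : c < p
          c<p = ℕ.+-cancelˡ-< p _ _ (subst (_< p ℕ.+ p) (sym (ℕ.m+[n∸m]≡n (ℕ.≮⇒≥ ≮p)))
            (ℕ.+-mono-< (Fin.toℕ<n a) (Fin.toℕ<n b)))

    -- Subspaces are extended until they exhaust the field. The size grows at every extension, so
    -- the fuel bounds what is still missing.
    prime-power-size : ∃ λ r → p ℕ.^ r ≡ suc m
    prime-power-size = search (suc m) 0 trivial (ℕ.m≤n+m (suc m) 1)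
      where
      instance
        p≢0 : NonZero p
        p≢0 = ℕ.>-nonZero (ℕ.<-trans (s≤s z≤n) p>1)
      search : ∀ fuel i → Subspace i → suc m ≤ p ℕ.^ i ℕ.+ fuel → ∃ λ r → p ℕ.^ r ≡ suc m
      search fuel i V bound with all? (Subspace.span? V)
      ... | yes onto = i , ℕ.≤-antisym (Fin.injective⇒≤ (Subspace.injective V))
        (Fin.injective⇒≤ {f = proj₁ ∘ onto} λ {x} {y} e → trans (sym (proj₂ (onto x))) (trans (cong (Subspace.vector V) e) (proj₂ (onto y))))
      search zero i V bound | no ¬onto = i , ℕ.≤-antisym (Fin.injective⇒≤ (Subspace.injective V)) (subst (suc m ≤_) (ℕ.+-identityʳ _) bound)
      search (suc fuel) i V bound | no ¬onto with Fin.¬∀⟶∃¬ (suc m) _ (Subspace.span? V) ¬onto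
      ... | x , x∉V = search fuel (suc i) (extend V x x∉V) (ℕ.≤-trans bound
        (subst (_≤ p ℕ.^ suc i ℕ.+ fuel) (sym (ℕ.+-suc (p ℕ.^ i) fuel)) (ℕ.+-monoˡ-≤ fuel
          (subst (p ℕ.^ i <_) (ℕ.*-comm (p ℕ.^ i) p) (ℕ.m<m*n (p ℕ.^ i) p {{ℕ.m^n≢0 p i}} p>1)))))

module _ (p : ℕ) .{{_ : NonZero p}} where

  split-% : ∀ {x} X → x < p → (x ℕ.+ X ℕ.* p) % p ≡ x
  split-% {x} X x<p = trans ([m+kn]%n≡m%n x X p) (m<n⇒m%n≡m x<p)

  division-unique : ∀ {x y X Y} → x < p → y < p → x ℕ.+ X ℕ.* p ≡ y ℕ.+ Y ℕ.* p → x ≡ y × X ≡ Y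
  division-unique {x} {y} {X} {Y} x<p y<p e = x≡y ,
    ℕ.*-cancelʳ-≡ X Y p (ℕ.+-cancelˡ-≡ x _ _ (trans e (cong (ℕ._+ Y ℕ.* p) (sym x≡y))))
    where
    x≡y : x ≡ y
    x≡y = trans (sym (split-% X x<p)) (trans (cong (_% p) e) (split-% Y y<p))

  split-/ : ∀ {x} X → x < p → (x ℕ.+ X ℕ.* p) / p ≡ X
  split-/ {x} X x<p = proj₂ (division-unique {X = (x ℕ.+ X ℕ.* p) / p} {Y = X} (m%n<n _ p) x<p (sym (m≡m%n+[m/n]*n (x ℕ.+ X ℕ.* p) p)))

module _ {m : ℕ} (𝔽 : FieldOn (suc m)) where

  open FieldTheory 𝔽
  open Characteristic 𝔽

  -- With p = 2 h + 1 and q = pʳ⁺¹ = m + 1, `half` is (q - 1)/2. It is written as h (1 + p + ⋯ + pʳ)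
  -- so that (1 - s)^half splits into Frobenius conjugates of (1 - s)ʰ.
  record Parameters : Set where
    field
      2≢0     : 1# + 1# ≢ 0#
      {g}     : F
      g≢0     : g ≢ 0#
      og      : HasOrder g m
      {h r}   : ℕ
      isChar  : IsCharacteristic (suc (h ℕ.+ h))
      size≡   : suc (h ℕ.+ h) ℕ.^ suc r ≡ suc m

    half : ℕ
    half = h ℕ.* repunit (suc (h ℕ.+ h)) (suc r)

    field
      m≡half+half : m ≡ half ℕ.+ half
      {ε o o′}    : ℕ
      m≡2ᵉo       : m ≡ 2 ℕ.^ ε ℕ.* o
      o-odd       : o ≡ suc (o′ ℕ.+ o′)
      o∣half      : o ∣ half

  opaque
    parameters : 1# + 1# ≢ 0# → Parameters
    parameters 2≢0 = fromOdd (proj₂ characteristic) (odd-characteristic (proj₂ characteristic) 2≢0)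
      where
      fromSize : ∀ {h} → IsCharacteristic (suc (h ℕ.+ h)) → (∃ λ r → suc (h ℕ.+ h) ℕ.^ r ≡ suc m) → Parameters
      fromSize     isChar (zero  , size≡) = contradiction (sym (ℕ.suc-injective size≡)) m≢0
      fromSize {h} isChar (suc r , size≡) = fromSplit (splitPower 2 (s≤s (s≤s z≤n)) m m≢0)
        where
        half : ℕ
        half = h ℕ.* repunit (suc (h ℕ.+ h)) (suc r)
        m≡half+half : m ≡ half ℕ.+ half
        m≡half+half = ℕ.suc-injective (trans (sym size≡) (trans (repunit-power (h ℕ.+ h) (suc r))
          (cong suc (ℕ.*-distribʳ-+ (repunit (suc (h ℕ.+ h)) (suc r)) h h))))
        double : ∀ k → k ℕ.+ k ≡ k ℕ.* 2
        double k = trans (cong (k ℕ.+_) (sym (ℕ.+-identityʳ k))) (ℕ.*-comm 2 k)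
        fromSplit : (∃₂ λ e o → m ≡ 2 ℕ.^ e ℕ.* o × 2 ∤ o) → Parameters
        fromSplit (zero , o , m≡ , 2∤o) =
          contradiction (divides half (trans (sym (trans m≡ (ℕ.+-identityʳ o))) (trans m≡half+half (double half)))) 2∤o
        -- Since m = 2 half is even, the exponent of 2 in m is positive, and therefore o divides
        -- half.
        fromSplit (suc e , o , m≡ , 2∤o) = fromHalve (halve o)
          where
          o∣half : o ∣ half
          o∣half = divides (2 ℕ.^ e) (ℕ.*-cancelʳ-≡ half (2 ℕ.^ e ℕ.* o) 2 (begin
            half ℕ.* 2  ≡⟨ double half ⟨
            half ℕ.+ half  ≡⟨ m≡half+half ⟨
            m  ≡⟨ m≡ ⟩
            2 ℕ.* 2 ℕ.^ e ℕ.* o  ≡⟨ ℕ.*-assoc 2 (2 ℕ.^ e) o ⟩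
            2 ℕ.* (2 ℕ.^ e ℕ.* o)  ≡⟨ ℕ.*-comm 2 (2 ℕ.^ e ℕ.* o) ⟩
            2 ℕ.^ e ℕ.* o ℕ.* 2  ∎))
            where open ≡-Reasoning
          fromHalve : (∃ λ k → o ≡ k ℕ.+ k) ⊎ (∃ λ k → o ≡ suc (k ℕ.+ k)) → Parameters
          fromHalve (inj₁ (k , o≡)) = contradiction (divides k (trans o≡ (double k))) 2∤o
          fromHalve (inj₂ (k , o≡)) = record
            { 2≢0 = 2≢0 ; g = proj₁ generator ; h = h ; r = r ; ε = suc e ; o = o ; o′ = k
            ; g≢0 = proj₁ (proj₂ generator) ; og = proj₂ (proj₂ generator) ; isChar = isChar ; size≡ = size≡
            ; m≡half+half = m≡half+half ; m≡2ᵉo = m≡ ; o-odd = o≡ ; o∣half = o∣half }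
      fromOdd : ∀ {p} → IsCharacteristic p → (∃ λ h → p ≡ suc (h ℕ.+ h)) → Parameters
      fromOdd isChar (h , refl) = fromSize {h} isChar (prime-power-size isChar)

module Cyclotomy {m : ℕ} (𝔽 : FieldOn (suc m)) (P : Parameters 𝔽) where

  open FieldTheory 𝔽
  open Characteristic 𝔽
  open Parameters P
  open IsCharacteristic isChar
  open ≡-Reasoning

  private
    N : ℕ
    N = suc m

  -- Discrete logarithms and character sums

  g^-cong⁻ : ∀ {i j} → i ≤ j → g ^ i ≡ g ^ j → m ∣ j ∸ i
  g^-cong⁻ {i} {j} i≤j e = proj₂ og (j ∸ i) (*-cancelˡ (^-≢0 i g≢0) (begin
    g ^ i * g ^ (j ∸ i)  ≡⟨ ^-homo-* g i (j ∸ i) ⟨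
    g ^ (i ℕ.+ (j ∸ i))  ≡⟨ cong (g ^_) (ℕ.m+[n∸m]≡n i≤j) ⟩
    g ^ j  ≡⟨ e ⟨
    g ^ i  ≡⟨ *-identityʳ _ ⟨
    g ^ i * 1#  ∎))

  private
    window : ∀ {a i j} → a ≤ i → j < a ℕ.+ m → m ∣ j ∸ i → j ≤ i
    window {a} {i} {j} a≤i j< d with j ∸ i in eq
    ... | zero  = ℕ.m∸n≡0⇒m≤n eq
    ... | suc k = contradiction (∣⇒≤ d) (ℕ.<⇒≱ (subst (_< m) eq
      (ℕ.m<n+o⇒m∸n<o j i {{ℕ.≢-nonZero m≢0}} (ℕ.<-≤-trans j< (ℕ.+-monoˡ-≤ m a≤i)))))

  -- The exponents may lie in any window of m consecutive integers. The window 1, ..., m serves for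
  -- positive exponents that can reach m.
  g^-injective : ∀ {a i j} → a ≤ i → i < a ℕ.+ m → a ≤ j → j < a ℕ.+ m → g ^ i ≡ g ^ j → i ≡ j
  g^-injective {a} {i} {j} a≤i i< a≤j j< e with ℕ.≤-total i j
  ... | inj₁ i≤j = ℕ.≤-antisym i≤j (window a≤i j< (g^-cong⁻ i≤j e))
  ... | inj₂ j≤i = ℕ.≤-antisym (window a≤j i< (g^-cong⁻ j≤i (sym e))) j≤i

  -- Otherwise 0, x and the m distinct powers of g would be q + 1 elements.
  logarithm : ∀ {x} → x ≢ 0# → ∃ λ i → x ≡ g ^ i
  logarithm {x} x≢0 with any? (λ (i : Fin m) → x ≟ g ^ toℕ i)
  ... | yes (i , e) = toℕ i , e
  ... | no ¬∃ = contradiction (Fin.injective⇒≤ {f = f} f-injective) ℕ.1+n≰n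
    where
    f : Fin (suc (suc m)) → F
    f zero          = 0#
    f (suc zero)    = x
    f (suc (suc i)) = g ^ toℕ i
    f-injective : ∀ {i j} → f i ≡ f j → i ≡ j
    f-injective {zero}        {zero}        e = refl
    f-injective {zero}        {suc zero}    e = contradiction (sym e) x≢0
    f-injective {zero}        {suc (suc j)} e = contradiction (sym e) (^-≢0 (toℕ j) g≢0)
    f-injective {suc zero}    {zero}        e = contradiction e x≢0
    f-injective {suc zero}    {suc zero}    e = refl
    f-injective {suc zero}    {suc (suc j)} e = contradiction (j , e) ¬∃
    f-injective {suc (suc i)} {zero}        e = contradiction e (^-≢0 (toℕ i) g≢0)
    f-injective {suc (suc i)} {suc zero}    e = contradiction (i , sym e) ¬∃
    f-injective {suc (suc i)} {suc (suc j)} e =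
      cong (λ k → suc (suc k)) (Fin.toℕ-injective (g^-injective {0} z≤n (Fin.toℕ<n i) z≤n (Fin.toℕ<n j) e))

  -- The indicator function of the nonzero elements.
  nz : F → F
  nz w = w * w ⁻¹

  nz-0 : nz 0# ≡ 0#
  nz-0 = zeroˡ _

  nz-≢0 : ∀ {w} → w ≢ 0# → nz w ≡ 1#
  nz-≢0 = ⁻¹-inverse

  nz-* : ∀ x w → x ≢ 0# → nz (x * w) ≡ nz w
  nz-* x w x≢0 = begin
    x * w * (x * w) ⁻¹  ≡⟨ cong (x * w *_) (⁻¹-distrib-* x w) ⟩
    x * w * (x ⁻¹ * w ⁻¹)  ≡⟨ solve 4 (λ x w y v → x :* w :* (y :* v) := (x :* y) :* (w :* v)) refl x w (x ⁻¹) (w ⁻¹) ⟩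
    nz x * nz w  ≡⟨ cong (_* nz w) (nz-≢0 x≢0) ⟩
    1# * nz w  ≡⟨ *-identityˡ _ ⟩
    nz w  ∎

  ∑-nz : ∑ nz ≡ - 1#
  ∑-nz = begin
    ∑ nz  ≡⟨ ∑-remove 0# nz ⟩
    nz 0# + ∑ (λ i → nz (Fin.punchIn 0# i)) ≡⟨ cong₂ _+_ nz-0 (∑-cong (λ i → nz-≢0 (Fin.punchInᵢ≢i 0# i))) ⟩
    0# + ∑ {m} (λ _ → 1#)  ≡⟨ cong (0# +_) (∑-const m 1#) ⟩
    0# + m · 1#  ≡⟨ solve 1 (λ k → :0 :+ k := (:1 :+ k) :- :1) refl (m · 1#) ⟩
    suc m · 1# - 1#  ≡⟨ cong (_- 1#) size·1≡0 ⟩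
    0# - 1#  ≡⟨ +-identityˡ _ ⟩
    - 1#  ∎

  Multiplicative : (F → F) → Set
  Multiplicative μ = ∀ x y → μ (x * y) ≡ μ x * μ y

  module _ {μ : F → F} (μ-* : Multiplicative μ) where

    multiplicative-^ : μ 1# ≡ 1# → ∀ x n → μ (x ^ n) ≡ μ x ^ n
    multiplicative-^ μ1 x zero    = μ1
    multiplicative-^ μ1 x (suc n) = trans (μ-* x (x ^ n)) (cong (μ x *_) (multiplicative-^ μ1 x n))

    orthogonality₁ : μ g ≡ 1# → ∑ (λ w → nz w * μ w) ≡ - 1#
    orthogonality₁ μg = trans (∑-cong value) ∑-nz
      where
      μ1 : μ 1# ≡ 1#
      μ1 = begin
        μ 1#  ≡⟨ *-identityˡ _ ⟨
        1# * μ 1#  ≡⟨ cong (_* μ 1#) μg ⟨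
        μ g * μ 1#  ≡⟨ μ-* g 1# ⟨
        μ (g * 1#)  ≡⟨ cong μ (*-identityʳ g) ⟩
        μ g  ≡⟨ μg ⟩
        1#  ∎
      value : ∀ w → nz w * μ w ≡ nz w
      value w with zero? w
      ... | inj₁ refl = trans (cong (_* μ 0#) nz-0) (trans (zeroˡ _) (sym nz-0))
      ... | inj₂ w≢0 with logarithm w≢0
      ...   | i , refl = trans (cong (nz (g ^ i) *_) (trans (multiplicative-^ μ1 g i) (trans (cong (_^ i) μg) (1^ i)))) (*-identityʳ _)

    -- Replacing w by g w multiplies the sum by `μ g` and also leaves it unchanged.
    orthogonality₀ : μ g ≢ 1# → ∑ (λ w → nz w * μ w) ≡ 0#
    orthogonality₀ μg≢1 with integral {μ g - 1#} {S} vanish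
      where
      S = ∑ (λ w → nz w * μ w)
      shifted : μ g * S ≡ S
      shifted = begin
        μ g * S  ≡⟨ ∑-*ˡ (μ g) (λ w → nz w * μ w) ⟩
        ∑ (λ w → μ g * (nz w * μ w))  ≡⟨ ∑-cong (λ w → trans
          (solve 3 (λ a b c → a :* (b :* c) := b :* (a :* c)) refl (μ g) (nz w) (μ w))
          (cong₂ _*_ (sym (nz-* g w g≢0)) (sym (μ-* g w)))) ⟩
        ∑ (λ w → nz (g * w) * μ (g * w))  ≡⟨ ∑-permute (λ w → nz w * μ w) (scaling g≢0) ⟨
        S  ∎
      vanish : (μ g - 1#) * S ≡ 0#
      vanish = begin
        (μ g - 1#) * S  ≡⟨ solve 2 (λ a s → (a :- :1) :* s := a :* s :- s) refl (μ g) S ⟩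
        μ g * S - S  ≡⟨ cong (_- S) shifted ⟩
        S - S  ≡⟨ -‿inverseʳ S ⟩
        0#  ∎
    ... | inj₁ e = contradiction (x-y≡0⇒x≡y e) μg≢1
    ... | inj₂ e = e

  -- The quadratic character and sums over squares

  half>0 : 0 < half
  half>0 = ℕ.n≢0⇒n>0 λ e → m≢0 (trans m≡half+half (cong₂ ℕ._+_ e e))

  half<m : half < m
  half<m = subst (half <_) (sym m≡half+half) (ℕ.m<m+n half half>0)

  1≢-1 : 1# ≢ - 1#
  1≢-1 e = 1≢0 (x≡-x⇒x≡0 2≢0 e)

  opaque
    x²≡y²⇒x≡±y : ∀ {x y} → x * x ≡ y * y → x ≡ y ⊎ x ≡ - y
    x²≡y²⇒x≡±y {x} {y} e with integral {x - y} {x + y} (begin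
        (x - y) * (x + y)  ≡⟨ solve 2 (λ x y → (x :- y) :* (x :+ y) := x :* x :- y :* y) refl x y ⟩
        x * x - y * y  ≡⟨ cong (_- y * y) e ⟩
        y * y - y * y  ≡⟨ -‿inverseʳ _ ⟩
        0#  ∎)
    ... | inj₁ d = inj₁ (x-y≡0⇒x≡y d)
    ... | inj₂ s = inj₂ (x-y≡0⇒x≡y (trans (cong (x +_) (-‿involutive y)) s))

  -- The quadratic character, by Euler's criterion.
  χ : F → F
  χ w = w ^ half

  χ² : ∀ {w} → w ≢ 0# → χ w * χ w ≡ 1#
  χ² {w} w≢0 = trans (sym (^-homo-* w half half)) (trans (cong (w ^_) (sym m≡half+half)) (fermat w≢0))

  χ-* : Multiplicative χ
  χ-* x y = ^-distrib-* x y half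

  χ-0 : χ 0# ≡ 0#
  χ-0 = go half half>0
    where
    go : ∀ n → 0 < n → 0# ^ n ≡ 0#
    go (suc n) _ = zeroˡ _

  χ-g : χ g ≡ - 1#
  χ-g with x²≡y²⇒x≡±y (trans (χ² g≢0) (sym (*-identityˡ 1#)))
  ... | inj₁ e = contradiction (∣⇒≤ {{ℕ.>-nonZero half>0}} (proj₂ og half e)) (ℕ.<⇒≱ half<m)
  ... | inj₂ e = e

  IsSquare : F → Set
  IsSquare x = χ x ≡ 1#

  square-≢0 : ∀ {x} → IsSquare x → x ≢ 0#
  square-≢0 sx refl = 1≢0 (trans (sym sx) χ-0)

  square-* : ∀ {x y} → IsSquare x → IsSquare y → IsSquare (x * y)
  square-* {x} {y} sx sy = trans (χ-* x y) (trans (cong₂ _*_ sx sy) (*-identityˡ 1#))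

  square-⁻¹ : ∀ {x} → IsSquare x → IsSquare (x ⁻¹)
  square-⁻¹ {x} sx = begin
    χ (x ⁻¹)  ≡⟨ *-identityˡ _ ⟨
    1# * χ (x ⁻¹)  ≡⟨ cong (_* χ (x ⁻¹)) sx ⟨
    χ x * χ (x ⁻¹)  ≡⟨ χ-* x (x ⁻¹) ⟨
    χ (x * x ⁻¹)  ≡⟨ cong χ (⁻¹-inverse (square-≢0 sx)) ⟩
    χ 1#  ≡⟨ 1^ half ⟩
    1#  ∎

  x*x-square : ∀ {x} → x ≢ 0# → IsSquare (x * x)
  x*x-square {x} x≢0 = trans (χ-* x x) (χ² x≢0)

  squareRoot : ∀ {x} → IsSquare x → ∃ λ y → y ≢ 0# × x ≡ y * y
  squareRoot {x} sx with logarithm (square-≢0 sx)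
  ... | i , refl with halve i
  ...   | inj₁ (k , refl) = g ^ k , ^-≢0 k g≢0 , ^-homo-* g k k
  ...   | inj₂ (k , refl) = contradiction (begin
    1#  ≡⟨ sx ⟨
    χ (g * g ^ (k ℕ.+ k))  ≡⟨ χ-* g _ ⟩
    χ g * χ (g ^ (k ℕ.+ k))  ≡⟨ cong₂ _*_ χ-g (trans (cong χ (^-homo-* g k k)) (x*x-square (^-≢0 k g≢0))) ⟩
    - 1# * 1#  ≡⟨ *-identityʳ _ ⟩
    - 1#  ∎) 1≢-1

  -- Twice the indicator function of the nonzero squares.
  sq : F → F
  sq w = nz w + χ w

  sq-nonsquare : ∀ {w} → ¬ IsSquare w → sq w ≡ 0#
  sq-nonsquare {w} ¬sw with zero? w
  ... | inj₁ refl = trans (cong₂ _+_ nz-0 χ-0) (+-identityˡ 0#)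
  ... | inj₂ w≢0 with x²≡y²⇒x≡±y (trans (χ² w≢0) (sym (*-identityˡ 1#)))
  ...   | inj₁ e = contradiction e ¬sw
  ...   | inj₂ e = trans (cong₂ _+_ (nz-≢0 w≢0) e) (-‿inverseʳ 1#)

  private
    split : ∀ {μ : F → F} → ∑ (λ w → sq w * μ w) ≡ ∑ (λ w → nz w * μ w) + ∑ (λ w → nz w * (χ w * μ w))
    split {μ} = trans (∑-cong term) (∑-+ _ _)
      where
      χ-nz : ∀ w → χ w ≡ nz w * χ w
      χ-nz w with zero? w
      ... | inj₁ refl = trans χ-0 (sym (trans (cong (_* χ 0#) nz-0) (zeroˡ _)))
      ... | inj₂ w≢0  = sym (trans (cong (_* χ w) (nz-≢0 w≢0)) (*-identityˡ _))
      term : ∀ w → sq w * μ w ≡ nz w * μ w + nz w * (χ w * μ w)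
      term w = trans (distribʳ (μ w) (nz w) (χ w)) (cong (nz w * μ w +_)
        (trans (cong (_* μ w) (χ-nz w)) (*-assoc (nz w) (χ w) (μ w))))

    χμ-* : ∀ {μ : F → F} → Multiplicative μ → Multiplicative (λ w → χ w * μ w)
    χμ-* {μ} μ-* x y = trans (cong₂ _*_ (χ-* x y) (μ-* x y))
      (solve 4 (λ a b c d → (a :* b) :* (c :* d) := (a :* c) :* (b :* d)) refl (χ x) (χ y) (μ x) (μ y))

    χμ-g : ∀ (μ : F → F) → χ g * μ g ≡ - μ g
    χμ-g μ = trans (cong (_* μ g) χ-g) (-1*x≈-x (μ g))

  -- The sum splits into the full sums of μ and of χ μ. Since χ(g) = - 1, exactly one of these
  -- characters is trivial if μ(g)² = 1, and neither is otherwise.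
  square-orthogonality₁ : ∀ {μ} → Multiplicative μ → μ g * μ g ≡ 1# → ∑ (λ w → sq w * μ w) ≡ - 1#
  square-orthogonality₁ {μ} μ-* e with x²≡y²⇒x≡±y (trans e (sym (*-identityˡ 1#)))
  ... | inj₁ μg = trans (split {μ}) (trans (cong₂ _+_ (orthogonality₁ μ-* μg)
        (orthogonality₀ (χμ-* μ-*) λ e′ → 1≢-1 (sym (trans (sym (trans (χμ-g μ) (cong -_ μg))) e′)))) (+-identityʳ _))
  ... | inj₂ μg = trans (split {μ}) (trans (cong₂ _+_ (orthogonality₀ μ-* λ e′ → 1≢-1 (trans (sym e′) μg))
        (orthogonality₁ (χμ-* μ-*) (trans (χμ-g μ) (trans (cong -_ μg) (-‿involutive 1#))))) (+-identityˡ _))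

  square-orthogonality₀ : ∀ {μ} → Multiplicative μ → μ g * μ g ≢ 1# → ∑ (λ w → sq w * μ w) ≡ 0#
  square-orthogonality₀ {μ} μ-* ¬e = trans (split {μ}) (trans (cong₂ _+_
    (orthogonality₀ μ-* λ μg → ¬e (trans (cong₂ _*_ μg μg) (*-identityˡ 1#)))
    (orthogonality₀ (χμ-* μ-*) λ e′ → ¬e (trans (solve 1 (λ a → a :* a := (:- a) :* (:- a)) refl (μ g))
      (trans (cong₂ _*_ (trans (sym (χμ-g μ)) e′) (trans (sym (χμ-g μ)) e′)) (*-identityˡ 1#))))) (+-identityˡ 0#))

  -- Base-p digits and products of Frobenius conjugates

  p : ℕ
  p = suc (h ℕ.+ h)

  infix 9 ∑<
  ∑< : ℕ → (ℕ → F) → F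
  ∑< n f = ∑ {n} (λ i → f (toℕ i))

  ∑<-cong : ∀ n {f f′} → (∀ i → i < n → f i ≡ f′ i) → ∑< n f ≡ ∑< n f′
  ∑<-cong n eq = ∑-cong (λ i → eq (toℕ i) (Fin.toℕ<n i))

  ∑<-0 : ∀ n {f} → (∀ i → i < n → f i ≡ 0#) → ∑< n f ≡ 0#
  ∑<-0 n eq = trans (∑<-cong n eq) (∑-0 n)

  ∑<-append : ∀ a b f → ∑< (a ℕ.+ b) f ≡ ∑< a f + ∑< b (λ i → f (a ℕ.+ i))
  ∑<-append zero    b f = sym (trans (cong (_+ ∑< b f) (∑-zero _)) (+-identityˡ _))
  ∑<-append (suc a) b f = begin
    ∑< (suc a ℕ.+ b) f  ≡⟨ ∑-suc _ ⟩
    f 0 + ∑< (a ℕ.+ b) (λ i → f (suc i))  ≡⟨ cong (f 0 +_) (∑<-append a b (λ i → f (suc i))) ⟩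
    f 0 + (∑< a (λ i → f (suc i)) + ∑< b (λ i → f (suc (a ℕ.+ i))))  ≡⟨ +-assoc _ _ _ ⟨
    (f 0 + ∑< a (λ i → f (suc i))) + ∑< b (λ i → f (suc (a ℕ.+ i)))  ≡⟨ cong (_+ ∑< b (λ i → f (suc (a ℕ.+ i)))) (∑-suc _) ⟨
    ∑< (suc a) f + ∑< b (λ i → f (suc a ℕ.+ i))  ∎

  ∑<-digits : ∀ N f → ∑< (p ℕ.* N) f ≡ ∑< N (λ i → ∑< p (λ j → f (j ℕ.+ i ℕ.* p)))
  ∑<-digits zero    f = trans (cong (λ n → ∑< n f) (ℕ.*-zeroʳ p)) (trans (∑-zero _) (sym (∑-zero _)))
  ∑<-digits (suc N) f = begin
    ∑< (p ℕ.* suc N) f  ≡⟨ cong (λ n → ∑< n f) (ℕ.*-suc p N) ⟩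
    ∑< (p ℕ.+ p ℕ.* N) f  ≡⟨ ∑<-append p (p ℕ.* N) f ⟩
    ∑< p f + ∑< (p ℕ.* N) (λ n → f (p ℕ.+ n))  ≡⟨ cong (∑< p f +_) (∑<-digits N (λ n → f (p ℕ.+ n))) ⟩
    ∑< p f + ∑< N (λ i → ∑< p (λ j → f (p ℕ.+ (j ℕ.+ i ℕ.* p))))
      ≡⟨ cong₂ _+_ (∑<-cong p (λ j _ → cong f (sym (ℕ.+-identityʳ j))))
           (∑<-cong N (λ i _ → ∑<-cong p (λ j _ → cong f (shuffle j (i ℕ.* p))))) ⟩
    ∑< p (λ j → f (j ℕ.+ 0)) + ∑< N (λ i → ∑< p (λ j → f (j ℕ.+ (p ℕ.+ i ℕ.* p))))  ≡⟨ ∑-suc _ ⟨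
    ∑< (suc N) (λ i → ∑< p (λ j → f (j ℕ.+ i ℕ.* p)))  ∎
    where
    shuffle : ∀ j k → p ℕ.+ (j ℕ.+ k) ≡ j ℕ.+ (p ℕ.+ k)
    shuffle j k = trans (sym (ℕ.+-assoc p j k)) (trans (cong (ℕ._+ k) (ℕ.+-comm p j)) (ℕ.+-assoc j p k))

  -- φ a j is the coefficient of yʲ in (1 - y)ᵃ.
  φ : ℕ → ℕ → F
  φ a       zero    = 1#
  φ zero    (suc j) = 0#
  φ (suc a) (suc j) = φ a (suc j) - φ a j

  φ-expansion : ∀ a y N → a < N → ∑< N (λ j → φ a j * y ^ j) ≡ (1# - y) ^ a
  φ-expansion zero y (suc N) _ = begin
    ∑< (suc N) (λ j → φ 0 j * y ^ j)  ≡⟨ ∑-suc _ ⟩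
    1# * 1# + ∑< N (λ j → 0# * y ^ suc j)  ≡⟨ cong₂ _+_ (*-identityˡ 1#) (∑<-0 N (λ j _ → zeroˡ (y ^ suc j))) ⟩
    1# + 0#  ≡⟨ +-identityʳ 1# ⟩
    1#  ∎
  φ-expansion (suc a) y (suc N) (s≤s a<N) = begin
    ∑< (suc N) (λ j → φ (suc a) j * y ^ j)  ≡⟨ ∑-suc _ ⟩
    1# * 1# + ∑< N (λ j → (φ a (suc j) - φ a j) * y ^ suc j)  ≡⟨ cong (1# * 1# +_) (∑<-cong N (λ j _ →
        solve 4 (λ u v y z → (u :- v) :* (y :* z) := u :* (y :* z) :+ (:- y) :* (v :* z)) refl (φ a (suc j)) (φ a j) y (y ^ j))) ⟩
    1# * 1# + ∑< N (λ j → φ a (suc j) * y ^ suc j + - y * (φ a j * y ^ j))  ≡⟨ cong (1# * 1# +_) (∑-+ _ _) ⟩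
    1# * 1# + (∑< N (λ j → φ a (suc j) * y ^ suc j) + ∑< N (λ j → - y * (φ a j * y ^ j)))
      ≡⟨ +-assoc _ _ _ ⟨
    (1# * 1# + ∑< N (λ j → φ a (suc j) * y ^ suc j)) + ∑< N (λ j → - y * (φ a j * y ^ j))
      ≡⟨ cong₂ _+_ (∑-suc _) (∑-*ˡ (- y) _) ⟨
    ∑< (suc N) (λ j → φ a j * y ^ j) + - y * ∑< N (λ j → φ a j * y ^ j)
      ≡⟨ cong₂ (λ u v → u + - y * v) (φ-expansion a y (suc N) (ℕ.m<n⇒m<1+n a<N)) (φ-expansion a y N a<N) ⟩
    (1# - y) ^ a + - y * (1# - y) ^ a
      ≡⟨ solve 2 (λ y z → z :+ (:- y) :* z := (:1 :- y) :* z) refl y ((1# - y) ^ a) ⟩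
    (1# - y) ^ suc a ∎

  φ-vanishes : ∀ {a j} → a < j → φ a j ≡ 0#
  φ-vanishes {zero}  {suc j} _         = refl
  φ-vanishes {suc a} {suc j} (s≤s a<j) =
    trans (cong₂ _-_ (φ-vanishes (ℕ.m<n⇒m<1+n a<j)) (φ-vanishes a<j)) (-‿inverseʳ 0#)

  -- With signs, this is (j + 1) C(a, j + 1) = (a - j) C(a, j). It decides which binomial
  -- coefficients vanish in the field: none with j ≤ a < p, and all with a = p and 0 < j < p.
  φ-recurrence : ∀ a j → suc j · 1# * φ a (suc j) + (a · 1# - j · 1#) * φ a j ≡ 0#
  φ-recurrence zero zero =
    solve 0 ((:1 :+ :0) :* :0 :+ (:0 :- :0) :* :1 := :0) refl
  φ-recurrence zero (suc j) =
    solve 2 (λ u v → u :* :0 :+ v :* :0 := :0) refl (suc (suc j) · 1#) (0# - suc j · 1#)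
  φ-recurrence (suc a) zero = begin
    (1# + 0#) * (φ a 1 - 1#) + ((1# + a · 1#) - 0#) * 1#
      ≡⟨ solve 2 (λ u v → (:1 :+ :0) :* (u :- :1) :+ ((:1 :+ v) :- :0) :* :1 := (:1 :+ :0) :* u :+ (v :- :0) :* :1) refl (φ a 1) (a · 1#) ⟩
    (1# + 0#) * φ a 1 + (a · 1# - 0#) * 1#  ≡⟨ φ-recurrence a zero ⟩
    0#  ∎
  φ-recurrence (suc a) (suc j) = begin
    (1# + (1# + J)) * (A - B) + ((1# + M) - (1# + J)) * (B - C)
      ≡⟨ solve 5 (λ J M A B C → (:1 :+ (:1 :+ J)) :* (A :- B) :+ ((:1 :+ M) :- (:1 :+ J)) :* (B :- C)
           := ((:1 :+ (:1 :+ J)) :* A :+ (M :- (:1 :+ J)) :* B) :- ((:1 :+ J) :* B :+ (M :- J) :* C)) refl J M A B C ⟩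
    ((1# + (1# + J)) * A + (M - (1# + J)) * B) - ((1# + J) * B + (M - J) * C)
      ≡⟨ cong₂ _-_ (φ-recurrence a (suc j)) (φ-recurrence a j) ⟩
    0# - 0#  ≡⟨ -‿inverseʳ 0# ⟩
    0#  ∎
    where
    J = j · 1#
    M = a · 1#
    A = φ a (suc (suc j))
    B = φ a (suc j)
    C = φ a j

  φ-≢0 : ∀ {a j} → a < p → j ≤ a → φ a j ≢ 0#
  φ-≢0 {a} {zero}  a<p _   = 1≢0
  φ-≢0 {a} {suc j} a<p j<a e = *-≢0 a-j≢0 (φ-≢0 a<p (ℕ.<⇒≤ j<a)) (begin
    (a · 1# - j · 1#) * φ a j  ≡⟨ +-identityˡ _ ⟨
    0# + (a · 1# - j · 1#) * φ a j  ≡⟨ cong (_+ (a · 1# - j · 1#) * φ a j) (trans (cong (suc j · 1# *_) e) (zeroʳ _)) ⟨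
    suc j · 1# * φ a (suc j) + (a · 1# - j · 1#) * φ a j  ≡⟨ φ-recurrence a j ⟩
    0#  ∎)
    where
    a-j≢0 : a · 1# - j · 1# ≢ 0#
    a-j≢0 e₀ = j·1≢0 (ℕ.m<n⇒0<n∸m j<a) (ℕ.≤-<-trans (ℕ.m∸n≤m a j) a<p) (begin
      (a ∸ j) · 1#  ≡⟨ solve 2 (λ u v → v := (u :+ v) :- u) refl (j · 1#) _ ⟩
      (j · 1# + (a ∸ j) · 1#) - j · 1#  ≡⟨ cong (_- j · 1#) (×-homo-+ 1# j (a ∸ j)) ⟨
      (j ℕ.+ (a ∸ j)) · 1# - j · 1#  ≡⟨ cong (λ k → k · 1# - j · 1#) (ℕ.m+[n∸m]≡n (ℕ.<⇒≤ j<a)) ⟩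
      a · 1# - j · 1#  ≡⟨ e₀ ⟩
      0#  ∎)

  φ-top : ∀ a → φ a a ≡ (- 1#) ^ a
  φ-top zero    = refl
  φ-top (suc a) = begin
    φ a (suc a) - φ a a  ≡⟨ cong₂ _-_ (φ-vanishes (ℕ.n<1+n a)) (φ-top a) ⟩
    0# - (- 1#) ^ a  ≡⟨ solve 1 (λ z → :0 :- z := (:- :1) :* z) refl ((- 1#) ^ a) ⟩
    (- 1#) ^ suc a  ∎

  [-1]^p : (- 1#) ^ p ≡ - 1#
  [-1]^p = trans (neg-^-odd {p} {h} refl 1#) (cong -_ (1^ p))

  φ-characteristic : ∀ {j} → 0 < j → j < p → φ p j ≡ 0#
  φ-characteristic {suc j} _ j<p with integral {suc j · 1#} {φ p (suc j)} (begin
      suc j · 1# * φ p (suc j)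
        ≡⟨ solve 2 (λ u v → u := (u :+ v) :- v) refl (suc j · 1# * φ p (suc j)) ((p · 1# - j · 1#) * φ p j) ⟩
      (suc j · 1# * φ p (suc j) + (p · 1# - j · 1#) * φ p j) - (p · 1# - j · 1#) * φ p j
        ≡⟨ cong₂ _-_ (φ-recurrence p j) (lower j (ℕ.<-trans (ℕ.n<1+n j) j<p)) ⟩
      0# - 0#  ≡⟨ -‿inverseʳ 0# ⟩
      0#  ∎)
    where
    lower : ∀ j → j < p → (p · 1# - j · 1#) * φ p j ≡ 0#
    lower zero    _   = trans (cong (λ z → (z - 0#) * 1#) p·1≡0) (solve 0 ((:0 :- :0) :* :1 := :0) refl)
    lower (suc j) j<p = trans (cong ((p · 1# - suc j · 1#) *_) (φ-characteristic (s≤s z≤n) j<p)) (zeroʳ _)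
  ... | inj₁ e = contradiction e (j·1≢0 (s≤s z≤n) j<p)
  ... | inj₂ e = e

  frobenius : ∀ y → (1# - y) ^ p ≡ 1# - y ^ p
  frobenius y = begin
    (1# - y) ^ p  ≡⟨ φ-expansion p y (suc p) (ℕ.n<1+n p) ⟨
    ∑< (suc p) (λ j → φ p j * y ^ j)  ≡⟨ cong (λ n → ∑< n (λ j → φ p j * y ^ j)) (ℕ.+-comm 1 p) ⟩
    ∑< (p ℕ.+ 1) (λ j → φ p j * y ^ j)  ≡⟨ ∑<-append p 1 (λ j → φ p j * y ^ j) ⟩
    ∑< p (λ j → φ p j * y ^ j) + ∑< 1 (λ j → φ p (p ℕ.+ j) * y ^ (p ℕ.+ j))
      ≡⟨ cong₂ _+_ (∑-suc _) (trans (∑-suc _) (trans (cong (φ p (p ℕ.+ 0) * y ^ (p ℕ.+ 0) +_) (∑-zero _)) (+-identityʳ _))) ⟩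
    (1# * 1# + ∑< (h ℕ.+ h) (λ j → φ p (suc j) * y ^ suc j)) + φ p (p ℕ.+ 0) * y ^ (p ℕ.+ 0)
      ≡⟨ cong₂ _+_ (cong₂ _+_ (*-identityˡ 1#) (∑<-0 (h ℕ.+ h) (λ j j< →
           trans (cong (_* y ^ suc j) (φ-characteristic (s≤s z≤n) (s≤s j<))) (zeroˡ _))))
           (cong (λ k → φ p k * y ^ k) (ℕ.+-identityʳ p)) ⟩
    (1# + 0#) + φ p p * y ^ p  ≡⟨ cong (λ z → (1# + 0#) + z * y ^ p) (trans (φ-top p) [-1]^p) ⟩
    (1# + 0#) + - 1# * y ^ p  ≡⟨ solve 1 (λ z → (:1 :+ :0) :+ (:- :1) :* z := :1 :- z) refl (y ^ p) ⟩
    1# - y ^ p  ∎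

  pol : (ℕ → F) → F → F
  pol f y = ∑< p (λ j → f j * y ^ j)

  digitwise : ℕ → (ℕ → F) → ℕ → F
  digitwise zero    f n = 1#
  digitwise (suc r) f n = f (n % p) * digitwise r f (n / p)

  conjugates : ℕ → (ℕ → F) → F → F
  conjugates zero    f s = 1#
  conjugates (suc r) f s = pol f s * conjugates r f (s ^ p)

  poly : ℕ → (ℕ → F) → F → F
  poly N α s = ∑< N (λ n → α n * s ^ n)

  -- Multiplying out the conjugates produces every exponent below pʳ exactly once, by uniqueness of
  -- base-p expansions, with coefficient the product of `f` over the digits.
  conjugates-poly : ∀ r f s → conjugates r f s ≡ poly (p ℕ.^ r) (digitwise r f) s
  conjugates-poly zero f s = sym (trans (∑-suc _) (trans (cong (1# * 1# +_) (∑-zero _)) (trans (+-identityʳ _) (*-identityˡ 1#))))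
  conjugates-poly (suc r) f s = begin
    pol f s * conjugates r f (s ^ p)  ≡⟨ cong (pol f s *_) (conjugates-poly r f (s ^ p)) ⟩
    pol f s * ∑< L (λ i → digitwise r f i * (s ^ p) ^ i)  ≡⟨ ∑-*ˡ (pol f s) _ ⟩
    ∑< L (λ i → pol f s * (digitwise r f i * (s ^ p) ^ i))  ≡⟨ ∑<-cong L (λ i _ → trans (∑-*ʳ _ _) (∑<-cong p (λ j j<p → term i j j<p))) ⟩
    ∑< L (λ i → ∑< p (λ j → digitwise (suc r) f (j ℕ.+ i ℕ.* p) * s ^ (j ℕ.+ i ℕ.* p)))  ≡⟨ ∑<-digits L (λ n → digitwise (suc r) f n * s ^ n) ⟨
    poly (p ℕ.^ suc r) (digitwise (suc r) f) s  ∎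
    where
    L = p ℕ.^ r
    term : ∀ i j → j < p → f j * s ^ j * (digitwise r f i * (s ^ p) ^ i) ≡ digitwise (suc r) f (j ℕ.+ i ℕ.* p) * s ^ (j ℕ.+ i ℕ.* p)
    term i j j<p = begin
      f j * s ^ j * (digitwise r f i * (s ^ p) ^ i)
        ≡⟨ solve 4 (λ a b c d → a :* b :* (c :* d) := (a :* c) :* (b :* d)) refl (f j) (s ^ j) (digitwise r f i) ((s ^ p) ^ i) ⟩
      f j * digitwise r f i * (s ^ j * (s ^ p) ^ i)
        ≡⟨ cong₂ _*_ (cong₂ (λ k l → f k * digitwise r f l) (sym (split-% p i j<p)) (sym (split-/ p i j<p)))
             (trans (cong (s ^ j *_) (trans (^-assocʳ s p i) (cong (s ^_) (ℕ.*-comm p i)))) (sym (^-homo-* s j (i ℕ.* p)))) ⟩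
      digitwise (suc r) f (j ℕ.+ i ℕ.* p) * s ^ (j ℕ.+ i ℕ.* p) ∎

  digitwise-cong : ∀ r {f f′} n → (∀ j → j < p → f j ≡ f′ j) → digitwise r f n ≡ digitwise r f′ n
  digitwise-cong zero    n eq = refl
  digitwise-cong (suc r) n eq = cong₂ _*_ (eq (n % p) (m%n<n n p)) (digitwise-cong r (n / p) eq)

  digitwise-* : ∀ r f f′ n → digitwise r f n * digitwise r f′ n ≡ digitwise r (λ j → f j * f′ j) n
  digitwise-* zero    f f′ n = *-identityˡ 1#
  digitwise-* (suc r) f f′ n = trans
    (solve 4 (λ a b c d → (a :* b) :* (c :* d) := (a :* c) :* (b :* d)) refl (f (n % p)) (digitwise r f (n / p)) (f′ (n % p)) (digitwise r f′ (n / p)))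
    (cong (f (n % p) * f′ (n % p) *_) (digitwise-* r f f′ (n / p)))

  digitwise-^ : ∀ r f k n → digitwise r f n ^ k ≡ digitwise r (λ j → f j ^ k) n
  digitwise-^ zero    f k n = 1^ k
  digitwise-^ (suc r) f k n = trans (^-distrib-* _ _ k) (cong (f (n % p) ^ k *_) (digitwise-^ r f k (n / p)))

  -- The product is formed digit by digit. The hypothesis expresses that no carry occurs: the
  -- product of the digit polynomials again has only exponents below p.
  conjugates-* : ∀ r {f f′ f″} → (∀ y → pol f y * pol f′ y ≡ pol f″ y) →
                 ∀ s → conjugates r f s * conjugates r f′ s ≡ conjugates r f″ s
  conjugates-* zero    eq s = *-identityˡ 1#
  conjugates-* (suc r) {f} {f′} {f″} eq s = trans
    (solve 4 (λ a b c d → (a :* b) :* (c :* d) := (a :* c) :* (b :* d)) refl (pol f s) (conjugates r f (s ^ p)) (pol f′ s) (conjugates r f′ (s ^ p)))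
    (cong₂ _*_ (eq s) (conjugates-* r eq (s ^ p)))

  conjugates-φ : ∀ r {a} → a < p → ∀ s → conjugates r (φ a) s ≡ (1# - s) ^ (a ℕ.* repunit p r)
  conjugates-φ zero    {a} a<p s = cong ((1# - s) ^_) (sym (ℕ.*-zeroʳ a))
  conjugates-φ (suc r) {a} a<p s = begin
    pol (φ a) s * conjugates r (φ a) (s ^ p)  ≡⟨ cong₂ _*_ (φ-expansion a s p a<p) (conjugates-φ r a<p (s ^ p)) ⟩
    (1# - s) ^ a * (1# - s ^ p) ^ (a ℕ.* R)  ≡⟨ cong (λ z → (1# - s) ^ a * z ^ (a ℕ.* R)) (frobenius s) ⟨
    (1# - s) ^ a * ((1# - s) ^ p) ^ (a ℕ.* R)  ≡⟨ cong ((1# - s) ^ a *_) (^-assocʳ (1# - s) p (a ℕ.* R)) ⟩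
    (1# - s) ^ a * (1# - s) ^ (p ℕ.* (a ℕ.* R))  ≡⟨ ^-homo-* (1# - s) a _ ⟨
    (1# - s) ^ (a ℕ.+ p ℕ.* (a ℕ.* R))  ≡⟨ cong (λ k → (1# - s) ^ (a ℕ.+ k)) (trans (sym (ℕ.*-assoc p a R)) (trans (cong (ℕ._* R) (ℕ.*-comm p a)) (ℕ.*-assoc a p R))) ⟩
    (1# - s) ^ (a ℕ.+ a ℕ.* (p ℕ.* R))  ≡⟨ cong ((1# - s) ^_) (ℕ.*-suc a (p ℕ.* R)) ⟨
    (1# - s) ^ (a ℕ.* repunit p (suc r))  ∎
    where R = repunit p r

  -- The indicator function of j ≤ a, for j < p.
  support : ℕ → ℕ → F
  support a j = φ a j ^ m

  support-1 : ∀ {a j} → a < p → j ≤ a → support a j ≡ 1#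
  support-1 a<p j≤a = fermat (φ-≢0 a<p j≤a)

  support-0 : ∀ {a j} → a < j → support a j ≡ 0#
  support-0 {a} {j} a<j = trans (cong (_^ m) (φ-vanishes a<j)) (0^ m m≢0)
    where
    0^ : ∀ n → n ≢ 0 → 0# ^ n ≡ 0#
    0^ zero    n≢0 = contradiction refl n≢0
    0^ (suc n) _   = zeroˡ _

  geometric : ∀ N y → (1# - y) * ∑< N (λ j → y ^ j) ≡ 1# - y ^ N
  geometric zero y = trans (cong ((1# - y) *_) (∑-zero _)) (solve 1 (λ y → (:1 :- y) :* :0 := :1 :- :1) refl y)
  geometric (suc N) y = begin
    (1# - y) * ∑< (suc N) (λ j → y ^ j)  ≡⟨ cong ((1# - y) *_) (trans (∑-suc _) (cong (1# +_) (sym (∑-*ˡ y _)))) ⟩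
    (1# - y) * (1# + y * ∑< N (λ j → y ^ j))  ≡⟨ solve 2 (λ y z → (:1 :- y) :* (:1 :+ y :* z) := (:1 :- y) :+ y :* ((:1 :- y) :* z)) refl y _ ⟩
    (1# - y) + y * ((1# - y) * ∑< N (λ j → y ^ j))  ≡⟨ cong (λ z → (1# - y) + y * z) (geometric N y) ⟩
    (1# - y) + y * (1# - y ^ N)  ≡⟨ solve 2 (λ y z → (:1 :- y) :+ y :* (:1 :- z) := :1 :- y :* z) refl y (y ^ N) ⟩
    1# - y ^ suc N  ∎

  -- (1 - y)ᵇ⁺¹ (1 + y + ⋯ + yᵇ⁺¹) = (1 - y)ᵇ (1 - yᵇ⁺²), and the term with yᵇ⁺² only
  -- contributes exponents above b + 1, which the support of (1 - y)ᵇ⁺¹ removes again.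
  module Descent (b : ℕ) (b<h : b < h) where

    private
      k L : ℕ
      k = suc (suc b)
      L = p ∸ k
      -- The digit product has degree 2 b + 2, which is at most 2 h = p - 1 because b < h; so there
      -- is no carry.
      k+b<p : k ℕ.+ b < p
      k+b<p = s≤s (subst (_≤ h ℕ.+ h) (ℕ.+-suc (suc b) b) (ℕ.+-mono-≤ b<h b<h))
      k≤p : k ≤ p
      k≤p = ℕ.<⇒≤ (ℕ.≤-<-trans (ℕ.m≤m+n k b) k+b<p)
      k+L≡p : k ℕ.+ L ≡ p
      k+L≡p = ℕ.m+[n∸m]≡n k≤p
      b<L : b < L
      b<L = ℕ.+-cancelˡ-< k b L (subst (k ℕ.+ b <_) (sym k+L≡p) k+b<p)
      1+b<p : suc b < p
      1+b<p = k≤p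

    shifted : ℕ → F
    shifted j with j ℕ.<? k
    ... | yes _ = 0#
    ... | no  _ = φ b (j ∸ k)

    shifted-< : ∀ {j} → j < k → shifted j ≡ 0#
    shifted-< {j} j<k with j ℕ.<? k
    ... | yes _  = refl
    ... | no ≮k  = contradiction j<k ≮k

    shifted-+ : ∀ j → shifted (k ℕ.+ j) ≡ φ b j
    shifted-+ j with k ℕ.+ j ℕ.<? k
    ... | yes lt = contradiction lt (ℕ.m+n≮m k j)
    ... | no _   = cong (φ b) (ℕ.m+n∸m≡n k j)

    product : ℕ → F
    product j = φ b j - shifted j

    split-p : ∀ f → ∑< p f ≡ ∑< k f + ∑< L (λ j → f (k ℕ.+ j))
    split-p f = trans (cong (λ n → ∑< n f) (sym k+L≡p)) (∑<-append k L f)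

    pol-support : ∀ y → pol (support (suc b)) y ≡ ∑< k (λ j → y ^ j)
    pol-support y = begin
      pol (support (suc b)) y  ≡⟨ split-p (λ j → support (suc b) j * y ^ j) ⟩
      ∑< k (λ j → support (suc b) j * y ^ j) + ∑< L (λ j → support (suc b) (k ℕ.+ j) * y ^ (k ℕ.+ j))
        ≡⟨ cong₂ _+_ (∑<-cong k (λ j j<k → trans (cong (_* y ^ j) (support-1 1+b<p (ℕ.≤-pred j<k))) (*-identityˡ _)))
             (∑<-0 L (λ j _ → trans (cong (_* y ^ (k ℕ.+ j)) (support-0 (ℕ.m≤m+n k j))) (zeroˡ _))) ⟩
      ∑< k (λ j → y ^ j) + 0#  ≡⟨ +-identityʳ _ ⟩
      ∑< k (λ j → y ^ j)  ∎

    pol-shifted : ∀ y → pol shifted y ≡ y ^ k * (1# - y) ^ b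
    pol-shifted y = begin
      pol shifted y  ≡⟨ split-p (λ j → shifted j * y ^ j) ⟩
      ∑< k (λ j → shifted j * y ^ j) + ∑< L (λ j → shifted (k ℕ.+ j) * y ^ (k ℕ.+ j))
        ≡⟨ cong₂ _+_ (∑<-0 k (λ j j<k → trans (cong (_* y ^ j) (shifted-< j<k)) (zeroˡ _)))
             (∑<-cong L (λ j _ → trans (cong₂ _*_ (shifted-+ j) (^-homo-* y k j))
               (solve 3 (λ a b c → a :* (b :* c) := b :* (a :* c)) refl (φ b j) (y ^ k) (y ^ j)))) ⟩
      0# + ∑< L (λ j → y ^ k * (φ b j * y ^ j))  ≡⟨ +-identityˡ _ ⟩
      ∑< L (λ j → y ^ k * (φ b j * y ^ j))  ≡⟨ ∑-*ˡ (y ^ k) _ ⟨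
      y ^ k * ∑< L (λ j → φ b j * y ^ j)  ≡⟨ cong (y ^ k *_) (φ-expansion b y L b<L) ⟩
      y ^ k * (1# - y) ^ b  ∎

    pol-product : ∀ y → pol (φ (suc b)) y * pol (support (suc b)) y ≡ pol product y
    pol-product y = begin
      pol (φ (suc b)) y * pol (support (suc b)) y  ≡⟨ cong₂ _*_ (φ-expansion (suc b) y p 1+b<p) (pol-support y) ⟩
      (1# - y) * (1# - y) ^ b * ∑< k (λ j → y ^ j)  ≡⟨ solve 3 (λ a b c → a :* b :* c := b :* (a :* c)) refl (1# - y) ((1# - y) ^ b) _ ⟩
      (1# - y) ^ b * ((1# - y) * ∑< k (λ j → y ^ j))  ≡⟨ cong ((1# - y) ^ b *_) (geometric k y) ⟩
      (1# - y) ^ b * (1# - y ^ k)  ≡⟨ solve 2 (λ a b → a :* (:1 :- b) := a :+ (:- :1) :* (b :* a)) refl ((1# - y) ^ b) (y ^ k) ⟩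
      (1# - y) ^ b + - 1# * (y ^ k * (1# - y) ^ b)  ≡⟨ cong₂ (λ u v → u + - 1# * v) (φ-expansion b y p (ℕ.<-trans (ℕ.n<1+n b) 1+b<p)) (pol-shifted y) ⟨
      pol (φ b) y + - 1# * pol shifted y  ≡⟨ cong (pol (φ b) y +_) (∑-*ˡ (- 1#) _) ⟩
      pol (φ b) y + ∑< p (λ j → - 1# * (shifted j * y ^ j))  ≡⟨ ∑-+ _ _ ⟨
      ∑< p (λ j → φ b j * y ^ j + - 1# * (shifted j * y ^ j))  ≡⟨ ∑<-cong p (λ j _ → solve 3 (λ a b c → a :* c :+ (:- :1) :* (b :* c) := (a :- b) :* c) refl (φ b j) (shifted j) (y ^ j)) ⟩
      pol product y  ∎

    product-support : ∀ j → product j * support (suc b) j ≡ φ b j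
    product-support j with ℕ.<-≤-connex j k
    ... | inj₁ j<k = begin
      (φ b j - shifted j) * support (suc b) j  ≡⟨ cong₂ (λ u v → (φ b j - u) * v) (shifted-< j<k) (support-1 1+b<p (ℕ.≤-pred j<k)) ⟩
      (φ b j - 0#) * 1#  ≡⟨ solve 1 (λ z → (z :- :0) :* :1 := z) refl (φ b j) ⟩
      φ b j  ∎
    ... | inj₂ k≤j = begin
      product j * support (suc b) j  ≡⟨ cong (product j *_) (support-0 k≤j) ⟩
      product j * 0#  ≡⟨ zeroʳ _ ⟩
      0#  ≡⟨ φ-vanishes (ℕ.<-trans (ℕ.n<1+n b) k≤j) ⟨
      φ b j  ∎

  2<p : 2 < p
  2<p = s≤s (ℕ.+-mono-≤ h>0 h>0)
    where
    h>0 : 0 < h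
    h>0 = ℕ.n≢0⇒n>0 λ e → ℕ.<-irrefl (cong (λ k → suc (k ℕ.+ k)) (sym e)) p>1

  -- Numbers whose base-p digits are 0 and 1

  bit-cube : ∀ j → φ 1 j * (φ 1 j * φ 1 j) ≡ φ 1 j
  bit-cube zero          = solve 0 (:1 :* (:1 :* :1) := :1) refl
  bit-cube (suc zero)    = solve 0 ((:0 :- :1) :* ((:0 :- :1) :* (:0 :- :1)) := :0 :- :1) refl
  bit-cube (suc (suc j)) = solve 0 ((:0 :- :0) :* ((:0 :- :0) :* (:0 :- :0)) := :0 :- :0) refl

  bit-sign : ∀ j → (- 1#) ^ j * φ 1 j ≡ φ 1 j * φ 1 j
  bit-sign zero          = refl
  bit-sign (suc zero)    = solve 0 ((:- :1) :* :1 :* (:0 :- :1) := (:0 :- :1) :* (:0 :- :1)) refl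
  bit-sign (suc (suc j)) = solve 1 (λ z → z :* (:0 :- :0) := (:0 :- :0) :* (:0 :- :0)) refl ((- 1#) ^ suc (suc j))

  bit-≤1 : ∀ {j} → φ 1 j ≢ 0# → j ≤ 1
  bit-≤1 {j} φ≢0 = ℕ.≮⇒≥ (φ≢0 ∘ φ-vanishes)

  module _ (r : ℕ) where

    -- If all r digits of n are 0 or 1, `σ n` is - 1 to the number of ones; otherwise it is 0.
    -- Squaring to `θ` forgets the sign.
    σ θ : ℕ → F
    σ = digitwise r (φ 1)
    θ = digitwise r (λ j → φ 1 j * φ 1 j)

    σσ≡θ : ∀ n → σ n * σ n ≡ θ n
    σσ≡θ = digitwise-* r (φ 1) (φ 1)

    σθ≡σ : ∀ n → σ n * θ n ≡ σ n
    σθ≡σ n = trans (digitwise-* r (φ 1) _ n) (digitwise-cong r n (λ j _ → bit-cube j))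

    θθ≡θ : ∀ n → θ n * θ n ≡ θ n
    θθ≡θ n = begin
      θ n * θ n  ≡⟨ cong (_* θ n) (σσ≡θ n) ⟨
      σ n * σ n * θ n  ≡⟨ *-assoc _ _ _ ⟩
      σ n * (σ n * θ n)  ≡⟨ cong (σ n *_) (σθ≡σ n) ⟩
      σ n * σ n  ≡⟨ σσ≡θ n ⟩
      θ n  ∎

  -- As p is odd, n has the parity of its digit sum, and for digits 0 and 1 the digit sum is the
  -- number of ones.
  σ-sign : ∀ r n → n < p ℕ.^ r → (- 1#) ^ n * σ r n ≡ θ r n
  σ-sign zero    zero    _          = *-identityˡ 1#
  σ-sign zero    (suc n) (s≤s ())
  σ-sign (suc r) n n< = begin
    (- 1#) ^ n * (φ 1 a * σ r n′)  ≡⟨ cong (_* (φ 1 a * σ r n′)) sign-split ⟩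
    (- 1#) ^ a * (- 1#) ^ n′ * (φ 1 a * σ r n′)  ≡⟨ solve 4 (λ a b c d → a :* b :* (c :* d) := (a :* c) :* (b :* d)) refl ((- 1#) ^ a) ((- 1#) ^ n′) (φ 1 a) (σ r n′) ⟩
    (- 1#) ^ a * φ 1 a * ((- 1#) ^ n′ * σ r n′)  ≡⟨ cong₂ _*_ (bit-sign a) (σ-sign r n′ (m<n*o⇒m/o<n (subst (n <_) (ℕ.*-comm p (p ℕ.^ r)) n<))) ⟩
    φ 1 a * φ 1 a * θ r n′  ∎
    where
    a = n % p
    n′ = n / p
    sign-split : (- 1#) ^ n ≡ (- 1#) ^ a * (- 1#) ^ n′
    sign-split = begin
      (- 1#) ^ n  ≡⟨ cong ((- 1#) ^_) (trans (m≡m%n+[m/n]*n n p) (cong (a ℕ.+_) (ℕ.*-comm n′ p))) ⟩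
      (- 1#) ^ (a ℕ.+ p ℕ.* n′)  ≡⟨ ^-homo-* (- 1#) a _ ⟩
      (- 1#) ^ a * (- 1#) ^ (p ℕ.* n′)  ≡⟨ cong ((- 1#) ^ a *_) (^-assocʳ (- 1#) p n′) ⟨
      (- 1#) ^ a * ((- 1#) ^ p) ^ n′  ≡⟨ cong (λ z → (- 1#) ^ a * z ^ n′) [-1]^p ⟩
      (- 1#) ^ a * (- 1#) ^ n′  ∎

  σ-digit : ∀ r {n} → σ (suc r) n ≢ 0# → n % p ≤ 1 × σ r (n / p) ≢ 0#
  σ-digit r ≢0 = bit-≤1 (factorˡ≢0 ≢0) , factorʳ≢0 ≢0

  -- Doubling a number with digits 0 and 1 produces no carry, because 2 < p.
  σ-bound : ∀ r {n} → n < p ℕ.^ r → σ r n ≢ 0# → n ℕ.+ n < p ℕ.^ r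
  σ-bound zero    {zero}  _ _ = s≤s z≤n
  σ-bound zero    {suc n} (s≤s ()) _
  σ-bound (suc r) {n} n< ≢0 = ℕ.<-≤-trans (subst (_< p ℕ.+ (n′ ℕ.+ n′) ℕ.* p) (sym double) below) above
    where
    a = n % p
    n′ = n / p
    IH : n′ ℕ.+ n′ < p ℕ.^ r
    IH = σ-bound r (m<n*o⇒m/o<n (subst (n <_) (ℕ.*-comm p (p ℕ.^ r)) n<)) (proj₂ (σ-digit r {n} ≢0))
    double : n ℕ.+ n ≡ (a ℕ.+ a) ℕ.+ (n′ ℕ.+ n′) ℕ.* p
    double = trans (cong₂ ℕ._+_ (m≡m%n+[m/n]*n n p) (m≡m%n+[m/n]*n n p))
      (+-*-Solver.solve 3 (λ a n p → (a :+′ n :*′ p) :+′ (a :+′ n :*′ p) :=′ (a :+′ a) :+′ (n :+′ n) :*′ p) refl a n′ p)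
      where open +-*-Solver using () renaming (_:+_ to infixl 6 _:+′_; _:*_ to infixl 7 _:*′_; _:=_ to infix 4 _:=′_)
    below : (a ℕ.+ a) ℕ.+ (n′ ℕ.+ n′) ℕ.* p < p ℕ.+ (n′ ℕ.+ n′) ℕ.* p
    below = ℕ.+-monoˡ-< _ (ℕ.≤-<-trans (ℕ.+-mono-≤ (proj₁ (σ-digit r {n} ≢0)) (proj₁ (σ-digit r {n} ≢0))) 2<p)
    above : p ℕ.+ (n′ ℕ.+ n′) ℕ.* p ≤ p ℕ.* p ℕ.^ r
    above = subst (suc (n′ ℕ.+ n′) ℕ.* p ≤_) (ℕ.*-comm (p ℕ.^ r) p) (ℕ.*-monoˡ-≤ p IH)

  -- Since 2 < p, adding two such numbers produces no carries, so the digits can be compared one at a time.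
  progression-free : ∀ r {A B C} → A < p ℕ.^ r → B < p ℕ.^ r → C < p ℕ.^ r →
                     σ r A ≢ 0# → σ r B ≢ 0# → σ r C ≢ 0# → A ℕ.+ B ≡ C ℕ.+ C → A ≡ C × B ≡ C
  progression-free zero (s≤s z≤n) (s≤s z≤n) (s≤s z≤n) _ _ _ _ = refl , refl
  progression-free (suc r) {A} {B} {C} A< B< C< σA σB σC e =
    reassemble A C (proj₁ bits) (proj₁ IH) , reassemble B C (proj₂ bits) (proj₂ IH)
    where
    sum-digits : ∀ X Y → X ℕ.+ Y ≡ (X % p ℕ.+ Y % p) ℕ.+ (X / p ℕ.+ Y / p) ℕ.* p
    sum-digits X Y = trans (cong₂ ℕ._+_ (m≡m%n+[m/n]*n X p) (m≡m%n+[m/n]*n Y p))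
      (+-*-Solver.solve 5 (λ a b n m p → (a :+′ n :*′ p) :+′ (b :+′ m :*′ p) :=′ (a :+′ b) :+′ (n :+′ m) :*′ p) refl (X % p) (Y % p) (X / p) (Y / p) p)
      where open +-*-Solver using () renaming (_:+_ to infixl 6 _:+′_; _:*_ to infixl 7 _:*′_; _:=_ to infix 4 _:=′_)
    small : ∀ X Y → σ (suc r) X ≢ 0# → σ (suc r) Y ≢ 0# → X % p ℕ.+ Y % p < p
    small X Y σX σY = ℕ.≤-<-trans (ℕ.+-mono-≤ (proj₁ (σ-digit r {X} σX)) (proj₁ (σ-digit r {Y} σY))) 2<p
    digits : A % p ℕ.+ B % p ≡ C % p ℕ.+ C % p × A / p ℕ.+ B / p ≡ C / p ℕ.+ C / p
    digits = division-unique p (small A B σA σB) (small C C σC σC)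
      (trans (sym (sum-digits A B)) (trans e (sum-digits C C)))
    bits : A % p ≡ C % p × B % p ≡ C % p
    bits = equal-bits (proj₁ (σ-digit r {A} σA)) (proj₁ (σ-digit r {B} σB)) (proj₁ (σ-digit r {C} σC)) (proj₁ digits)
      where
      equal-bits : ∀ {a b c} → a ≤ 1 → b ≤ 1 → c ≤ 1 → a ℕ.+ b ≡ c ℕ.+ c → a ≡ c × b ≡ c
      equal-bits z≤n       z≤n       z≤n       _ = refl , refl
      equal-bits (s≤s z≤n) (s≤s z≤n) (s≤s z≤n) _ = refl , refl
      equal-bits z≤n       z≤n       (s≤s z≤n) ()
      equal-bits z≤n       (s≤s z≤n) z≤n       ()
      equal-bits z≤n       (s≤s z≤n) (s≤s z≤n) ()
      equal-bits (s≤s z≤n) z≤n       z≤n       ()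
      equal-bits (s≤s z≤n) z≤n       (s≤s z≤n) ()
      equal-bits (s≤s z≤n) (s≤s z≤n) z≤n       ()
    lower : ∀ {X} → X < p ℕ.^ suc r → X / p < p ℕ.^ r
    lower {X} X< = m<n*o⇒m/o<n (subst (X <_) (ℕ.*-comm p (p ℕ.^ r)) X<)
    IH : A / p ≡ C / p × B / p ≡ C / p
    IH = progression-free r (lower A<) (lower B<) (lower C<)
      (proj₂ (σ-digit r {A} σA)) (proj₂ (σ-digit r {B} σB)) (proj₂ (σ-digit r {C} σC)) (proj₂ digits)
    reassemble : ∀ X Y → X % p ≡ Y % p → X / p ≡ Y / p → X ≡ Y
    reassemble X Y e₀ e₁ = trans (m≡m%n+[m/n]*n X p) (trans (cong₂ (λ a b → a ℕ.+ b ℕ.* p) e₀ e₁) (sym (m≡m%n+[m/n]*n Y p)))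

  digitwise-0 : ∀ r f → f 0 ≡ 1# → digitwise r f 0 ≡ 1#
  digitwise-0 zero    f e = refl
  digitwise-0 (suc r) f e = begin
    f (0 % p) * digitwise r f (0 / p)  ≡⟨ cong₂ (λ a b → f a * digitwise r f b) (m<n⇒m%n≡m {n = p} (s≤s z≤n)) (m<n⇒m/n≡0 {n = p} (s≤s z≤n)) ⟩
    f 0 * digitwise r f 0  ≡⟨ cong₂ _*_ e (digitwise-0 r f e) ⟩
    1# * 1#  ≡⟨ *-identityˡ 1# ⟩
    1#  ∎

  digitwise-1 : ∀ r f → f 0 ≡ 1# → digitwise (suc r) f 1 ≡ f 1
  digitwise-1 r f e = begin
    f (1 % p) * digitwise r f (1 / p)  ≡⟨ cong₂ (λ a b → f a * digitwise r f b) (m<n⇒m%n≡m p>1) (m<n⇒m/n≡0 p>1) ⟩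
    f 1 * digitwise r f 0  ≡⟨ cong (f 1 *_) (digitwise-0 r f e) ⟩
    f 1 * 1#  ≡⟨ *-identityʳ _ ⟩
    f 1  ∎

  ½ : F
  ½ = (1# + 1#) ⁻¹

  ½-double : ∀ x → ½ * (x + x) ≡ x
  ½-double x = begin
    ½ * (x + x)  ≡⟨ solve 2 (λ a x → a :* (x :+ x) := (:1 :+ :1) :* a :* x) refl ½ x ⟩
    (1# + 1#) * ½ * x  ≡⟨ cong (_* x) (⁻¹-inverse 2≢0) ⟩
    1# * x  ≡⟨ *-identityˡ x ⟩
    x  ∎

  module _ (r : ℕ) where

    -- The indicator function of the numbers whose base-p digits are 0 and 1
    -- with an odd number of ones.
    ω : ℕ → F
    ω n = ½ * (θ r n - σ r n)

    ω-idempotent : ∀ n → ω n * ω n ≡ ω n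
    ω-idempotent n = begin
      ½ * (T - S) * (½ * (T - S))  ≡⟨ solve 3 (λ a t s → a :* (t :- s) :* (a :* (t :- s)) := a :* (a :* ((t :* t :+ s :* s) :- (s :* t :+ s :* t)))) refl ½ T S ⟩
      ½ * (½ * ((T * T + S * S) - (S * T + S * T)))  ≡⟨ cong₂ (λ u v → ½ * (½ * (u - v))) (cong₂ _+_ (θθ≡θ r n) (σσ≡θ r n)) (cong₂ _+_ (σθ≡σ r n) (σθ≡σ r n)) ⟩
      ½ * (½ * ((T + T) - (S + S)))  ≡⟨ cong (½ *_) (solve 3 (λ a t s → a :* ((t :+ t) :- (s :+ s)) := a :* ((t :- s) :+ (t :- s))) refl ½ T S) ⟩
      ½ * (½ * ((T - S) + (T - S)))  ≡⟨ cong (½ *_) (½-double (T - S)) ⟩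
      ½ * (T - S)  ∎
      where
      T = θ r n
      S = σ r n

    ω-σ : ∀ {n} → ω n ≢ 0# → σ r n ≢ 0#
    ω-σ {n} ω≢0 σ≡0 = ω≢0 (begin
      ½ * (θ r n - σ r n)  ≡⟨ cong (λ t → ½ * (t - σ r n)) (σσ≡θ r n) ⟨
      ½ * (σ r n * σ r n - σ r n)  ≡⟨ cong (λ s → ½ * (s * s - s)) σ≡0 ⟩
      ½ * (0# * 0# - 0#)  ≡⟨ solve 1 (λ a → a :* (:0 :* :0 :- :0) := :0) refl ½ ⟩
      0#  ∎)

    ω-0 : ω 0 ≡ 0#
    ω-0 = begin
      ½ * (θ r 0 - σ r 0)  ≡⟨ cong₂ (λ t s → ½ * (t - s)) (digitwise-0 r _ (*-identityˡ 1#)) (digitwise-0 r _ refl) ⟩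
      ½ * (1# - 1#)  ≡⟨ solve 1 (λ a → a :* (:1 :- :1) := :0) refl ½ ⟩
      0#  ∎

    ω-odd : ∀ n → n < p ℕ.^ r → (- 1#) ^ n * ω n ≡ - ω n
    ω-odd n n< = begin
      s * (½ * (θ r n - σ r n))  ≡⟨ cong (λ t → s * (½ * (t - σ r n))) (σ-sign r n n<) ⟨
      s * (½ * (s * σ r n - σ r n))  ≡⟨ solve 3 (λ s a t → s :* (a :* (s :* t :- t)) := a :* (s :* s :* t :- s :* t)) refl s ½ (σ r n) ⟩
      ½ * (s * s * σ r n - s * σ r n)  ≡⟨ cong₂ (λ u v → ½ * (u * σ r n - v)) s² (σ-sign r n n<) ⟩
      ½ * (1# * σ r n - θ r n)  ≡⟨ solve 3 (λ a t u → a :* (:1 :* t :- u) := :- (a :* (u :- t))) refl ½ (σ r n) (θ r n) ⟩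
      - ω n  ∎
      where
      s = (- 1#) ^ n
      s² : s * s ≡ 1#
      s² = trans (sym (^-homo-* (- 1#) n n)) ([-1]^even n)

  ω-1 : ∀ r → ω (suc r) 1 ≡ 1#
  ω-1 r = begin
    ½ * (θ (suc r) 1 - σ (suc r) 1)  ≡⟨ cong₂ (λ t s → ½ * (t - s)) (digitwise-1 r _ (*-identityˡ 1#)) (digitwise-1 r _ refl) ⟩
    ½ * ((0# - 1#) * (0# - 1#) - (0# - 1#))  ≡⟨ cong (½ *_) (solve 0 ((:0 :- :1) :* (:0 :- :1) :- (:0 :- :1) := :1 :+ :1) refl) ⟩
    ½ * (1# + 1#)  ≡⟨ ½-double 1# ⟩
    1#  ∎

  -- Convolution over the multiplicative group

  ⁻¹-^ : ∀ x n → (x ⁻¹) ^ n * x ^ n ≡ nz x ^ n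
  ⁻¹-^ x n = trans (sym (^-distrib-* (x ⁻¹) x n)) (cong (_^ n) (*-comm (x ⁻¹) x))

  ⁻¹-^-cancel : ∀ {x} → x ≢ 0# → ∀ n → (x ⁻¹) ^ n * x ^ n ≡ 1#
  ⁻¹-^-cancel {x} x≢0 n = trans (⁻¹-^ x n) (trans (cong (_^ n) (nz-≢0 x≢0)) (1^ n))

  infixl 7 _⋆_
  _⋆_ : (F → F) → (F → F) → F → F
  (f ⋆ f′) s = ∑ (λ w → nz w * (f (s * w ⁻¹) * f′ w))

  power-multiplicative : ∀ n → Multiplicative (_^ n)
  power-multiplicative n x y = ^-distrib-* x y n

  inverse-power-multiplicative : ∀ n → Multiplicative (λ w → (w ⁻¹) ^ n)
  inverse-power-multiplicative n x y = trans (cong (_^ n) (⁻¹-distrib-* x y)) (^-distrib-* _ _ n)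

  product-multiplicative : ∀ {μ ν} → Multiplicative μ → Multiplicative ν → Multiplicative (λ w → μ w * ν w)
  product-multiplicative {μ} {ν} μ-* ν-* x y = trans (cong₂ _*_ (μ-* x y) (ν-* x y))
    (solve 4 (λ a b c d → (a :* b) :* (c :* d) := (a :* c) :* (b :* d)) refl (μ x) (μ y) (ν x) (ν y))

  opaque
    δ : ℕ → ℕ → F
    δ i j with i ℕ.≟ j
    ... | yes _ = 1#
    ... | no  _ = 0#

    δ-refl : ∀ i → δ i i ≡ 1#
    δ-refl i with i ℕ.≟ i
    ... | yes _ = refl
    ... | no ¬e = contradiction refl ¬e

    δ-≢ : ∀ {i j} → i ≢ j → δ i j ≡ 0#
    δ-≢ {i} {j} i≢j with i ℕ.≟ j
    ... | yes e = contradiction e i≢j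
    ... | no _  = refl

  ∑<-δ : ∀ n i (f : ℕ → F) → i < n → ∑< n (λ j → δ i j * f j) ≡ f i
  ∑<-δ (suc n) zero f _ = begin
    ∑< (suc n) (λ j → δ 0 j * f j)  ≡⟨ ∑-suc _ ⟩
    δ 0 0 * f 0 + ∑< n (λ j → δ 0 (suc j) * f (suc j))  ≡⟨ cong₂ _+_ (trans (cong (_* f 0) (δ-refl 0)) (*-identityˡ _))
                                                              (∑<-0 n (λ j _ → trans (cong (_* f (suc j)) (δ-≢ {0} {suc j} λ ())) (zeroˡ _))) ⟩
    f 0 + 0#  ≡⟨ +-identityʳ _ ⟩
    f 0  ∎
  ∑<-δ (suc n) (suc i) f (s≤s i<n) = begin
    ∑< (suc n) (λ j → δ (suc i) j * f j)  ≡⟨ ∑-suc _ ⟩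
    δ (suc i) 0 * f 0 + ∑< n (λ j → δ (suc i) (suc j) * f (suc j))  ≡⟨ cong₂ _+_ (trans (cong (_* f 0) (δ-≢ λ ())) (zeroˡ _))
                                                                            (∑<-cong n (λ j _ → cong (_* f (suc j)) (δ-suc j))) ⟩
    0# + ∑< n (λ j → δ i j * f (suc j))  ≡⟨ +-identityˡ _ ⟩
    ∑< n (λ j → δ i j * f (suc j))  ≡⟨ ∑<-δ n i (f ∘ suc) i<n ⟩
    f (suc i)  ∎
    where
    δ-suc : ∀ j → δ (suc i) (suc j) ≡ δ i j
    δ-suc j with i ℕ.≟ j
    ... | yes refl = trans (δ-refl (suc i)) (sym (δ-refl i))
    ... | no i≢j   = trans (δ-≢ (i≢j ∘ ℕ.suc-injective)) (sym (δ-≢ i≢j))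

  pairing : ∀ n l → n < m → l < m → ∑ (λ w → nz w * ((w ⁻¹) ^ n * w ^ l)) ≡ - 1# * δ n l
  pairing n l n<m l<m = byCases (n ℕ.≟ l)
    where
    μ : F → F
    μ w = (w ⁻¹) ^ n * w ^ l
    μ-* : Multiplicative μ
    μ-* = product-multiplicative (inverse-power-multiplicative n) (power-multiplicative l)
    byCases : Dec (n ≡ l) → ∑ (λ w → nz w * μ w) ≡ - 1# * δ n l
    byCases (yes refl) = trans (orthogonality₁ μ-* (⁻¹-^-cancel g≢0 n)) (sym (trans (cong (- 1# *_) (δ-refl n)) (*-identityʳ _)))
    byCases (no n≢l)   = trans (orthogonality₀ μ-* λ e → n≢l (g^-injective {0} z≤n n<m z≤n l<m
        (*-cancelˡ (^-≢0 n (⁻¹-≢0 g≢0)) (trans (⁻¹-^-cancel g≢0 n) (sym e)))))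
      (sym (trans (cong (- 1# *_) (δ-≢ n≢l)) (zeroʳ _)))

  -- The inner sum over w of w^(l - n) is - 1 for l = n and vanishes otherwise. Exponents stay below
  -- m because s⁰ and sᵐ agree at nonzero s and would not be orthogonal.
  ⋆-poly : ∀ α β s → (poly m α ⋆ poly m β) s ≡ - 1# * poly m (λ n → α n * β n) s
  ⋆-poly α β s = begin
    ∑ (λ w → nz w * (poly m α (s * w ⁻¹) * poly m β w))
      ≡⟨ ∑-cong expand ⟩
    ∑ (λ w → ∑< m (λ n → ∑< m (λ l → α n * s ^ n * (β l * (nz w * ((w ⁻¹) ^ n * w ^ l))))))
      ≡⟨ trans (∑-swap _) (∑<-cong m λ n _ →
           ∑-swap (λ w l → α n * s ^ n * (β (toℕ l) * (nz w * ((w ⁻¹) ^ n * w ^ toℕ l))))) ⟩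
    ∑< m (λ n → ∑< m (λ l → ∑ (λ w → α n * s ^ n * (β l * (nz w * ((w ⁻¹) ^ n * w ^ l))))))
      ≡⟨ ∑<-cong m (λ n n< → ∑<-cong m (λ l l< → collect n l n< l<)) ⟩
    ∑< m (λ n → ∑< m (λ l → δ n l * (- 1# * (α n * β l * s ^ n))))
      ≡⟨ ∑<-cong m (λ n n< → ∑<-δ m n (λ l → - 1# * (α n * β l * s ^ n)) n<) ⟩
    ∑< m (λ n → - 1# * (α n * β n * s ^ n))
      ≡⟨ ∑-*ˡ (- 1#) _ ⟨
    - 1# * poly m (λ n → α n * β n) s ∎
    where
    collect : ∀ n l → n < m → l < m → ∑ (λ w → α n * s ^ n * (β l * (nz w * ((w ⁻¹) ^ n * w ^ l)))) ≡ δ n l * (- 1# * (α n * β l * s ^ n))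
    collect n l n< l< = begin
      ∑ (λ w → α n * s ^ n * (β l * (nz w * ((w ⁻¹) ^ n * w ^ l))))
        ≡⟨ trans (sym (∑-*ˡ _ _)) (cong (α n * s ^ n *_) (trans (sym (∑-*ˡ (β l) _)) (cong (β l *_) (pairing n l n< l<)))) ⟩
      α n * s ^ n * (β l * (- 1# * δ n l))
        ≡⟨ solve 4 (λ a s b d → a :* s :* (b :* ((:- :1) :* d)) := d :* ((:- :1) :* (a :* b :* s))) refl (α n) (s ^ n) (β l) (δ n l) ⟩
      δ n l * (- 1# * (α n * β l * s ^ n)) ∎
    expand : ∀ w → nz w * (poly m α (s * w ⁻¹) * poly m β w) ≡
                   ∑< m (λ n → ∑< m (λ l → α n * s ^ n * (β l * (nz w * ((w ⁻¹) ^ n * w ^ l)))))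
    expand w = begin
      nz w * (poly m α (s * w ⁻¹) * poly m β w)
        ≡⟨ cong (nz w *_) (trans (∑-*ʳ _ _) (∑<-cong m (λ n _ → ∑-*ˡ (α n * (s * w ⁻¹) ^ n) _))) ⟩
      nz w * ∑< m (λ n → ∑< m (λ l → α n * (s * w ⁻¹) ^ n * (β l * w ^ l)))
        ≡⟨ trans (∑-*ˡ _ _) (∑<-cong m (λ n _ → trans (∑-*ˡ _ _) (∑<-cong m (λ l _ → term n l)))) ⟩
      ∑< m (λ n → ∑< m (λ l → α n * s ^ n * (β l * (nz w * ((w ⁻¹) ^ n * w ^ l))))) ∎
      where
      term : ∀ n l → nz w * (α n * (s * w ⁻¹) ^ n * (β l * w ^ l)) ≡ α n * s ^ n * (β l * (nz w * ((w ⁻¹) ^ n * w ^ l)))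
      term n l = trans (cong (λ z → nz w * (α n * z * (β l * w ^ l))) (^-distrib-* s (w ⁻¹) n))
        (solve 6 (λ z a s v b w → z :* (a :* (s :* v) :* (b :* w)) := a :* s :* (b :* (z :* (v :* w)))) refl
          (nz w) (α n) (s ^ n) ((w ⁻¹) ^ n) (β l) (w ^ l))

  -- On nonzero elements the exponent m contributes a constant.
  poly-last : ∀ α {s} → s ≢ 0# → poly N α s ≡ poly m α s + α m
  poly-last α {s} s≢0 = begin
    poly (suc m) α s  ≡⟨ cong (λ n → poly n α s) (ℕ.+-comm 1 m) ⟩
    poly (m ℕ.+ 1) α s  ≡⟨ ∑<-append m 1 (λ n → α n * s ^ n) ⟩
    poly m α s + ∑< 1 (λ n → α (m ℕ.+ n) * s ^ (m ℕ.+ n))  ≡⟨ cong (poly m α s +_) (trans (∑-suc _) (trans (cong (α (m ℕ.+ 0) * s ^ (m ℕ.+ 0) +_) (∑-zero _)) (+-identityʳ _))) ⟩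
    poly m α s + α (m ℕ.+ 0) * s ^ (m ℕ.+ 0)  ≡⟨ cong (λ n → poly m α s + α n * s ^ n) (ℕ.+-identityʳ m) ⟩
    poly m α s + α m * s ^ m  ≡⟨ cong (poly m α s +_) (trans (cong (α m *_) (fermat s≢0)) (*-identityʳ _)) ⟩
    poly m α s + α m  ∎

  -- The functions E and Ê

  R : ℕ
  R = suc r

  W : ℕ → F
  W = ω R

  E : F → F
  E = poly N W

  W-odd : ∀ {A} → A < N → W A ≢ 0# → ∃ λ k → A ≡ suc (k ℕ.+ k)
  W-odd {A} A<N W≢0 with halve A
  ... | inj₂ odd = odd
  ... | inj₁ (k , refl) = contradiction (x≡-x⇒x≡0 2≢0 (begin
    W (k ℕ.+ k)  ≡⟨ *-identityˡ _ ⟨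
    1# * W (k ℕ.+ k)  ≡⟨ cong (_* W (k ℕ.+ k)) ([-1]^even k) ⟨
    (- 1#) ^ (k ℕ.+ k) * W (k ℕ.+ k)  ≡⟨ ω-odd R (k ℕ.+ k) (subst (k ℕ.+ k <_) (sym size≡) A<N) ⟩
    - W (k ℕ.+ k)  ∎)) W≢0

  W-positive : ∀ {A} → W A ≢ 0# → 1 ≤ A
  W-positive {zero}  W≢0 = contradiction (ω-0 R) W≢0
  W-positive {suc A} _   = s≤s z≤n

  E-odd : ∀ s → E (- s) ≡ - E s
  E-odd s = begin
    ∑< N (λ n → W n * (- s) ^ n)  ≡⟨ ∑<-cong N term ⟩
    ∑< N (λ n → - 1# * (W n * s ^ n))  ≡⟨ ∑-*ˡ (- 1#) _ ⟨
    - 1# * E s  ≡⟨ -1*x≈-x (E s) ⟩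
    - E s  ∎
    where
    term : ∀ n → n < N → W n * (- s) ^ n ≡ - 1# * (W n * s ^ n)
    term n n<N = begin
      W n * (- s) ^ n  ≡⟨ cong (λ z → W n * z ^ n) (-1*x≈-x s) ⟨
      W n * (- 1# * s) ^ n  ≡⟨ cong (W n *_) (^-distrib-* (- 1#) s n) ⟩
      W n * ((- 1#) ^ n * s ^ n)  ≡⟨ solve 3 (λ a b c → a :* (b :* c) := (b :* a) :* c) refl (W n) ((- 1#) ^ n) (s ^ n) ⟩
      (- 1#) ^ n * W n * s ^ n  ≡⟨ cong (_* s ^ n) (ω-odd R n (subst (n <_) (sym size≡) n<N)) ⟩
      - W n * s ^ n  ≡⟨ solve 2 (λ a b → (:- a) :* b := (:- :1) :* (a :* b)) refl (W n) (s ^ n) ⟩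
      - 1# * (W n * s ^ n)  ∎

  W-bound : ∀ {A} → A < N → W A ≢ 0# → A ℕ.+ A ≤ m
  W-bound {A} A<N W≢0 = ℕ.≤-pred (subst (A ℕ.+ A <_) size≡ (σ-bound R (subst (A <_) (sym size≡) A<N) (ω-σ R {A} W≢0)))

  -- Equality of powers of g is a congruence modulo m. By `W-positive` and `W-bound` both sums lie
  -- in 1, ..., m, so it is an equality of integers.
  W-progression-free : ∀ {A B C} → A < N → B < N → C < N → W A ≢ 0# → W B ≢ 0# → W C ≢ 0# →
                       g ^ (A ℕ.+ B) ≡ g ^ (C ℕ.+ C) → A ≡ C × B ≡ C
  W-progression-free {A} {B} {C} A< B< C< WA WB WC e = progression-free R
    (subst (A <_) (sym size≡) A<) (subst (B <_) (sym size≡) B<) (subst (C <_) (sym size≡) C<) (ω-σ R {A} WA) (ω-σ R {B} WB) (ω-σ R {C} WC)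
    (g^-injective {1} (ℕ.≤-trans (W-positive WA) (ℕ.m≤m+n A B)) (s≤s A+B≤m)
                      (ℕ.≤-trans (W-positive WC) (ℕ.m≤m+n C C)) (s≤s (W-bound C< WC)) e)
    where
    A+B≤m : A ℕ.+ B ≤ m
    A+B≤m with ℕ.≤-total A B
    ... | inj₁ A≤B = ℕ.≤-trans (ℕ.+-monoˡ-≤ B A≤B) (W-bound B< WB)
    ... | inj₂ B≤A = ℕ.≤-trans (ℕ.+-monoʳ-≤ A B≤A) (W-bound A< WA)

  -- For odd A this is exactly (A + o)/2. The shift by o makes the exponent even at the price of a
  -- factor xᵒ, which is constant on fibers once 0 is fixed.
  η : ℕ → ℕ
  η A = ⌊ A ℕ.+ o /2⌋

  η-double : ∀ {A} → A < N → W A ≢ 0# → η A ℕ.+ η A ≡ A ℕ.+ o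
  η-double {A} A<N W≢0 with W-odd A<N W≢0
  ... | k , refl = trans (cong (λ n → ⌊ n /2⌋ ℕ.+ ⌊ n /2⌋) double) (trans (cong (λ n → n ℕ.+ n) (sym (ℕ.n≡⌊n+n/2⌋ c))) (sym double))
    where
    c = suc (k ℕ.+ o′)
    double : suc (k ℕ.+ k) ℕ.+ o ≡ c ℕ.+ c
    double = trans (cong (suc (k ℕ.+ k) ℕ.+_) o-odd)
      (+-*-Solver.solve 2 (λ k o → (:one :+′ (k :+′ k)) :+′ (:one :+′ (o :+′ o)) :=′ (:one :+′ (k :+′ o)) :+′ (:one :+′ (k :+′ o))) refl k o′)
      where
      open +-*-Solver using (con; Polynomial) renaming (_:+_ to infixl 6 _:+′_; _:=_ to infix 4 _:=′_)
      :one : Polynomial 2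
      :one = con 1

  η-power : ∀ {A} → A < N → W A ≢ 0# → ∀ x → x ^ η A * x ^ η A ≡ x ^ A * x ^ o
  η-power {A} A<N W≢0 x = trans (sym (^-homo-* x (η A) (η A))) (trans (cong (x ^_) (η-double A<N W≢0)) (^-homo-* x A o))

  Ê : F → F
  Ê x = ∑< N (λ A → W A * x ^ η A)

  Ê-square : ∀ a → Ê (a * a) ≡ a ^ o * E a
  Ê-square a = trans (∑<-cong N term) (sym (∑-*ˡ (a ^ o) _))
    where
    term : ∀ A → A < N → W A * (a * a) ^ η A ≡ a ^ o * (W A * a ^ A)
    term A A<N with zero? (W A)
    ... | inj₁ W≡0 = trans (vanish ((a * a) ^ η A)) (sym (trans (cong (a ^ o *_) (vanish (a ^ A))) (zeroʳ _)))
      where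
      vanish : ∀ z → W A * z ≡ 0#
      vanish z = trans (cong (_* z) W≡0) (zeroˡ z)
    ... | inj₂ W≢0 = begin
      W A * (a * a) ^ η A  ≡⟨ cong (W A *_) (trans (^-distrib-* a a (η A)) (η-power A<N W≢0 a)) ⟩
      W A * (a ^ A * a ^ o)  ≡⟨ solve 3 (λ w x y → w :* (x :* y) := y :* (w :* x)) refl (W A) (a ^ A) (a ^ o) ⟩
      a ^ o * (W A * a ^ A)  ∎

  -- The common form of the two convolutions over squares. The character f C (1/w) μ A B (w) is
  -- trivial on the squares exactly if its value at g², the square of its value at g, is 1. The
  -- hypotheses say that for exponents A, B, C in the support of `W` this happens only when A = B =
  -- C, so the coefficients a C and b C get multiplied.
  module Step (f : ℕ → F → F) (μ : ℕ → ℕ → F → F)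
              (f-* : ∀ C → Multiplicative (f C)) (μ-* : ∀ A B → Multiplicative (μ A B))
              (diagonal : ∀ {C} → C < N → W C ≢ 0# → (f C (g ⁻¹) * μ C C g) * (f C (g ⁻¹) * μ C C g) ≡ 1#)
              (only-diagonal : ∀ {A B C} → A < N → B < N → C < N → W A ≢ 0# → W B ≢ 0# → W C ≢ 0# →
                 (f C (g ⁻¹) * μ A B g) * (f C (g ⁻¹) * μ A B g) ≡ 1# → A ≡ C × B ≡ C)
              (a b : ℕ → F) where

    private
      ρ : ℕ → ℕ → ℕ → F → F
      ρ C A B w = f C (w ⁻¹) * μ A B w

      ρ-* : ∀ C A B → Multiplicative (ρ C A B)
      ρ-* C A B = product-multiplicative (λ x y → trans (cong (f C) (⁻¹-distrib-* x y)) (f-* C _ _)) (μ-* A B)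

      S : ℕ → ℕ → ℕ → F
      S C A B = ∑ (λ w → sq w * ρ C A B w)

      c : F → ℕ → ℕ → ℕ → F
      c x C A B = (W C * f C x) * ((W A * a A) * (W B * b B))

      null : ∀ x {C A B} → c x C A B ≡ 0# → c x C A B * S C A B ≡ δ C A * (δ C B * (- 1# * c x C A B))
      null x {C} {A} {B} e = trans (cong (_* S C A B) e) (trans (zeroˡ _) (sym (trans (cong (λ u → δ C A * (δ C B * (- 1# * u))) e)
        (solve 2 (λ d e → d :* (e :* ((:- :1) :* :0)) := :0) refl (δ C A) (δ C B)))))

      c-S : ∀ x {C A B} → C < N → A < N → B < N → c x C A B * S C A B ≡ δ C A * (δ C B * (- 1# * c x C A B))
      c-S x {C} {A} {B} C< A< B< with zero? (W C) | zero? (W A) | zero? (W B)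
      ... | inj₁ z | _ | _ = null x (trans (cong (λ u → (u * f C x) * ((W A * a A) * (W B * b B))) z)
          (solve 2 (λ f v → (:0 :* f) :* v := :0) refl (f C x) ((W A * a A) * (W B * b B))))
      ... | inj₂ _ | inj₁ z | _ = null x (trans (cong (λ u → (W C * f C x) * ((u * a A) * (W B * b B))) z)
          (solve 3 (λ u f v → u :* ((:0 :* f) :* v) := :0) refl (W C * f C x) (a A) (W B * b B)))
      ... | inj₂ _ | inj₂ _ | inj₁ z = null x (trans (cong (λ u → (W C * f C x) * ((W A * a A) * (u * b B))) z)
          (solve 3 (λ u f v → u :* (v :* (:0 :* f)) := :0) refl (W C * f C x) (b B) (W A * a A)))
      ... | inj₂ WC | inj₂ WA | inj₂ WB with C ℕ.≟ A | C ℕ.≟ B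
      ...   | yes refl | yes refl = begin
        c x C C C * S C C C  ≡⟨ cong (c x C C C *_) (square-orthogonality₁ (ρ-* C C C) (diagonal C< WC)) ⟩
        c x C C C * - 1#  ≡⟨ solve 1 (λ z → z :* (:- :1) := :1 :* (:1 :* ((:- :1) :* z))) refl (c x C C C) ⟩
        1# * (1# * (- 1# * c x C C C))  ≡⟨ cong (λ d → d * (d * (- 1# * c x C C C))) (δ-refl C) ⟨
        δ C C * (δ C C * (- 1# * c x C C C))  ∎
      ...   | no C≢A | _ = trans (cong (c x C A B *_) (square-orthogonality₀ (ρ-* C A B)
                (C≢A ∘ sym ∘ proj₁ ∘ only-diagonal A< B< C< WA WB WC)))
              (trans (zeroʳ _) (sym (trans (cong (_* (δ C B * (- 1# * c x C A B))) (δ-≢ C≢A)) (zeroˡ _))))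
      ...   | yes _ | no C≢B = trans (cong (c x C A B *_) (square-orthogonality₀ (ρ-* C A B)
                (C≢B ∘ sym ∘ proj₂ ∘ only-diagonal A< B< C< WA WB WC)))
              (trans (zeroʳ _) (sym (trans (cong (λ d → δ C A * (d * (- 1# * c x C A B))) (δ-≢ C≢B))
                (solve 2 (λ d z → d :* (:0 :* z) := :0) refl (δ C A) (- 1# * c x C A B)))))

    kernel : F → F
    kernel x = ∑< N (λ C → W C * f C x)

    density : F → F
    density w = ∑< N (λ A → ∑< N (λ B → (W A * a A) * (W B * b B) * μ A B w))

    result : F → F
    result x = ∑< N (λ C → W C * (a C * b C) * f C x)

    step : ∀ x → ∑ (λ w → sq w * (kernel (x * w ⁻¹) * density w)) ≡ - 1# * result x
    step x = begin
      ∑ (λ w → sq w * (kernel (x * w ⁻¹) * density w))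
        ≡⟨ ∑-cong expand ⟩
      ∑ (λ w → ∑< N (λ C → ∑< N (λ A → ∑< N (λ B → c x C A B * (sq w * ρ C A B w)))))
        ≡⟨ trans (∑-swap _) (∑<-cong N λ C _ → trans (∑-swap _) (∑<-cong N λ A _ →
             trans (∑-swap (λ w B → c x C A (toℕ B) * (sq w * ρ C A (toℕ B) w))) (∑<-cong N λ B _ → sym (∑-*ˡ (c x C A B) (λ w → sq w * ρ C A B w))))) ⟩
      ∑< N (λ C → ∑< N (λ A → ∑< N (λ B → c x C A B * S C A B)))
        ≡⟨ ∑<-cong N (λ C C< → ∑<-cong N (λ A A< → ∑<-cong N (λ B B< → c-S x C< A< B<))) ⟩
      ∑< N (λ C → ∑< N (λ A → ∑< N (λ B → δ C A * (δ C B * (- 1# * c x C A B)))))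
        ≡⟨ ∑<-cong N (λ C C< → trans (∑<-cong N (λ A _ → trans (sym (∑-*ˡ (δ C A) _)) (cong (δ C A *_) (∑<-δ N C (λ B → - 1# * c x C A B) C<))))
             (∑<-δ N C (λ A → - 1# * c x C A C) C<)) ⟩
      ∑< N (λ C → - 1# * c x C C C)
        ≡⟨ ∑-*ˡ (- 1#) _ ⟨
      - 1# * ∑< N (λ C → c x C C C)
        ≡⟨ cong (- 1# *_) (∑<-cong N λ C _ → collapse C) ⟩
      - 1# * result x ∎
      where
      collapse : ∀ C → c x C C C ≡ W C * (a C * b C) * f C x
      collapse C = begin
        (W C * f C x) * ((W C * a C) * (W C * b C))
          ≡⟨ solve 4 (λ w f a b → (w :* f) :* ((w :* a) :* (w :* b)) := (w :* w) :* w :* (a :* b) :* f) refl (W C) (f C x) (a C) (b C) ⟩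
        W C * W C * W C * (a C * b C) * f C x
          ≡⟨ cong (λ w → w * (a C * b C) * f C x) (trans (cong (_* W C) (ω-idempotent R C)) (ω-idempotent R C)) ⟩
        W C * (a C * b C) * f C x ∎
      expand : ∀ w → sq w * (kernel (x * w ⁻¹) * density w) ≡ ∑< N (λ C → ∑< N (λ A → ∑< N (λ B → c x C A B * (sq w * ρ C A B w))))
      expand w = begin
        sq w * (kernel (x * w ⁻¹) * density w)
          ≡⟨ cong (sq w *_) (trans (∑-*ʳ _ _) (∑<-cong N (λ C _ → trans (∑-*ˡ (W C * f C (x * w ⁻¹)) _) (∑<-cong N (λ A _ →
               ∑-*ˡ (W C * f C (x * w ⁻¹)) (λ B → (W A * a A) * (W (toℕ B) * b (toℕ B)) * μ A (toℕ B) w)))))) ⟩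
        sq w * ∑< N (λ C → ∑< N (λ A → ∑< N (λ B → W C * f C (x * w ⁻¹) * ((W A * a A) * (W B * b B) * μ A B w))))
          ≡⟨ trans (∑-*ˡ _ _) (∑<-cong N (λ C _ → trans (∑-*ˡ _ _) (∑<-cong N (λ A _ → trans (∑-*ˡ _ _) (∑<-cong N (λ B _ → term C A B)))))) ⟩
        ∑< N (λ C → ∑< N (λ A → ∑< N (λ B → c x C A B * (sq w * ρ C A B w)))) ∎
        where
        term : ∀ C A B → sq w * (W C * f C (x * w ⁻¹) * ((W A * a A) * (W B * b B) * μ A B w)) ≡ c x C A B * (sq w * ρ C A B w)
        term C A B = trans (cong (λ z → sq w * (W C * z * ((W A * a A) * (W B * b B) * μ A B w))) (f-* C x (w ⁻¹)))
          (solve 7 (λ q u f v p s t → q :* (u :* (f :* v) :* (p :* s :* t)) := (u :* f) :* (p :* s) :* (q :* (v :* t))) refl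
            (sq w) (W C) (f C x) (f C (w ⁻¹)) (W A * a A) (W B * b B) (μ A B w))

  -- Fissions of a cyclotomic scheme

  DifferencePowers : CoherentConfiguration (suc m) → Set
  DifferencePowers Z = ∀ {x y x′ y′} → colour x y ≡ colour x′ y′ → (x - y) ^ o ≡ (x′ - y′) ^ o
    where open Colouring Z

  module ThreePoints (Z : CoherentConfiguration (suc m)) (difference-colour : DifferencePowers Z)
    (fixed-0 : Colouring.IsFixed Z 0#) (fixed-1 : Colouring.IsFixed Z 1#) (fixed-c : Colouring.IsFixed Z (- g)) where

    open Colouring Z

    -- Functions of x / y that are constant on basic relations

    /-≢0 : ∀ {x y} → x ≢ 0# → y ≢ 0# → x * y ⁻¹ ≢ 0#
    /-≢0 x≢0 y≢0 = *-≢0 x≢0 (⁻¹-≢0 y≢0)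

    fiber-zero : ∀ {x x′} → colour x x ≡ colour x′ x′ → x ≡ 0# → x′ ≡ 0#
    fiber-zero e refl = fixed-0 e

    fiber-^o : ∀ {x x′} → colour x x ≡ colour x′ x′ → x ^ o ≡ x′ ^ o
    fiber-^o {x} {x′} e = begin
      x ^ o  ≡⟨ cong (_^ o) (x-0 x) ⟨
      (x - 0#) ^ o  ≡⟨ difference-colour (colour-fixed fixed-0 e) ⟩
      (x′ - 0#) ^ o  ≡⟨ cong (_^ o) (x-0 x′) ⟩
      x′ ^ o  ∎
      where
      x-0 : ∀ z → z - 0# ≡ z
      x-0 z = solve 1 (λ z → z :- :0 := z) refl z

    fiber-⁻¹^o : ∀ {x x′} → colour x x ≡ colour x′ x′ → (x ⁻¹) ^ o ≡ (x′ ⁻¹) ^ o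
    fiber-⁻¹^o {x} {x′} e with zero? x
    ... | inj₁ x≡0 = cong (λ z → (z ⁻¹) ^ o) (trans x≡0 (sym (fiber-zero e x≡0)))
    ... | inj₂ x≢0 = *-cancelʳ (^-≢0 o x≢0) (begin
      (x ⁻¹) ^ o * x ^ o  ≡⟨ ⁻¹-^-cancel x≢0 o ⟩
      1#  ≡⟨ ⁻¹-^-cancel (x≢0 ∘ fiber-zero (sym e)) o ⟨
      (x′ ⁻¹) ^ o * x′ ^ o  ≡⟨ cong ((x′ ⁻¹) ^ o *_) (fiber-^o e) ⟨
      (x′ ⁻¹) ^ o * x ^ o  ∎)

    ^half : ∀ x → x ^ half ≡ (x ^ o) ^ _∣_.quotient o∣half
    ^half x = begin
      x ^ half  ≡⟨ cong (x ^_) (_∣_.equality o∣half) ⟩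
      x ^ (q ℕ.* o)  ≡⟨ cong (x ^_) (ℕ.*-comm q o) ⟩
      x ^ (o ℕ.* q)  ≡⟨ ^-assocʳ x o q ⟨
      (x ^ o) ^ q  ∎
      where q = _∣_.quotient o∣half

    -- As o divides `half`, the quadratic character is a power of x ↦ xᵒ; so no fiber contains both
    -- squares and nonsquares.
    fiber-χ : ∀ {x x′} → colour x x ≡ colour x′ x′ → χ x ≡ χ x′
    fiber-χ {x} {x′} e = trans (^half x) (trans (cong (_^ _∣_.quotient o∣half) (fiber-^o e)) (sym (^half x′)))

    -- A record instead of a plain function type, so that `f` can be inferred from a proof.
    record Invariant (f : F → F) : Set where
      constructor invariant
      field
        respects : ∀ {x y x′ y′} → x ≢ 0# → y ≢ 0# → x′ ≢ 0# → y′ ≢ 0# →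
                   colour x y ≡ colour x′ y′ → f (x * y ⁻¹) ≡ f (x′ * y′ ⁻¹)

    open Invariant

    invariant-cong : ∀ {f f′} → (∀ {s} → s ≢ 0# → f s ≡ f′ s) → Invariant f → Invariant f′
    invariant-cong eq Hf = invariant λ x≢0 y≢0 x′≢0 y′≢0 e →
      trans (sym (eq (/-≢0 x≢0 y≢0))) (trans (respects Hf x≢0 y≢0 x′≢0 y′≢0 e) (eq (/-≢0 x′≢0 y′≢0)))

    invariant-const : ∀ a → Invariant (λ _ → a)
    invariant-const a = invariant λ _ _ _ _ _ → refl

    invariant-+ : ∀ {f f′} → Invariant f → Invariant f′ → Invariant (λ s → f s + f′ s)
    invariant-+ Hf Hf′ = invariant λ a b c d e → cong₂ _+_ (respects Hf a b c d e) (respects Hf′ a b c d e)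

    invariant-* : ∀ {f f′} → Invariant f → Invariant f′ → Invariant (λ s → f s * f′ s)
    invariant-* Hf Hf′ = invariant λ a b c d e → cong₂ _*_ (respects Hf a b c d e) (respects Hf′ a b c d e)

    invariant-^o : Invariant (_^ o)
    invariant-^o = invariant λ {x} {y} {x′} {y′} _ _ _ _ e → begin
      (x * y ⁻¹) ^ o  ≡⟨ ^-distrib-* x (y ⁻¹) o ⟩
      x ^ o * (y ⁻¹) ^ o  ≡⟨ cong₂ _*_ (fiber-^o (colour-left e)) (fiber-⁻¹^o (colour-right e)) ⟩
      x′ ^ o * (y′ ⁻¹) ^ o  ≡⟨ ^-distrib-* x′ (y′ ⁻¹) o ⟨
      (x′ * y′ ⁻¹) ^ o  ∎

    -- Write 1 - x / y = (y - x) / y: the colour determines (y - x)ᵒ, and the fiber of y determines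
    -- yᵒ.
    invariant-1-s : Invariant (λ s → (1# - s) ^ half)
    invariant-1-s = invariant λ _ y≢0 _ y′≢0 e →
      trans (^half _) (trans (cong (_^ _∣_.quotient o∣half) (step y≢0 y′≢0 e)) (sym (^half _)))
      where
      factor : ∀ {x y} → y ≢ 0# → (1# - x * y ⁻¹) ^ o ≡ (y - x) ^ o * (y ⁻¹) ^ o
      factor {x} {y} y≢0 = begin
        (1# - x * y ⁻¹) ^ o  ≡⟨ cong (λ z → (z - x * y ⁻¹) ^ o) (⁻¹-inverse y≢0) ⟨
        (y * y ⁻¹ - x * y ⁻¹) ^ o  ≡⟨ cong (_^ o) (solve 3 (λ x y z → y :* z :- x :* z := (y :- x) :* z) refl x y (y ⁻¹)) ⟩
        ((y - x) * y ⁻¹) ^ o  ≡⟨ ^-distrib-* (y - x) (y ⁻¹) o ⟩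
        (y - x) ^ o * (y ⁻¹) ^ o  ∎
      step : ∀ {x y x′ y′} → y ≢ 0# → y′ ≢ 0# → colour x y ≡ colour x′ y′ → (1# - x * y ⁻¹) ^ o ≡ (1# - x′ * y′ ⁻¹) ^ o
      step y≢0 y′≢0 e = trans (factor y≢0) (trans (cong₂ _*_ (difference-colour (colour-converse e)) (fiber-⁻¹^o (colour-right e))) (sym (factor y′≢0)))

    -- After rescaling w by y, the convolution at x / y is the sum of f(x / w) f′(w / y) over the
    -- paths x → w → y, and matching the paths preserves it. The point w = 0 contributes nothing and
    -- is matched with itself because 0 is fixed.
    invariant-⋆ : ∀ {f f′} → Invariant f → Invariant f′ → Invariant (f ⋆ f′)
    invariant-⋆ {f} {f′} Hf Hf′ = invariant λ {x} {y} {x′} {y′} x≢0 y≢0 x′≢0 y′≢0 e → begin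
      (f ⋆ f′) (x * y ⁻¹)  ≡⟨ reindex x y y≢0 ⟨
      ∑ (term x y)  ≡⟨ byPermutation x≢0 y≢0 x′≢0 y′≢0 (colour-permutation e) ⟩
      ∑ (term x′ y′)  ≡⟨ reindex x′ y′ y′≢0 ⟩
      (f ⋆ f′) (x′ * y′ ⁻¹)  ∎
      where
      term : F → F → F → F
      term x y w = nz w * (f (x * w ⁻¹) * f′ (w * y ⁻¹))
      reindex : ∀ x y → y ≢ 0# → ∑ (term x y) ≡ (f ⋆ f′) (x * y ⁻¹)
      reindex x y y≢0 = trans (∑-permute (term x y) (scaling y≢0)) (∑-cong λ w → cong₂ _*_ (nz-* y w y≢0) (cong₂ _*_
        (cong f (trans (cong (x *_) (⁻¹-distrib-* y w)) (sym (*-assoc x (y ⁻¹) (w ⁻¹)))))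
        (cong f′ (begin
          y * w * y ⁻¹  ≡⟨ solve 3 (λ y w z → y :* w :* z := (y :* z) :* w) refl y w (y ⁻¹) ⟩
          y * y ⁻¹ * w  ≡⟨ cong (_* w) (⁻¹-inverse y≢0) ⟩
          1# * w  ≡⟨ *-identityˡ w ⟩
          w  ∎))))
      vanish : ∀ {x y w} → w ≡ 0# → term x y w ≡ 0#
      vanish {x} {y} refl = trans (cong (_* (f (x * 0# ⁻¹) * f′ (0# * y ⁻¹))) nz-0) (zeroˡ _)
      byPermutation : ∀ {x y x′ y′} → x ≢ 0# → y ≢ 0# → x′ ≢ 0# → y′ ≢ 0# →
        Matching x y x′ y′ →
        ∑ (term x y) ≡ ∑ (term x′ y′)
      byPermutation {x} {y} {x′} {y′} x≢0 y≢0 x′≢0 y′≢0 (π , eq) = trans (∑-cong matched) (sym (∑-permute (term x′ y′) π))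
        where
        matched : ∀ w → term x y w ≡ term x′ y′ (π ⟨$⟩ʳ w)
        matched w with zero? w
        ... | inj₁ w≡0 = trans (vanish w≡0) (sym (vanish (fiber-zero (colour-right (proj₁ (eq w))) w≡0)))
        ... | inj₂ w≢0 = cong₂ _*_ (trans (nz-≢0 w≢0) (sym (nz-≢0 w′≢0)))
          (cong₂ _*_ (respects Hf x≢0 w≢0 x′≢0 w′≢0 (proj₁ (eq w))) (respects Hf′ w≢0 y≢0 w′≢0 y′≢0 (proj₂ (eq w))))
          where
          w′≢0 : π ⟨$⟩ʳ w ≢ 0#
          w′≢0 = w≢0 ∘ fiber-zero (sym (colour-right (proj₁ (eq w))))

    -- Convolution over the multiplicative group multiplies coefficients.
    invariant-hadamard : ∀ α β → Invariant (poly N α) → Invariant (poly N β) → Invariant (poly N (λ n → α n * β n))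
    invariant-hadamard α β Hα Hβ = invariant-cong (λ {s} s≢0 → begin
        - 1# * (poly m α ⋆ poly m β) s + α m * β m  ≡⟨ cong (λ z → - 1# * z + α m * β m) (⋆-poly α β s) ⟩
        - 1# * (- 1# * poly m (λ n → α n * β n) s) + α m * β m  ≡⟨ solve 2 (λ P c → (:- :1) :* ((:- :1) :* P) :+ c := P :+ c) refl _ _ ⟩
        poly m (λ n → α n * β n) s + α m * β m  ≡⟨ poly-last (λ n → α n * β n) s≢0 ⟨
        poly N (λ n → α n * β n) s  ∎)
      (invariant-+ (invariant-* (invariant-const (- 1#)) (invariant-⋆ (truncate α Hα) (truncate β Hβ))) (invariant-const (α m * β m)))
      where
      truncate : ∀ α → Invariant (poly N α) → Invariant (poly m α)
      truncate α Hα = invariant-cong (λ {s} s≢0 → begin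
          poly N α s + - α m  ≡⟨ cong (_+ - α m) (poly-last α s≢0) ⟩
          poly m α s + α m + - α m  ≡⟨ solve 2 (λ P c → P :+ c :+ (:- c) := P) refl _ _ ⟩
          poly m α s  ∎) (invariant-+ Hα (invariant-const (- α m)))

    invariant-hadamard-^ : ∀ α k → Invariant (poly N α) → Invariant (poly N (λ n → α n ^ suc k))
    invariant-hadamard-^ α zero    Hα = invariant-cong (λ {s} _ → ∑<-cong N λ n _ → cong (_* s ^ n) (sym (*-identityʳ (α n)))) Hα
    invariant-hadamard-^ α (suc k) Hα = invariant-hadamard α (λ n → α n ^ suc k) Hα (invariant-hadamard-^ α k Hα)

    record Digital (f : ℕ → F) : Set where
      constructor digital
      field
        isInvariant : Invariant (poly N (digitwise R f))

    open Digital

    conjugates≡poly : ∀ f s → conjugates R f s ≡ poly N (digitwise R f) s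
    conjugates≡poly f s = trans (conjugates-poly R f s) (cong (λ n → poly n (digitwise R f) s) size≡)

    poly-cong : ∀ {α β} → (∀ n → α n ≡ β n) → ∀ s → poly N α s ≡ poly N β s
    poly-cong eq s = ∑<-cong N λ n _ → cong (_* s ^ n) (eq n)

    digital-cong : ∀ {f f′} → (∀ j → f j ≡ f′ j) → Digital f → Digital f′
    digital-cong eq (digital Hf) = digital (invariant-cong (λ {s} _ → poly-cong (λ n → digitwise-cong R n (λ j _ → eq j)) s) Hf)

    digital-* : ∀ {f f′} → Digital f → Digital f′ → Digital (λ j → f j * f′ j)
    digital-* {f} {f′} (digital Hf) (digital Hf′) =
      digital (invariant-cong (λ {s} _ → poly-cong (digitwise-* R f f′) s) (invariant-hadamard (digitwise R f) (digitwise R f′) Hf Hf′))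

    -- By Fermat this replaces every nonzero coefficient by 1, so the support of an available
    -- polynomial is available too.
    digital-^m : ∀ {f} → Digital f → Digital (λ j → f j ^ m)
    digital-^m {f} (digital Hf) = digital (invariant-cong
      (λ {s} _ → poly-cong (λ n → trans (digitwise-^ R f (suc (ℕ.pred m)) n) (cong (λ k → digitwise R (λ j → f j ^ k) n) 1+pred)) s)
      (invariant-hadamard-^ (digitwise R f) (ℕ.pred m) Hf))
      where
      1+pred : suc (ℕ.pred m) ≡ m
      1+pred = ℕ.suc-pred m {{ℕ.≢-nonZero m≢0}}

    digital-product : ∀ {f f′ f″} → (∀ y → pol f y * pol f′ y ≡ pol f″ y) → Digital f → Digital f′ → Digital f″
    digital-product {f} {f′} {f″} eq (digital Hf) (digital Hf′) = digital (invariant-cong (λ {s} _ → begin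
      poly N (digitwise R f) s * poly N (digitwise R f′) s  ≡⟨ cong₂ _*_ (conjugates≡poly f s) (conjugates≡poly f′ s) ⟨
      conjugates R f s * conjugates R f′ s  ≡⟨ conjugates-* R eq s ⟩
      conjugates R f″ s  ≡⟨ conjugates≡poly f″ s ⟩
      poly N (digitwise R f″) s  ∎) (invariant-* Hf Hf′))

    h<p : h < p
    h<p = s≤s (ℕ.m≤m+n h h)

    -- The number `k` counts the steps down from h, where the function is (1 - s)^half itself.
    digital-φ : ∀ k a → a ℕ.+ k ≡ h → Digital (φ a)
    digital-φ zero a e = digital (invariant-cong (λ {s} _ → begin
      (1# - s) ^ half  ≡⟨ conjugates-φ R h<p s ⟨
      conjugates R (φ h) s  ≡⟨ conjugates≡poly (φ h) s ⟩
      poly N (digitwise R (φ h)) s  ≡⟨ cong (λ b → poly N (digitwise R (φ b)) s) (trans (sym e) (ℕ.+-identityʳ a)) ⟩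
      poly N (digitwise R (φ a)) s  ∎) invariant-1-s)
    digital-φ (suc k) a e = digital-cong product-support
      (digital-* (digital-product pol-product upper (digital-^m upper)) (digital-^m upper))
      where
      open Descent a (subst (a <_) e (ℕ.m<m+n a (s≤s z≤n)))
      upper : Digital (φ (suc a))
      upper = digital-φ k (suc a) (trans (sym (ℕ.+-suc a k)) e)

    digital-φ₁ : Digital (φ 1)
    digital-φ₁ = digital-φ (ℕ.pred h) 1 (ℕ.suc-pred h {{ℕ.≢-nonZero h≢0}})
      where
      h≢0 : h ≢ 0
      h≢0 e = ℕ.<⇒≱ 2<p (ℕ.≤-trans (ℕ.≤-reflexive (cong (λ k → suc (k ℕ.+ k)) e)) (s≤s z≤n))

    invariant-E : Invariant E
    invariant-E = invariant-cong (λ {s} _ → begin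
      ½ * (poly N (θ R) s + - 1# * poly N (σ R) s)  ≡⟨ cong (λ z → ½ * (poly N (θ R) s + z)) (∑-*ˡ (- 1#) _) ⟩
      ½ * (poly N (θ R) s + ∑< N (λ n → - 1# * (σ R n * s ^ n)))  ≡⟨ cong (½ *_) (∑-+ _ _) ⟨
      ½ * ∑< N (λ n → θ R n * s ^ n + - 1# * (σ R n * s ^ n))  ≡⟨ ∑-*ˡ ½ _ ⟩
      ∑< N (λ n → ½ * (θ R n * s ^ n + - 1# * (σ R n * s ^ n)))  ≡⟨ ∑<-cong N (λ n _ →
        solve 4 (λ a t s z → a :* (t :* z :+ (:- :1) :* (s :* z)) := a :* (t :- s) :* z) refl ½ (θ R n) (σ R n) (s ^ n)) ⟩
      E s  ∎)
      (invariant-* (invariant-const ½) (invariant-+ (isInvariant (digital-* digital-φ₁ digital-φ₁))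
        (invariant-* (invariant-const (- 1#)) (isInvariant digital-φ₁))))

    -- Square roots of x / y by the parity of paths

    private
      does⁻ : {P : Set} (P? : Dec P) → does P? ≡ true → P
      does⁻ (yes q) _ = q

      ∧-true : ∀ a b → a ∧ b ≡ true → a ≡ true × b ≡ true
      ∧-true true b e = refl , e

    module _ {x y : F} (x≢0 : x ≢ 0#) (y≢0 : y ≢ 0#) where

      reflection : F → F
      reflection w = x * y * w ⁻¹

      reflection-⁻¹ : ∀ w → (reflection w) ⁻¹ ≡ (x * y) ⁻¹ * w
      reflection-⁻¹ w = trans (⁻¹-distrib-* (x * y) (w ⁻¹)) (cong ((x * y) ⁻¹ *_) (⁻¹-involutive w))

      reflection-involutive : ∀ w → reflection (reflection w) ≡ w
      reflection-involutive w = begin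
        x * y * (reflection w) ⁻¹  ≡⟨ cong (x * y *_) (reflection-⁻¹ w) ⟩
        x * y * ((x * y) ⁻¹ * w)  ≡⟨ *-assoc _ _ _ ⟨
        x * y * (x * y) ⁻¹ * w  ≡⟨ cong (_* w) (⁻¹-inverse (*-≢0 x≢0 y≢0)) ⟩
        1# * w  ≡⟨ *-identityˡ w ⟩
        w  ∎

      reflection-left : ∀ w → x * (reflection w) ⁻¹ ≡ w * y ⁻¹
      reflection-left w = begin
        x * (reflection w) ⁻¹  ≡⟨ cong (x *_) (trans (reflection-⁻¹ w) (cong (_* w) (⁻¹-distrib-* x y))) ⟩
        x * (x ⁻¹ * y ⁻¹ * w)  ≡⟨ solve 4 (λ x u v w → x :* (u :* v :* w) := (x :* u) :* (w :* v)) refl x (x ⁻¹) (y ⁻¹) w ⟩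
        x * x ⁻¹ * (w * y ⁻¹)  ≡⟨ cong (_* (w * y ⁻¹)) (⁻¹-inverse x≢0) ⟩
        1# * (w * y ⁻¹)  ≡⟨ *-identityˡ _ ⟩
        w * y ⁻¹  ∎

      reflection-right : ∀ w → reflection w * y ⁻¹ ≡ x * w ⁻¹
      reflection-right w = begin
        x * y * w ⁻¹ * y ⁻¹  ≡⟨ solve 4 (λ x y u v → x :* y :* u :* v := (y :* v) :* (x :* u)) refl x y (w ⁻¹) (y ⁻¹) ⟩
        y * y ⁻¹ * (x * w ⁻¹)  ≡⟨ cong (_* (x * w ⁻¹)) (⁻¹-inverse y≢0) ⟩
        1# * (x * w ⁻¹)  ≡⟨ *-identityˡ _ ⟩
        x * w ⁻¹  ∎

      reflection-fixed : ∀ {w} → w ≢ 0# → reflection w ≡ w → w * w ≡ x * y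
      reflection-fixed {w} w≢0 fix = begin
        w * w  ≡⟨ cong (_* w) fix ⟨
        x * y * w ⁻¹ * w  ≡⟨ *-assoc _ _ _ ⟩
        x * y * (w ⁻¹ * w)  ≡⟨ cong (x * y *_) (trans (*-comm (w ⁻¹) w) (⁻¹-inverse w≢0)) ⟩
        x * y * 1#  ≡⟨ *-identityʳ _ ⟩
        x * y  ∎

    -- The paths x → w → y with both ratios in the class of a are permuted by w ↦ x y / w, whose
    -- fixed points are the square roots of x y; so their number is odd exactly when x / y
    -- has a square root in the class.
    module Roots (a : F) (a≢0 : a ≢ 0#) where

      -- Both sᵒ and E(s) are invariant, and together they determine Ê(s²).
      inClass : F → Bool
      inClass s = does (s ^ o ≟ a ^ o) ∧ does (E s ≟ E a)

      inClass⁻ : ∀ {s} → inClass s ≡ true → s ^ o ≡ a ^ o × E s ≡ E a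
      inClass⁻ {s} e with ∧-true (does (s ^ o ≟ a ^ o)) (does (E s ≟ E a)) e
      ... | e₁ , e₂ = does⁻ (s ^ o ≟ a ^ o) e₁ , does⁻ (E s ≟ E a) e₂

      inClass-a : inClass a ≡ true
      inClass-a with a ^ o ≟ a ^ o | E a ≟ E a
      ... | yes _ | yes _ = refl
      ... | no ¬e | _     = contradiction refl ¬e
      ... | yes _ | no ¬e = contradiction refl ¬e

      inClass-≢0 : ∀ {s} → inClass s ≡ true → s ≢ 0#
      inClass-≢0 e refl = ^-≢0 o a≢0 (trans (sym (proj₁ (inClass⁻ e))) (trans (cong (0# ^_) o-odd) (zeroˡ _)))

      -- An odd power distinguishes a from - a, so one root in the class excludes the other.
      ¬inClass-neg : inClass (- a) ≢ true
      ¬inClass-neg e = ^-≢0 o a≢0 (x≡-x⇒x≡0 2≢0 (trans (sym (proj₁ (inClass⁻ e))) (neg-^-odd {o} {o′} o-odd a)))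

      path : F → F → F → Bool
      path x y w = inClass (x * w ⁻¹) ∧ inClass (w * y ⁻¹)

      path⁻ : ∀ x y w → path x y w ≡ true → inClass (w * y ⁻¹) ≡ true
      path⁻ x y w e = proj₂ (∧-true (inClass (x * w ⁻¹)) (inClass (w * y ⁻¹)) e)

      path-≢0 : ∀ {x y w} → path x y w ≡ true → w ≢ 0#
      path-≢0 {x} {y} {w} e = factorˡ≢0 (inClass-≢0 (path⁻ x y w e))

      path-reflection : ∀ {x y} (x≢0 : x ≢ 0#) (y≢0 : y ≢ 0#) w → path x y (reflection x≢0 y≢0 w) ≡ path x y w
      path-reflection {x} {y} x≢0 y≢0 w = trans
        (cong₂ (λ u v → inClass u ∧ inClass v) (reflection-left x≢0 y≢0 w) (reflection-right x≢0 y≢0 w)) (Bool.∧-comm (inClass (w * y ⁻¹)) (inClass (x * w ⁻¹)))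

      paths-odd : ∀ {x y} → x ≢ 0# → y ≢ 0# → x ≡ a * a * y → 𝔹Σ.sum (path x y) ≡ true
      paths-odd {x} {y} x≢0 y≢0 x≡ = uniqueFixedPoint⇒odd (reflection x≢0 y≢0) (reflection-involutive x≢0 y≢0)
        (path x y) (path-reflection x≢0 y≢0) (a * y) on-path fixed unique
        where
        x/ay≡a : x * (a * y) ⁻¹ ≡ a
        x/ay≡a = begin
          x * (a * y) ⁻¹  ≡⟨ cong (_* (a * y) ⁻¹) (trans x≡ (*-assoc a a y)) ⟩
          a * (a * y) * (a * y) ⁻¹  ≡⟨ *-assoc _ _ _ ⟩
          a * nz (a * y)  ≡⟨ cong (a *_) (nz-≢0 (*-≢0 a≢0 y≢0)) ⟩
          a * 1#  ≡⟨ *-identityʳ a ⟩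
          a  ∎
        bz/z≡b : ∀ b → b * y * y ⁻¹ ≡ b
        bz/z≡b b = trans (*-assoc b y _) (trans (cong (b *_) (nz-≢0 y≢0)) (*-identityʳ b))
        on-path : path x y (a * y) ≡ true
        on-path = trans (cong₂ (λ u v → inClass u ∧ inClass v) x/ay≡a (bz/z≡b a)) (trans (cong (_∧ inClass a) inClass-a) inClass-a)
        fixed : reflection x≢0 y≢0 (a * y) ≡ a * y
        fixed = trans (solve 3 (λ x y z → x :* y :* z := (x :* z) :* y) refl x y ((a * y) ⁻¹)) (cong (_* y) x/ay≡a)
        unique : ∀ w → path x y w ≡ true → reflection x≢0 y≢0 w ≡ w → w ≡ a * y
        unique w pw fix with x²≡y²⇒x≡±y {w} {a * y} (trans (reflection-fixed x≢0 y≢0 (path-≢0 {x} {y} pw) fix)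
            (trans (cong (_* y) x≡) (solve 2 (λ a y → a :* a :* y :* y := (a :* y) :* (a :* y)) refl a y)))
        ... | inj₁ w≡ = w≡
        ... | inj₂ w≡ = contradiction (trans (cong inClass (sym neg-a)) (path⁻ x y w pw)) ¬inClass-neg
          where
          neg-a : w * y ⁻¹ ≡ - a
          neg-a = trans (cong (_* y ⁻¹) (trans w≡ (-‿distribˡ-* a y))) (bz/z≡b (- a))

      root : ∀ {x y x′ y′} → x ≢ 0# → y ≢ 0# → x′ ≢ 0# → y′ ≢ 0# → x ≡ a * a * y → colour x y ≡ colour x′ y′ →
             ∃ λ b → x′ ≡ b * b * y′ × b ^ o ≡ a ^ o × E b ≡ E a
      root {x} {y} {x′} {y′} x≢0 y≢0 x′≢0 y′≢0 x≡ e
        with any? (λ w → (path x′ y′ w Bool.≟ true) ×-dec (reflection x′≢0 y′≢0 w ≟ w))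
      ... | yes (w , pw , fix) = w * y′ ⁻¹ , sym x′≡ , inClass⁻ (path⁻ x′ y′ w pw)
        where
        x′≡ : w * y′ ⁻¹ * (w * y′ ⁻¹) * y′ ≡ x′
        x′≡ = begin
          w * y′ ⁻¹ * (w * y′ ⁻¹) * y′  ≡⟨ solve 3 (λ w z y → w :* z :* (w :* z) :* y := (w :* w) :* z :* (y :* z)) refl w (y′ ⁻¹) y′ ⟩
          w * w * y′ ⁻¹ * nz y′  ≡⟨ cong₂ _*_ (cong (_* y′ ⁻¹) (reflection-fixed x′≢0 y′≢0 (path-≢0 {x′} {y′} pw) fix)) (nz-≢0 y′≢0) ⟩
          x′ * y′ * y′ ⁻¹ * 1#  ≡⟨ solve 3 (λ x y z → x :* y :* z :* :1 := x :* (y :* z)) refl x′ y′ (y′ ⁻¹) ⟩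
          x′ * nz y′  ≡⟨ cong (x′ *_) (nz-≢0 y′≢0) ⟩
          x′ * 1#  ≡⟨ *-identityʳ x′ ⟩
          x′  ∎
      ... | no ¬∃ = contradiction (trans (sym odd) even) λ ()
        where
        even : 𝔹Σ.sum (path x′ y′) ≡ false
        even = fixedPointFree⇒even (reflection x′≢0 y′≢0) (reflection-involutive x′≢0 y′≢0) (path x′ y′)
          (path-reflection x′≢0 y′≢0) (λ w pw fix → ¬∃ (w , pw , fix))
        byPermutation : Matching x y x′ y′ →
                        𝔹Σ.sum (path x y) ≡ 𝔹Σ.sum (path x′ y′)
        byPermutation (π , eq) = trans (𝔹Σ.sum-cong-≗ matched) (sym (𝔹Σ.sum-permute (path x′ y′) π))
          where
          same : ∀ {s s′} → s ^ o ≡ s′ ^ o → E s ≡ E s′ → inClass s ≡ inClass s′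
          same e₁ e₂ = cong₂ (λ u v → does (u ≟ a ^ o) ∧ does (v ≟ E a)) e₁ e₂
          matched : ∀ w → path x y w ≡ path x′ y′ (π ⟨$⟩ʳ w)
          matched w with zero? w
          ... | inj₁ w≡0 = cong₂ _∧_ (cong inClass (trans (left x w≡0) (sym (left x′ w′≡0)))) (cong inClass (trans (right y w≡0) (sym (right y′ w′≡0))))
            where
            w′≡0 : π ⟨$⟩ʳ w ≡ 0#
            w′≡0 = fiber-zero (colour-right (proj₁ (eq w))) w≡0
            left : ∀ z {w} → w ≡ 0# → z * w ⁻¹ ≡ 0#
            left z refl = trans (cong (z *_) 0⁻¹≡0) (zeroʳ z)
            right : ∀ z {w} → w ≡ 0# → w * z ⁻¹ ≡ 0#
            right z refl = zeroˡ _
          ... | inj₂ w≢0 = cong₂ _∧_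
              (same (respects invariant-^o x≢0 w≢0 x′≢0 w′≢0 (proj₁ (eq w))) (respects invariant-E x≢0 w≢0 x′≢0 w′≢0 (proj₁ (eq w))))
              (same (respects invariant-^o w≢0 y≢0 w′≢0 y′≢0 (proj₂ (eq w))) (respects invariant-E w≢0 y≢0 w′≢0 y′≢0 (proj₂ (eq w))))
            where
            w′≢0 : π ⟨$⟩ʳ w ≢ 0#
            w′≢0 = w≢0 ∘ fiber-zero (sym (colour-right (proj₁ (eq w))))
        odd : 𝔹Σ.sum (path x′ y′) ≡ true
        odd = trans (sym (byPermutation (colour-permutation e))) (paths-odd x≢0 y≢0 x≡)

    -- Functions on the squares that are constant on fibers

    record SquareInvariant (f : F → F) : Set where
      constructor squareInvariant
      field
        respects-squares : ∀ {x y x′ y′} → x ≢ 0# → y ≢ 0# → x′ ≢ 0# → y′ ≢ 0# → IsSquare (x * y ⁻¹) → IsSquare (x′ * y′ ⁻¹) →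
                           colour x y ≡ colour x′ y′ → f (x * y ⁻¹) ≡ f (x′ * y′ ⁻¹)

    -- Only squares x are considered, because Ê is controlled only at square ratios: for squares x
    -- and w the ratio x / w is again a square.
    record FiberConstant (v : F → F) : Set where
      constructor fiberConstant
      field
        respects-fibers : ∀ {x x′} → IsSquare x → IsSquare x′ → colour x x ≡ colour x′ x′ → v x ≡ v x′

    open SquareInvariant
    open FiberConstant

    invariant⇒squareInvariant : ∀ {f} → Invariant f → SquareInvariant f
    invariant⇒squareInvariant Hf = squareInvariant λ a b c d _ _ e → respects Hf a b c d e

    /-⁻¹ : ∀ x y → (x * y ⁻¹) ⁻¹ ≡ y * x ⁻¹
    /-⁻¹ x y = trans (⁻¹-distrib-* x (y ⁻¹)) (trans (cong (x ⁻¹ *_) (⁻¹-involutive y)) (*-comm _ _))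

    -- Inverting x / y corresponds to passing to the converse relation.
    squareInvariant-⁻¹ : ∀ {f} → SquareInvariant f → SquareInvariant (λ s → f (s ⁻¹))
    squareInvariant-⁻¹ {f} Hf = squareInvariant λ {x} {y} {x′} {y′} x≢0 y≢0 x′≢0 y′≢0 sq sq′ e → begin
      f ((x * y ⁻¹) ⁻¹)  ≡⟨ cong f (/-⁻¹ x y) ⟩
      f (y * x ⁻¹)  ≡⟨ respects-squares Hf y≢0 x≢0 y′≢0 x′≢0 (subst IsSquare (/-⁻¹ x y) (square-⁻¹ sq))
                                   (subst IsSquare (/-⁻¹ x′ y′) (square-⁻¹ sq′)) (colour-converse e) ⟩
      f (y′ * x′ ⁻¹)  ≡⟨ cong f (/-⁻¹ x′ y′) ⟨
      f ((x′ * y′ ⁻¹) ⁻¹)  ∎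

    fiberConstant-cong : ∀ {v v′} → (∀ {x} → IsSquare x → v x ≡ v′ x) → FiberConstant v → FiberConstant v′
    fiberConstant-cong eq Vv = fiberConstant λ sx sx′ e → trans (sym (eq sx)) (trans (respects-fibers Vv sx sx′ e) (eq sx′))

    fiberConstant-* : ∀ {v v′} → FiberConstant v → FiberConstant v′ → FiberConstant (λ x → v x * v′ x)
    fiberConstant-* Vv Vv′ = fiberConstant λ sx sx′ e → cong₂ _*_ (respects-fibers Vv sx sx′ e) (respects-fibers Vv′ sx sx′ e)

    fiberConstant-scale : ∀ a {v} → FiberConstant v → FiberConstant (λ x → a * v x)
    fiberConstant-scale a Vv = fiberConstant λ sx sx′ e → cong (a *_) (respects-fibers Vv sx sx′ e)

    x/1≡x : ∀ x → x * 1# ⁻¹ ≡ x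
    x/1≡x x = trans (cong (x *_) 1⁻¹≡1) (*-identityʳ x)

    squareInvariant⇒fiberConstant : ∀ {f} → SquareInvariant f → FiberConstant f
    squareInvariant⇒fiberConstant {f} Hf = fiberConstant λ {x} {x′} sx sx′ e → begin
      f x  ≡⟨ cong f (x/1≡x x) ⟨
      f (x * 1# ⁻¹)  ≡⟨ respects-squares Hf (square-≢0 sx) 1≢0 (square-≢0 sx′) 1≢0
                             (subst IsSquare (sym (x/1≡x x)) sx) (subst IsSquare (sym (x/1≡x x′)) sx′) (colour-fixed fixed-1 e) ⟩
      f (x′ * 1# ⁻¹)  ≡⟨ cong f (x/1≡x x′) ⟩
      f x′  ∎

    -- If x / y = a², parity provides b with x′ / y′ = b² in the class of a. The root b need not be
    -- a, but Ê(b²) depends only on bᵒ and E(b).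
    squareInvariant-Ê : SquareInvariant Ê
    squareInvariant-Ê = squareInvariant λ {x} {y} {x′} {y′} x≢0 y≢0 x′≢0 y′≢0 sq sq′ e →
      transfer x≢0 y≢0 x′≢0 y′≢0 e (squareRoot sq)
      where
      restore : ∀ {x y a} → y ≢ 0# → x * y ⁻¹ ≡ a → x ≡ a * y
      restore {x} {y} {a} y≢0 q = begin
        x  ≡⟨ *-identityʳ x ⟨
        x * 1#  ≡⟨ cong (x *_) (nz-≢0 y≢0) ⟨
        x * (y * y ⁻¹)  ≡⟨ solve 3 (λ x y z → x :* (y :* z) := (x :* z) :* y) refl x y (y ⁻¹) ⟩
        x * y ⁻¹ * y  ≡⟨ cong (_* y) q ⟩
        a * y  ∎
      unrestore : ∀ {x y a} → y ≢ 0# → x ≡ a * y → x * y ⁻¹ ≡ a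
      unrestore {x} {y} {a} y≢0 refl = trans (*-assoc a y _) (trans (cong (a *_) (nz-≢0 y≢0)) (*-identityʳ a))
      transfer : ∀ {x y x′ y′} → x ≢ 0# → y ≢ 0# → x′ ≢ 0# → y′ ≢ 0# → colour x y ≡ colour x′ y′ →
                 (∃ λ a → a ≢ 0# × x * y ⁻¹ ≡ a * a) → Ê (x * y ⁻¹) ≡ Ê (x′ * y′ ⁻¹)
      transfer {x} {y} {x′} {y′} x≢0 y≢0 x′≢0 y′≢0 e (a , a≢0 , q) = viaRoot (Roots.root a a≢0 x≢0 y≢0 x′≢0 y′≢0 (restore y≢0 q) e)
        where
        viaRoot : (∃ λ b → x′ ≡ b * b * y′ × b ^ o ≡ a ^ o × E b ≡ E a) → Ê (x * y ⁻¹) ≡ Ê (x′ * y′ ⁻¹)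
        viaRoot (b , x′≡ , bᵒ , Eb) = begin
          Ê (x * y ⁻¹)  ≡⟨ cong Ê q ⟩
          Ê (a * a)  ≡⟨ Ê-square a ⟩
          a ^ o * E a  ≡⟨ cong₂ _*_ bᵒ Eb ⟨
          b ^ o * E b  ≡⟨ Ê-square b ⟨
          Ê (b * b)  ≡⟨ cong Ê (unrestore y′≢0 x′≡) ⟨
          Ê (x′ * y′ ⁻¹)  ∎

    -- The paths x → w → x are matched with those at `x′`. Matched points w have the same quadratic
    -- character, so the sum over squares is carried to itself.
    fiberConstant-⋆ : ∀ {f v} → SquareInvariant f → FiberConstant v → FiberConstant (λ x → ∑ (λ w → sq w * (f (x * w ⁻¹) * v w)))
    fiberConstant-⋆ {f} {v} Hf Vv = fiberConstant λ sx sx′ e → byPermutation sx sx′ (colour-permutation e)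
      where
      term : F → F → F
      term x w = sq w * (f (x * w ⁻¹) * v w)
      byPermutation : ∀ {x x′} → IsSquare x → IsSquare x′ →
        Matching x x x′ x′ →
        ∑ (term x) ≡ ∑ (term x′)
      byPermutation {x} {x′} sx sx′ (π , eq) = trans (∑-cong matched) (sym (∑-permute (term x′) π))
        where
        matched : ∀ w → term x w ≡ term x′ (π ⟨$⟩ʳ w)
        matched w = byCases (χ w ≟ 1#)
          where
          w′ : F
          w′ = π ⟨$⟩ʳ w
          χ≡ : χ w ≡ χ w′
          χ≡ = fiber-χ (colour-right (proj₁ (eq w)))
          vanish : ∀ {x w} → ¬ IsSquare w → term x w ≡ 0#
          vanish {x} {w} ¬s = trans (cong (_* (f (x * w ⁻¹) * v w)) (sq-nonsquare ¬s)) (zeroˡ _)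
          byCases : Dec (IsSquare w) → term x w ≡ term x′ w′
          byCases (no ¬s) = trans (vanish ¬s) (sym (vanish (¬s ∘ trans χ≡)))
          byCases (yes s) = cong₂ _*_ (cong₂ _+_ (trans (nz-≢0 (square-≢0 s)) (sym (nz-≢0 (square-≢0 s′)))) χ≡)
            (cong₂ _*_ (respects-squares Hf (square-≢0 sx) (square-≢0 s) (square-≢0 sx′) (square-≢0 s′)
                          (square-* sx (square-⁻¹ s)) (square-* sx′ (square-⁻¹ s′)) (proj₁ (eq w)))
                       (respects-fibers Vv s s′ (colour-right (proj₁ (eq w)))))
            where
            s′ : IsSquare w′
            s′ = trans (sym χ≡) s

    -- The two convolution steps

    private
      -- Here X is the value at g of a character involving inverse powers, while Y and V are plain
      -- powers of g; the condition X² = 1 turns into Y² = V².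
      square-ratio⁺ : ∀ {X Y V} → X * Y ≡ V → X * X ≡ 1# → Y * Y ≡ V * V
      square-ratio⁺ {X} {Y} {V} XY≡V X²≡1 = begin
        Y * Y  ≡⟨ *-identityˡ _ ⟨
        1# * (Y * Y)  ≡⟨ cong (_* (Y * Y)) X²≡1 ⟨
        X * X * (Y * Y)  ≡⟨ solve 2 (λ x y → x :* x :* (y :* y) := (x :* y) :* (x :* y)) refl X Y ⟩
        X * Y * (X * Y)  ≡⟨ cong₂ _*_ XY≡V XY≡V ⟩
        V * V  ∎

      square-ratio⁻ : ∀ {X Y V} → Y ≢ 0# → X * Y ≡ V → Y * Y ≡ V * V → X * X ≡ 1#
      square-ratio⁻ {X} {Y} {V} Y≢0 XY≡V e = *-cancelʳ (*-≢0 Y≢0 Y≢0) (begin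
        X * X * (Y * Y)  ≡⟨ solve 2 (λ x y → x :* x :* (y :* y) := (x :* y) :* (x :* y)) refl X Y ⟩
        X * Y * (X * Y)  ≡⟨ cong₂ _*_ XY≡V XY≡V ⟩
        V * V  ≡⟨ e ⟨
        Y * Y  ≡⟨ *-identityˡ _ ⟨
        1# * (Y * Y)  ∎)

      G : ℕ → F
      G n = g ^ n

      G≢0 : ∀ n → G n ≢ 0#
      G≢0 n = ^-≢0 n g≢0

      η-pair : ∀ {A B} → A < N → B < N → W A ≢ 0# → W B ≢ 0# →
               (G (η A) * G (η B)) * (G (η A) * G (η B)) ≡ G (A ℕ.+ B) * (G o * G o)
      η-pair {A} {B} A< B< WA WB = begin
        (G (η A) * G (η B)) * (G (η A) * G (η B))  ≡⟨ solve 2 (λ a b → (a :* b) :* (a :* b) := (a :* a) :* (b :* b)) refl (G (η A)) (G (η B)) ⟩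
        (G (η A) * G (η A)) * (G (η B) * G (η B))  ≡⟨ cong₂ _*_ (η-power A< WA g) (η-power B< WB g) ⟩
        (G A * G o) * (G B * G o)  ≡⟨ solve 3 (λ a b o → (a :* o) :* (b :* o) := (a :* b) :* (o :* o)) refl (G A) (G B) (G o) ⟩
        (G A * G B) * (G o * G o)  ≡⟨ cong (_* (G o * G o)) (^-homo-* g A B) ⟨
        G (A ℕ.+ B) * (G o * G o)  ∎

      o-pair : ∀ A → (G A * G o) * (G A * G o) ≡ G (A ℕ.+ A) * (G o * G o)
      o-pair A = trans (solve 2 (λ a o → (a :* o) :* (a :* o) := (a :* a) :* (o :* o)) refl (G A) (G o))
        (cong (_* (G o * G o)) (sym (^-homo-* g A A)))

      cancel-o : ∀ {i j} → G i * (G o * G o) ≡ G j * (G o * G o) → G i ≡ G j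
      cancel-o = *-cancelʳ (*-≢0 (G≢0 o) (G≢0 o))

      inverse-cancel : ∀ n → (g ⁻¹) ^ n * G n ≡ 1#
      inverse-cancel = ⁻¹-^-cancel g≢0

    -- The analogue of `Ê` for E(b x): one has û b (a²) = aᵒ E(b a), and `Ê` is the case b = 1.
    û : F → F → F
    û b x = ∑< N (λ C → W C * b ^ C * x ^ η C)

    -- The exponents of w add up to A + o - η B - η C, whose double is 2 A - (B + C); so `A` is the
    -- middle term of the progression.
    module FirstStep (b : F) where

      private
        f : ℕ → F → F
        f C x = x ^ η C

        μ : ℕ → ℕ → F → F
        μ A B w = w ^ A * (w ^ o * (w ⁻¹) ^ η B)

        ratio : ∀ A B C → (f C (g ⁻¹) * μ A B g) * (G (η B) * G (η C)) ≡ G A * G o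
        ratio A B C = begin
          ((g ⁻¹) ^ η C * (G A * (G o * (g ⁻¹) ^ η B))) * (G (η B) * G (η C))
            ≡⟨ solve 6 (λ c′ a o b′ b c → (c′ :* (a :* (o :* b′))) :* (b :* c) := ((c′ :* c) :* (b′ :* b)) :* (a :* o)) refl
                 ((g ⁻¹) ^ η C) (G A) (G o) ((g ⁻¹) ^ η B) (G (η B)) (G (η C)) ⟩
          (((g ⁻¹) ^ η C * G (η C)) * ((g ⁻¹) ^ η B * G (η B))) * (G A * G o)
            ≡⟨ cong (_* (G A * G o)) (trans (cong₂ _*_ (inverse-cancel (η C)) (inverse-cancel (η B))) (*-identityˡ 1#)) ⟩
          1# * (G A * G o)  ≡⟨ *-identityˡ _ ⟩
          G A * G o  ∎

        diagonal : ∀ {C} → C < N → W C ≢ 0# → (f C (g ⁻¹) * μ C C g) * (f C (g ⁻¹) * μ C C g) ≡ 1#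
        diagonal {C} C< WC = square-ratio⁻ (*-≢0 (G≢0 (η C)) (G≢0 (η C))) (ratio C C C) (trans (η-pair C< C< WC WC) (sym (o-pair C)))

        only-diagonal : ∀ {A B C} → A < N → B < N → C < N → W A ≢ 0# → W B ≢ 0# → W C ≢ 0# →
          (f C (g ⁻¹) * μ A B g) * (f C (g ⁻¹) * μ A B g) ≡ 1# → A ≡ C × B ≡ C
        only-diagonal {A} {B} {C} A< B< C< WA WB WC e = rearrange (W-progression-free B< C< A< WB WC WA
            (cancel-o {B ℕ.+ C} {A ℕ.+ A} (trans (sym (η-pair B< C< WB WC)) (trans (square-ratio⁺ (ratio A B C) e) (o-pair A)))))
          where
          rearrange : B ≡ A × C ≡ A → A ≡ C × B ≡ C
          rearrange (B≡A , C≡A) = sym C≡A , trans B≡A (sym C≡A)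

        module S = Step f μ (λ C → power-multiplicative (η C))
          (λ A B → product-multiplicative (power-multiplicative A) (product-multiplicative (power-multiplicative o) (inverse-power-multiplicative (η B))))
          diagonal only-diagonal (b ^_) (λ _ → 1#)

        density : ∀ w → E (b * w) * (w ^ o * Ê (w ⁻¹)) ≡ S.density w
        density w = begin
          E (b * w) * (w ^ o * Ê (w ⁻¹))
            ≡⟨ cong (E (b * w) *_) (∑-*ˡ (w ^ o) _) ⟩
          E (b * w) * ∑< N (λ B → w ^ o * (W B * (w ⁻¹) ^ η B))
            ≡⟨ trans (∑-*ʳ _ _) (∑<-cong N (λ A _ → trans (∑-*ˡ (W A * (b * w) ^ A) (λ B → w ^ o * (W (toℕ B) * (w ⁻¹) ^ η (toℕ B)))) (∑<-cong N (λ B _ → term A B)))) ⟩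
          S.density w ∎
          where
          term : ∀ A B → W A * (b * w) ^ A * (w ^ o * (W B * (w ⁻¹) ^ η B)) ≡ (W A * b ^ A) * (W B * 1#) * μ A B w
          term A B = trans (cong (λ z → W A * z * (w ^ o * (W B * (w ⁻¹) ^ η B))) (^-distrib-* b w A))
            (solve 6 (λ a b w o c v → a :* (b :* w) :* (o :* (c :* v)) := (a :* b) :* (c :* :1) :* (w :* (o :* v))) refl
              (W A) (b ^ A) (w ^ A) (w ^ o) (W B) ((w ⁻¹) ^ η B))

      first : FiberConstant (λ x → E (b * x)) → FiberConstant (û b)
      first VE = fiberConstant-cong (λ {x} _ → begin
          - 1# * ∑ (λ w → sq w * (Ê (x * w ⁻¹) * (E (b * w) * (w ^ o * Ê (w ⁻¹)))))
            ≡⟨ cong (- 1# *_) (∑-cong (λ w → cong (λ z → sq w * (Ê (x * w ⁻¹) * z)) (density w))) ⟩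
          - 1# * ∑ (λ w → sq w * (S.kernel (x * w ⁻¹) * S.density w))
            ≡⟨ cong (- 1# *_) (S.step x) ⟩
          - 1# * (- 1# * S.result x)  ≡⟨ solve 1 (λ z → (:- :1) :* ((:- :1) :* z) := z) refl (S.result x) ⟩
          S.result x  ≡⟨ ∑<-cong N (λ C _ → cong (λ z → W C * z * x ^ η C) (*-identityʳ (b ^ C))) ⟩
          û b x  ∎)
        (fiberConstant-scale (- 1#) (fiberConstant-⋆ squareInvariant-Ê (fiberConstant-* VE
          (fiberConstant-* (fiberConstant λ _ _ → fiber-^o) (squareInvariant⇒fiberConstant (squareInvariant-⁻¹ squareInvariant-Ê))))))

    -- The exponents of w add up to η A + η B - o - C, whose double is A + B - 2 C; now `C` is the
    -- middle term.
    module SecondStep (b b′ : F) where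

      private
        f : ℕ → F → F
        f C x = x ^ C

        μ : ℕ → ℕ → F → F
        μ A B w = w ^ η A * (w ^ η B * (w ⁻¹) ^ o)

        ratio : ∀ A B C → (f C (g ⁻¹) * μ A B g) * (G C * G o) ≡ G (η A) * G (η B)
        ratio A B C = begin
          ((g ⁻¹) ^ C * (G (η A) * (G (η B) * (g ⁻¹) ^ o))) * (G C * G o)
            ≡⟨ solve 6 (λ c′ a b o′ c o → (c′ :* (a :* (b :* o′))) :* (c :* o) := ((c′ :* c) :* (o′ :* o)) :* (a :* b)) refl
                 ((g ⁻¹) ^ C) (G (η A)) (G (η B)) ((g ⁻¹) ^ o) (G C) (G o) ⟩
          (((g ⁻¹) ^ C * G C) * ((g ⁻¹) ^ o * G o)) * (G (η A) * G (η B))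
            ≡⟨ cong (_* (G (η A) * G (η B))) (trans (cong₂ _*_ (inverse-cancel C) (inverse-cancel o)) (*-identityˡ 1#)) ⟩
          1# * (G (η A) * G (η B))  ≡⟨ *-identityˡ _ ⟩
          G (η A) * G (η B)  ∎

        diagonal : ∀ {C} → C < N → W C ≢ 0# → (f C (g ⁻¹) * μ C C g) * (f C (g ⁻¹) * μ C C g) ≡ 1#
        diagonal {C} C< WC = square-ratio⁻ (*-≢0 (G≢0 C) (G≢0 o)) (ratio C C C) (trans (o-pair C) (sym (η-pair C< C< WC WC)))

        only-diagonal : ∀ {A B C} → A < N → B < N → C < N → W A ≢ 0# → W B ≢ 0# → W C ≢ 0# →
          (f C (g ⁻¹) * μ A B g) * (f C (g ⁻¹) * μ A B g) ≡ 1# → A ≡ C × B ≡ C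
        only-diagonal {A} {B} {C} A< B< C< WA WB WC e = W-progression-free A< B< C< WA WB WC
            (cancel-o {A ℕ.+ B} {C ℕ.+ C} (trans (sym (η-pair A< B< WA WB)) (trans (sym (square-ratio⁺ (ratio A B C) e)) (o-pair C))))

        module S = Step f μ power-multiplicative
          (λ A B → product-multiplicative (power-multiplicative (η A)) (product-multiplicative (power-multiplicative (η B)) (inverse-power-multiplicative o)))
          diagonal only-diagonal (b ^_) (b′ ^_)

        density : ∀ w → û b w * (û b′ w * (w ⁻¹) ^ o) ≡ S.density w
        density w = begin
          û b w * (û b′ w * (w ⁻¹) ^ o)
            ≡⟨ cong (û b w *_) (∑-*ʳ ((w ⁻¹) ^ o) _) ⟩
          û b w * ∑< N (λ B → W B * b′ ^ B * w ^ η B * (w ⁻¹) ^ o)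
            ≡⟨ trans (∑-*ʳ _ _) (∑<-cong N (λ A _ → trans (∑-*ˡ (W A * b ^ A * w ^ η A) (λ B → W (toℕ B) * b′ ^ toℕ B * w ^ η (toℕ B) * (w ⁻¹) ^ o)) (∑<-cong N (λ B _ → term A B)))) ⟩
          S.density w ∎
          where
          term : ∀ A B → W A * b ^ A * w ^ η A * (W B * b′ ^ B * w ^ η B * (w ⁻¹) ^ o) ≡ (W A * b ^ A) * (W B * b′ ^ B) * μ A B w
          term A B = solve 5 (λ a b c d o → a :* b :* (c :* d :* o) := a :* c :* (b :* (d :* o))) refl
            (W A * b ^ A) (w ^ η A) (W B * b′ ^ B) (w ^ η B) ((w ⁻¹) ^ o)

      second : FiberConstant (û b) → FiberConstant (û b′) → FiberConstant (λ x → E (b * b′ * x))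
      second Vb Vb′ = fiberConstant-cong (λ {x} _ → begin
          - 1# * ∑ (λ w → sq w * (E (x * w ⁻¹) * (û b w * (û b′ w * (w ⁻¹) ^ o))))
            ≡⟨ cong (- 1# *_) (∑-cong (λ w → cong (λ z → sq w * (E (x * w ⁻¹) * z)) (density w))) ⟩
          - 1# * ∑ (λ w → sq w * (S.kernel (x * w ⁻¹) * S.density w))
            ≡⟨ cong (- 1# *_) (S.step x) ⟩
          - 1# * (- 1# * S.result x)  ≡⟨ solve 1 (λ z → (:- :1) :* ((:- :1) :* z) := z) refl (S.result x) ⟩
          S.result x  ≡⟨ ∑<-cong N (λ C _ → collect C x) ⟩
          E (b * b′ * x)  ∎)
        (fiberConstant-scale (- 1#) (fiberConstant-⋆ (invariant⇒squareInvariant invariant-E)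
          (fiberConstant-* Vb (fiberConstant-* Vb′ (fiberConstant λ _ _ → fiber-⁻¹^o)))))
        where
        collect : ∀ C x → W C * (b ^ C * b′ ^ C) * x ^ C ≡ W C * (b * b′ * x) ^ C
        collect C x = trans (*-assoc (W C) _ _) (cong (W C *_) (sym (trans (^-distrib-* (b * b′) x C) (cong (_* x ^ C) (^-distrib-* b b′ C)))))

    fiberConstant-E-* : ∀ {b b′} → FiberConstant (λ x → E (b * x)) → FiberConstant (λ x → E (b′ * x)) → FiberConstant (λ x → E (b * b′ * x))
    fiberConstant-E-* {b} {b′} Vb Vb′ = SecondStep.second b b′ (FirstStep.first b Vb) (FirstStep.first b′ Vb′)

    -- From E(z x) to fixed points

    fiberConstant-E-1 : FiberConstant (λ x → E (1# * x))
    fiberConstant-E-1 = fiberConstant-cong (λ {x} _ → cong E (sym (*-identityˡ x)))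
      (squareInvariant⇒fiberConstant (invariant⇒squareInvariant invariant-E))

    -- Since E is odd, E(x / g) = - E(x / c), and the point c = - g is fixed.
    fiberConstant-E-g⁻¹ : FiberConstant (λ x → E (g ⁻¹ * x))
    fiberConstant-E-g⁻¹ = fiberConstant λ {x} {x′} sx sx′ e → begin
      E (g ⁻¹ * x)  ≡⟨ flip x ⟩
      - E (x * (- g) ⁻¹)  ≡⟨ cong -_ (respects invariant-E (square-≢0 sx) (neg-≢0 g≢0) (square-≢0 sx′) (neg-≢0 g≢0) (colour-fixed fixed-c e)) ⟩
      - E (x′ * (- g) ⁻¹)  ≡⟨ flip x′ ⟨
      E (g ⁻¹ * x′)  ∎
      where
      flip : ∀ x → E (g ⁻¹ * x) ≡ - E (x * (- g) ⁻¹)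
      flip x = begin
        E (g ⁻¹ * x)  ≡⟨ cong E (solve 2 (λ u x → u :* x := :- (x :* (:- u))) refl (g ⁻¹) x) ⟩
        E (- (x * - (g ⁻¹)))  ≡⟨ cong (λ z → E (- (x * z))) (⁻¹-unique (trans (solve 2 (λ g u → (:- g) :* (:- u) := g :* u) refl g (g ⁻¹)) (nz-≢0 g≢0))) ⟩
        E (- (x * (- g) ⁻¹))  ≡⟨ E-odd _ ⟩
        - E (x * (- g) ⁻¹)  ∎

    fiberConstant-E-^ : ∀ n → FiberConstant (λ x → E ((g ⁻¹) ^ n * x))
    fiberConstant-E-^ zero    = fiberConstant-E-1
    fiberConstant-E-^ (suc n) = fiberConstant-E-* fiberConstant-E-g⁻¹ (fiberConstant-E-^ n)

    fiberConstant-E : ∀ {z} → z ≢ 0# → FiberConstant (λ x → E (z * x))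
    fiberConstant-E {z} z≢0 = viaLog (logarithm (⁻¹-≢0 z≢0))
      where
      viaLog : (∃ λ i → z ⁻¹ ≡ g ^ i) → FiberConstant (λ x → E (z * x))
      viaLog (i , e) = fiberConstant-cong (λ {x} _ → cong (λ u → E (u * x)) (sym z≡)) (fiberConstant-E-^ i)
        where
        z≡ : z ≡ (g ⁻¹) ^ i
        z≡ = *-cancelʳ (⁻¹-≢0 z≢0) (trans (⁻¹-inverse z≢0) (sym (trans (cong ((g ⁻¹) ^ i *_) e) (inverse-cancel i))))

    -- Pairing with z⁻¹ extracts the linear term in z, and `W 1` is 1 because 1 has a single digit
    -- one. The exponents with nonzero `W` lie in 1, ..., m, so no other one is congruent to 1
    -- modulo m.
    E-coefficient : ∀ x → ∑ (λ z → nz z * (z ⁻¹ * E (z * x))) ≡ - 1# * x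
    E-coefficient x = begin
      ∑ (λ z → nz z * (z ⁻¹ * E (z * x)))
        ≡⟨ ∑-cong (λ z → trans (cong (nz z *_) (∑-*ˡ (z ⁻¹) _)) (trans (∑-*ˡ (nz z) _) (∑<-cong N (λ A _ → term z A)))) ⟩
      ∑ (λ z → ∑< N (λ A → W A * x ^ A * (nz z * (z ⁻¹ * z ^ A))))
        ≡⟨ ∑-swap _ ⟩
      ∑< N (λ A → ∑ (λ z → W A * x ^ A * (nz z * (z ⁻¹ * z ^ A))))
        ≡⟨ ∑<-cong N (λ A A< → trans (sym (∑-*ˡ (W A * x ^ A) _)) (only-1 A A<)) ⟩
      ∑< N (λ A → δ 1 A * (- 1# * (W A * x ^ A)))
        ≡⟨ ∑<-δ N 1 (λ A → - 1# * (W A * x ^ A)) (s≤s (ℕ.n≢0⇒n>0 m≢0)) ⟩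
      - 1# * (W 1 * (x * 1#))  ≡⟨ cong (λ u → - 1# * (u * (x * 1#))) (ω-1 r) ⟩
      - 1# * (1# * (x * 1#))  ≡⟨ solve 1 (λ x → (:- :1) :* (:1 :* (x :* :1)) := (:- :1) :* x) refl x ⟩
      - 1# * x  ∎
      where
      term : ∀ z A → nz z * (z ⁻¹ * (W A * (z * x) ^ A)) ≡ W A * x ^ A * (nz z * (z ⁻¹ * z ^ A))
      term z A = trans (cong (λ u → nz z * (z ⁻¹ * (W A * u))) (^-distrib-* z x A))
        (solve 5 (λ n u w a b → n :* (u :* (w :* (a :* b))) := w :* b :* (n :* (u :* a))) refl (nz z) (z ⁻¹) (W A) (z ^ A) (x ^ A))
      μ-* : ∀ A → Multiplicative (λ z → z ⁻¹ * z ^ A)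
      μ-* A = product-multiplicative ⁻¹-distrib-* (power-multiplicative A)
      only-1 : ∀ A → A < N → W A * x ^ A * ∑ (λ z → nz z * (z ⁻¹ * z ^ A)) ≡ δ 1 A * (- 1# * (W A * x ^ A))
      only-1 A A< with zero? (W A)
      ... | inj₁ W≡0 = trans (cong (_* ∑ (λ z → nz z * (z ⁻¹ * z ^ A))) null) (trans (zeroˡ _)
            (sym (trans (cong (λ u → δ 1 A * (- 1# * u)) null) (solve 1 (λ d → d :* ((:- :1) :* :0) := :0) refl (δ 1 A)))))
        where
        null : W A * x ^ A ≡ 0#
        null = trans (cong (_* x ^ A) W≡0) (zeroˡ _)
      ... | inj₂ W≢0 = byCases (1 ℕ.≟ A)
        where
        byCases : Dec (1 ≡ A) → W A * x ^ A * ∑ (λ z → nz z * (z ⁻¹ * z ^ A)) ≡ δ 1 A * (- 1# * (W A * x ^ A))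
        byCases (yes refl) = begin
          W 1 * x ^ 1 * ∑ (λ z → nz z * (z ⁻¹ * z ^ 1))
            ≡⟨ cong (W 1 * x ^ 1 *_) (orthogonality₁ (μ-* 1) (trans (cong (g ⁻¹ *_) (*-identityʳ g)) (trans (*-comm _ g) (nz-≢0 g≢0)))) ⟩
          W 1 * x ^ 1 * - 1#  ≡⟨ solve 1 (λ u → u :* (:- :1) := :1 :* ((:- :1) :* u)) refl (W 1 * x ^ 1) ⟩
          1# * (- 1# * (W 1 * x ^ 1))  ≡⟨ cong (_* (- 1# * (W 1 * x ^ 1))) (δ-refl 1) ⟨
          δ 1 1 * (- 1# * (W 1 * x ^ 1))  ∎
        byCases (no 1≢A) = begin
          W A * x ^ A * ∑ (λ z → nz z * (z ⁻¹ * z ^ A))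
            ≡⟨ cong (W A * x ^ A *_) (orthogonality₀ (μ-* A) λ e → 1≢A (g^-injective {1} (s≤s z≤n) (s≤s (ℕ.n≢0⇒n>0 m≢0)) (W-positive W≢0) A<
                 (*-cancelˡ (⁻¹-≢0 g≢0) (trans (trans (cong (g ⁻¹ *_) (*-identityʳ g)) (trans (*-comm _ g) (nz-≢0 g≢0))) (sym e))))) ⟩
          W A * x ^ A * 0#  ≡⟨ zeroʳ _ ⟩
          0#  ≡⟨ zeroˡ _ ⟨
          0# * (- 1# * (W A * x ^ A))  ≡⟨ cong (_* (- 1# * (W A * x ^ A))) (δ-≢ 1≢A) ⟨
          δ 1 A * (- 1# * (W A * x ^ A))  ∎

    fixed-square : ∀ {x} → IsSquare x → IsFixed x
    fixed-square {x} sx {x′} e = sym (*-cancelˡ (neg-≢0 1≢0) (begin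
      - 1# * x  ≡⟨ E-coefficient x ⟨
      ∑ (λ z → nz z * (z ⁻¹ * E (z * x)))  ≡⟨ ∑-cong term ⟩
      ∑ (λ z → nz z * (z ⁻¹ * E (z * x′)))  ≡⟨ E-coefficient x′ ⟩
      - 1# * x′  ∎))
      where
      term : ∀ z → nz z * (z ⁻¹ * E (z * x)) ≡ nz z * (z ⁻¹ * E (z * x′))
      term z with zero? z
      ... | inj₁ refl = trans (trans (cong (_* (0# ⁻¹ * E (0# * x))) nz-0) (zeroˡ _)) (sym (trans (cong (_* (0# ⁻¹ * E (0# * x′))) nz-0) (zeroˡ _)))
      ... | inj₂ z≢0  = cong (λ u → nz z * (z ⁻¹ * u)) (respects-fibers (fiberConstant-E z≢0) sx (trans (sym (fiber-χ e)) sx) e)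

    o≢0 : o ≢ 0
    o≢0 e = case trans (sym o-odd) e of λ ()

    o≤half : o ≤ half
    o≤half = ∣⇒≤ {{ℕ.>-nonZero half>0}} o∣half

    -- The remaining points are separated by the half + 1 points 0 and g²ⁱ: for distinct y and z in one
    -- fiber, the quotients (y - u) / (z - u) would be too many roots of Xᵒ - 1.
    fixed-all : ∀ y → IsFixed y
    fixed-all y with zero? y | χ y ≟ 1#
    ... | inj₁ refl | _       = fixed-0
    ... | inj₂ y≢0  | yes sy  = fixed-square sy
    ... | inj₂ y≢0  | no ¬sy  = λ e → separate _ e (_ ≟ y)
      where
      separate : ∀ z → colour y y ≡ colour z z → Dec (z ≡ y) → z ≡ y
      separate z e (yes z≡y) = z≡y
      separate z e (no z≢y)  = contradiction (ℕ.≤-trans (s≤s o≤half) (roots o o≢0 ratio^o)) ℕ.1+n≰n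
        where
        point : Fin (suc half) → F
        point zero    = 0#
        point (suc i) = g ^ (toℕ i ℕ.+ toℕ i)
        point-fixed : ∀ i → IsFixed (point i)
        point-fixed zero    = fixed-0
        point-fixed (suc i) = fixed-square (subst IsSquare (sym (^-homo-* g (toℕ i) (toℕ i))) (x*x-square (^-≢0 (toℕ i) g≢0)))
        point-injective : ∀ {i j} → point i ≡ point j → i ≡ j
        point-injective {zero}  {zero}  _ = refl
        point-injective {zero}  {suc j} q = contradiction (sym q) (^-≢0 (toℕ j ℕ.+ toℕ j) g≢0)
        point-injective {suc i} {zero}  q = contradiction q (^-≢0 (toℕ i ℕ.+ toℕ i) g≢0)
        point-injective {suc i} {suc j} q = cong suc (Fin.toℕ-injective (begin
          toℕ i  ≡⟨ ℕ.n≡⌊n+n/2⌋ (toℕ i) ⟩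
          ⌊ toℕ i ℕ.+ toℕ i /2⌋  ≡⟨ cong ⌊_/2⌋ (g^-injective {0} z≤n (below i) z≤n (below j) q) ⟩
          ⌊ toℕ j ℕ.+ toℕ j /2⌋  ≡⟨ ℕ.n≡⌊n+n/2⌋ (toℕ j) ⟨
          toℕ j  ∎))
          where
          below : ∀ (i : Fin half) → toℕ i ℕ.+ toℕ i < m
          below i = subst (toℕ i ℕ.+ toℕ i <_) (sym m≡half+half) (ℕ.+-mono-< (Fin.toℕ<n i) (Fin.toℕ<n i))
        z≢point : ∀ i → z - point i ≢ 0#
        z≢point i q = z≢y (trans z≡ (sym (point-fixed i (trans (cong (λ u → colour u u) (sym z≡)) (sym e)))))
          where
          z≡ : z ≡ point i
          z≡ = x-y≡0⇒x≡y q
        ratio : Fin (suc half) → F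
        ratio i = (y - point i) * (z - point i) ⁻¹
        ratio^o : ∀ i → ratio i ^ o ≡ 1#
        ratio^o i = begin
          ratio i ^ o  ≡⟨ ^-distrib-* _ _ o ⟩
          (y - point i) ^ o * ((z - point i) ⁻¹) ^ o  ≡⟨ cong (_* ((z - point i) ⁻¹) ^ o) (difference-colour (colour-fixed (point-fixed i) e)) ⟩
          (z - point i) ^ o * ((z - point i) ⁻¹) ^ o  ≡⟨ *-comm _ _ ⟩
          ((z - point i) ⁻¹) ^ o * (z - point i) ^ o  ≡⟨ ⁻¹-^-cancel (z≢point i) o ⟩
          1#  ∎
        -- The map u ↦ (y - u) / (z - u) is a Möbius transformation of determinant y - z, which is
        -- nonzero.
        ratio-injective : ∀ {i j} → ratio i ≡ ratio j → i ≡ j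
        ratio-injective {i} {j} q = conclude (integral {y - z} {point i - point j} (begin
            (y - z) * (u - v)
              ≡⟨ solve 4 (λ y z u v → (y :- z) :* (u :- v) := (y :- u) :* (z :- v) :- (y :- v) :* (z :- u)) refl y z u v ⟩
            (y - u) * (z - v) - (y - v) * (z - u)
              ≡⟨ cong₂ _-_ (clear i (z - v)) (clear j (z - u)) ⟩
            ratio i * ((z - u) * (z - v)) - ratio j * ((z - v) * (z - u))
              ≡⟨ cong (λ t → t * ((z - u) * (z - v)) - ratio j * ((z - v) * (z - u))) q ⟩
            ratio j * ((z - u) * (z - v)) - ratio j * ((z - v) * (z - u))
              ≡⟨ solve 3 (λ r a b → r :* (a :* b) :- r :* (b :* a) := :0) refl (ratio j) (z - u) (z - v) ⟩
            0# ∎))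
          where
          u = point i
          v = point j
          conclude : y - z ≡ 0# ⊎ u - v ≡ 0# → i ≡ j
          conclude (inj₁ y≡z) = contradiction (sym (x-y≡0⇒x≡y y≡z)) z≢y
          conclude (inj₂ u≡v) = point-injective (x-y≡0⇒x≡y u≡v)
          clear : ∀ i t → (y - point i) * t ≡ ratio i * ((z - point i) * t)
          clear i t = begin
            (y - point i) * t  ≡⟨ cong (_* t) (*-identityʳ _) ⟨
            (y - point i) * 1# * t  ≡⟨ cong (λ n → (y - point i) * n * t) (nz-≢0 (z≢point i)) ⟨
            (y - point i) * ((z - point i) * (z - point i) ⁻¹) * t
              ≡⟨ solve 4 (λ a b c t → a :* (b :* c) :* t := (a :* c) :* (b :* t)) refl (y - point i) (z - point i) ((z - point i) ⁻¹) t ⟩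
            ratio i * ((z - point i) * t)  ∎
        roots : ∀ n → n ≢ 0 → (∀ i → ratio i ^ n ≡ 1#) → suc half ≤ n
        roots zero    n≢0 _ = contradiction refl n≢0
        roots (suc n) _   r^n = roots≤degree (- 1# ∷ replicate n 0#) ratio ratio-injective
          (λ i → trans (x^n-1 n (ratio i)) (trans (cong (_- 1#) (r^n i)) (-‿inverseʳ 1#)))

-- The triple 0, 1, c in a fission of the scheme

module _ {m : ℕ} (𝔽 : FieldOn (suc m)) where

  open FieldTheory 𝔽

  module Base (K : F → Set) (1∈K : K 1#) (*-closed : ∀ {x y} → K x → K y → K (x * y))
              (K-≢0 : ∀ {x} → K x → x ≢ 0#) (-1∉K : ¬ K (- 1#)) where

    params : Parameters 𝔽
    -- In characteristic 2 the element - 1 = 1 would lie in `K`.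
    params = parameters 𝔽 λ e → -1∉K (subst K (x-y≡0⇒x≡y (trans (cong (1# +_) (-‿involutive 1#)) e)) 1∈K)

    open Parameters params
    open ≡-Reasoning

    K-^ : ∀ {x} n → K x → K (x ^ n)
    K-^ zero    _  = 1∈K
    K-^ (suc n) Kx = *-closed Kx (K-^ n Kx)

    -- A nontrivial element of K of 2-power order would have - 1 among its powers.
    2-power-order : ∀ e {x} → K x → x ^ (2 ℕ.^ e) ≡ 1# → x ≡ 1#
    2-power-order zero    {x} Kx q = trans (sym (*-identityʳ x)) q
    2-power-order (suc e) {x} Kx q = fromSquare (integral {x - 1#} {x + 1#} (begin
        (x - 1#) * (x + 1#)  ≡⟨ solve 1 (λ x → (x :- :1) :* (x :+ :1) := x :* (x :* :1) :- :1) refl x ⟩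
        x ^ 2 - 1#  ≡⟨ cong (_- 1#) (2-power-order e (K-^ 2 Kx) (trans (^-assocʳ x 2 (2 ℕ.^ e)) q)) ⟩
        1# - 1#  ≡⟨ -‿inverseʳ 1# ⟩
        0#  ∎))
      where
      fromSquare : x - 1# ≡ 0# ⊎ x + 1# ≡ 0# → x ≡ 1#
      fromSquare (inj₁ d) = x-y≡0⇒x≡y d
      fromSquare (inj₂ s) = contradiction (subst K (x-y≡0⇒x≡y (trans (cong (x +_) (-‿involutive 1#)) s)) Kx) -1∉K

    -- The power xᵒ lies in `K` and its order divides 2^ε, because m = 2^ε o.
    K-^o : ∀ {x} → K x → x ^ o ≡ 1#
    K-^o {x} Kx = 2-power-order ε (K-^ o Kx) (begin
      (x ^ o) ^ (2 ℕ.^ ε)  ≡⟨ ^-assocʳ x o (2 ℕ.^ ε) ⟩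
      x ^ (o ℕ.* 2 ℕ.^ ε)  ≡⟨ cong (x ^_) (trans (ℕ.*-comm o (2 ℕ.^ ε)) (sym m≡2ᵉo)) ⟩
      x ^ m  ≡⟨ fermat (K-≢0 Kx) ⟩
      1#  ∎)

    c : F
    c = - g

    c≢0 : c ≢ 0#
    c≢0 = neg-≢0 g≢0

    -- As o is odd, cᵒ = - gᵒ; and gᵒ = 1 is impossible for 0 < o < m.
    cᵒ≢-1 : c ^ o ≢ - 1#
    cᵒ≢-1 q = ℕ.<⇒≱ o<m (∣⇒≤ {{ℕ.≢-nonZero o≢0}} (proj₂ og o (begin
      g ^ o  ≡⟨ -‿involutive _ ⟨
      - - g ^ o  ≡⟨ cong -_ (trans (sym (neg-^-odd {o} {o′} o-odd g)) q) ⟩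
      - - 1#  ≡⟨ -‿involutive 1# ⟩
      1#  ∎)))
      where
      o≢0 : o ≢ 0
      o≢0 q = case trans (sym o-odd) q of λ ()
      half≢0 : half ≢ 0
      half≢0 q = m≢0 (trans m≡half+half (cong₂ ℕ._+_ q q))
      o<m : o < m
      o<m = ℕ.≤-<-trans (∣⇒≤ {{ℕ.≢-nonZero half≢0}} o∣half) (subst (half <_) (sym m≡half+half) (ℕ.m<m+n half (ℕ.n≢0⇒n>0 half≢0)))

    Proportional : CoherentConfiguration (suc m) → Set
    Proportional Z = ∀ {x y x′ y′} → colour x y ≡ colour x′ y′ → ∃ λ κ → K κ × x′ - y′ ≡ κ * (x - y)
      where open Colouring Z

    module _ (Z : CoherentConfiguration (suc m)) (proportional : Proportional Z) where

      open Colouring Z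

      difference-colour : ∀ {x y x′ y′} → colour x y ≡ colour x′ y′ → (x - y) ^ o ≡ (x′ - y′) ^ o
      difference-colour {x} {y} {x′} {y′} q = fromRatio (proportional q)
        where
        fromRatio : (∃ λ κ → K κ × x′ - y′ ≡ κ * (x - y)) → (x - y) ^ o ≡ (x′ - y′) ^ o
        fromRatio (κ , Kκ , d) = sym (begin
          (x′ - y′) ^ o  ≡⟨ cong (_^ o) d ⟩
          (κ * (x - y)) ^ o  ≡⟨ ^-distrib-* κ (x - y) o ⟩
          κ ^ o * (x - y) ^ o  ≡⟨ cong (_* (x - y) ^ o) (K-^o Kκ) ⟩
          1# * (x - y) ^ o  ≡⟨ *-identityˡ _ ⟩
          (x - y) ^ o  ∎)

      threePoints⇒complete : IsFixed 0# → IsFixed 1# → IsFixed c → IsComplete Z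
      threePoints⇒complete fixed-0 fixed-1 fixed-c = allFixed⇒complete
        (Cyclotomy.ThreePoints.fixed-all 𝔽 params Z difference-colour fixed-0 fixed-1 fixed-c)

      Δ : F → Set
      Δ x = x ≡ 0# ⊎ x ≡ 1# ⊎ x ≡ c

      -- The arcs between 0, 1 and c do not form a directed 3-cycle of one colour, because cᵒ ≢ - 1.
      module _ (stable : ∀ {x x′} → colour x x ≡ colour x′ x′ → Δ x → Δ x′) where

        private
          ψ : F → F → F
          ψ x y = (x - y) ^ o

          -- The permutation matching the paths x → w → x with those at `x′` maps the triple into
          -- itself. Hence every value ψ x w with w in the triple also occurs at `x′`.
          match : ∀ {x x′ w} → colour x x ≡ colour x′ x′ → Δ w → ∃ λ w′ → Δ w′ × ψ x w ≡ ψ x′ w′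
          match {x} {x′} {w} q Δw = viaPermutation (colour-permutation q)
            where
            viaPermutation : Matching x x x′ x′ →
                             ∃ λ w′ → Δ w′ × ψ x w ≡ ψ x′ w′
            viaPermutation (π , eq) = π ⟨$⟩ʳ w , stable (colour-right (proj₁ (eq w))) Δw , difference-colour (proj₁ (eq w))

          γ d : F
          γ = c ^ o
          d = (1# - c) ^ o

          0ᵒ : 0# ^ o ≡ 0#
          0ᵒ = trans (cong (0# ^_) o-odd) (zeroˡ _)

          ψ-self : ∀ x → ψ x x ≡ 0#
          ψ-self x = trans (cong (_^ o) (-‿inverseʳ x)) 0ᵒ

          ψ-swap : ∀ x y → ψ x y ≡ - ψ y x
          ψ-swap x y = trans (cong (_^ o) (solve 2 (λ x y → x :- y := :- (y :- x)) refl x y)) (neg-^-odd {o} {o′} o-odd (y - x))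

          ψ-x0 : ∀ x → ψ x 0# ≡ x ^ o
          ψ-x0 x = cong (_^ o) (solve 1 (λ x → x :- :0 := x) refl x)

          ψ-10 : ψ 1# 0# ≡ 1#
          ψ-10 = trans (ψ-x0 1#) (1^ o)

          ψ-01 : ψ 0# 1# ≡ - 1#
          ψ-01 = trans (ψ-swap 0# 1#) (cong -_ ψ-10)

          ψ-0c : ψ 0# c ≡ - γ
          ψ-0c = trans (ψ-swap 0# c) (cong -_ (ψ-x0 c))

          γ≢0 : γ ≢ 0#
          γ≢0 = ^-≢0 o c≢0

          1≢-1 : 1# ≢ - 1#
          1≢-1 q = 1≢0 (x≡-x⇒x≡0 2≢0 q)

          at-0 : ∀ {w} → Δ w → ψ 0# w ≡ 0# ⊎ ψ 0# w ≡ - 1# ⊎ ψ 0# w ≡ - γ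
          at-0 (inj₁ refl)        = inj₁ (ψ-self 0#)
          at-0 (inj₂ (inj₁ refl)) = inj₂ (inj₁ ψ-01)
          at-0 (inj₂ (inj₂ refl)) = inj₂ (inj₂ ψ-0c)

          at-1 : ∀ {w} → Δ w → ψ 1# w ≡ 1# ⊎ ψ 1# w ≡ 0# ⊎ ψ 1# w ≡ d
          at-1 (inj₁ refl)        = inj₁ ψ-10
          at-1 (inj₂ (inj₁ refl)) = inj₂ (inj₁ (ψ-self 1#))
          at-1 (inj₂ (inj₂ refl)) = inj₂ (inj₂ refl)

          at-c : ∀ {w} → Δ w → ψ c w ≡ γ ⊎ ψ c w ≡ - d ⊎ ψ c w ≡ 0#
          at-c (inj₁ refl)        = inj₁ (ψ-x0 c)
          at-c (inj₂ (inj₁ refl)) = inj₂ (inj₁ (ψ-swap c 1#))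
          at-c (inj₂ (inj₂ refl)) = inj₂ (inj₂ (ψ-self c))

          Δ0 : Δ 0#
          Δ0 = inj₁ refl
          Δ1 : Δ 1#
          Δ1 = inj₂ (inj₁ refl)
          Δc : Δ c
          Δc = inj₂ (inj₂ refl)

          via : ∀ {x x′ w} {P : F → Set} → colour x x ≡ colour x′ x′ → Δ w → (∀ {w′} → Δ w′ → P (ψ x′ w′)) → P (ψ x w)
          via {x} {x′} {w} {P} q Δw h = fromMatch (match q Δw)
            where
            fromMatch : (∃ λ w′ → Δ w′ × ψ x w ≡ ψ x′ w′) → P (ψ x w)
            fromMatch (w′ , Δw′ , eq) = subst P (sym eq) (h Δw′)

          -- The arc 1 → 0 has the value 1, whereas the arcs from 0 within the triple have the
          -- values 0, - 1 and - γ, and γ ≠ - 1.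
          1≁0 : colour 1# 1# ≢ colour 0# 0#
          1≁0 q = refute (via {P = λ t → t ≡ 0# ⊎ t ≡ - 1# ⊎ t ≡ - γ} q Δ0 at-0)
            where
            refute : ¬ (ψ 1# 0# ≡ 0# ⊎ ψ 1# 0# ≡ - 1# ⊎ ψ 1# 0# ≡ - γ)
            refute (inj₁ z)        = 1≢0 (trans (sym ψ-10) z)
            refute (inj₂ (inj₁ z)) = 1≢-1 (trans (sym ψ-10) z)
            refute (inj₂ (inj₂ z)) = cᵒ≢-1 (trans (sym (-‿involutive γ)) (cong -_ (trans (sym z) ψ-10)))

          c≁0 : colour c c ≢ colour 0# 0#
          c≁0 q = refute (via {P = λ t → t ≡ 0# ⊎ t ≡ - 1# ⊎ t ≡ - γ} q Δ0 at-0)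
            where
            refute : ¬ (ψ c 0# ≡ 0# ⊎ ψ c 0# ≡ - 1# ⊎ ψ c 0# ≡ - γ)
            refute (inj₁ z)        = γ≢0 (trans (sym (ψ-x0 c)) z)
            refute (inj₂ (inj₁ z)) = cᵒ≢-1 (trans (sym (ψ-x0 c)) z)
            refute (inj₂ (inj₂ z)) = γ≢0 (x≡-x⇒x≡0 2≢0 (trans (sym (ψ-x0 c)) z))

          -- The point c does equal 1 when q = 3. Otherwise comparing the arcs from 1 and c to 0
          -- forces γ = 1, since the alternative γ = d, d = - 1 gives γ = - 1. Then the arcs between
          -- 1 and c force both d = 1 and - d = 1.
          c~1⇒c≡1 : colour c c ≡ colour 1# 1# → c ≡ 1#
          c~1⇒c≡1 q = byCases (c ≟ 1#)
            where
            byCases : Dec (c ≡ 1#) → c ≡ 1#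
            byCases (yes c≡1) = c≡1
            byCases (no c≢1)  = contradiction (γ≡1 (via {P = At1} q Δ0 at-1) (via {P = Atc} (sym q) Δ0 at-c)) γ≢1
              where
              At1 Atc : F → Set
              At1 t = t ≡ 1# ⊎ t ≡ 0# ⊎ t ≡ d
              Atc t = t ≡ γ ⊎ t ≡ - d ⊎ t ≡ 0#
              d≢0 : d ≢ 0#
              d≢0 = ^-≢0 o (λ z → c≢1 (sym (x-y≡0⇒x≡y z)))
              γ≡1 : At1 (ψ c 0#) → Atc (ψ 1# 0#) → γ ≡ 1#
              γ≡1 (inj₁ z) _                      = trans (sym (ψ-x0 c)) z
              γ≡1 (inj₂ (inj₁ z)) _               = contradiction (trans (sym (ψ-x0 c)) z) γ≢0
              γ≡1 _ (inj₁ z)                      = trans (sym z) ψ-10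
              γ≡1 _ (inj₂ (inj₂ z))               = contradiction (trans (sym ψ-10) z) 1≢0
              γ≡1 (inj₂ (inj₂ z)) (inj₂ (inj₁ y)) = contradiction (trans (sym (ψ-x0 c)) (trans z
                (trans (sym (-‿involutive d)) (cong -_ (trans (sym y) ψ-10))))) cᵒ≢-1
              γ≢1 : γ ≢ 1#
              γ≢1 γ≡1 = refute (via {P = Atc} (sym q) Δc at-c) (via {P = At1} q Δ1 at-1)
                where
                refute : Atc (ψ 1# c) → ¬ At1 (ψ c 1#)
                refute (inj₂ (inj₁ z)) _               = d≢0 (x≡-x⇒x≡0 2≢0 z)
                refute (inj₂ (inj₂ z)) _               = d≢0 z
                refute (inj₁ z) (inj₁ y)               = 1≢-1 (trans (sym y) (trans (ψ-swap c 1#) (cong -_ (trans z γ≡1))))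
                refute (inj₁ z) (inj₂ (inj₁ y))        = d≢0 (trans (sym (-‿involutive d)) (trans (cong -_ (trans (sym (ψ-swap c 1#)) y)) -0#≈0#))
                refute (inj₁ z) (inj₂ (inj₂ y))        = d≢0 (x≡-x⇒x≡0 2≢0 (trans (sym y) (ψ-swap c 1#)))

        stable⇒complete : IsComplete Z
        stable⇒complete = threePoints⇒complete
          (λ q → at₀ (stable q Δ0) q) (λ q → at₁ (stable q Δ1) q) (λ q → at₂ (stable q Δc) q)
          where
          at₀ : ∀ {z} → Δ z → colour 0# 0# ≡ colour z z → z ≡ 0#
          at₀ (inj₁ z≡0)         q = z≡0
          at₀ (inj₂ (inj₁ refl)) q = contradiction (sym q) 1≁0
          at₀ (inj₂ (inj₂ refl)) q = contradiction (sym q) c≁0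
          at₁ : ∀ {z} → Δ z → colour 1# 1# ≡ colour z z → z ≡ 1#
          at₁ (inj₁ refl)        q = contradiction q 1≁0
          at₁ (inj₂ (inj₁ z≡1))  q = z≡1
          at₁ (inj₂ (inj₂ refl)) q = c~1⇒c≡1 (sym q)
          at₂ : ∀ {z} → Δ z → colour c c ≡ colour z z → z ≡ c
          at₂ (inj₁ refl)        q = contradiction q c≁0
          at₂ (inj₂ (inj₁ refl)) q = sym (c~1⇒c≡1 q)
          at₂ (inj₂ (inj₂ z≡c))  q = z≡c

-- Bounds for gb and b

∣p∪q∣≤∣p∣+∣q∣ : ∀ {n} (p q : Subset n) → ∣ p ∪ q ∣ ≤ ∣ p ∣ ℕ.+ ∣ q ∣
∣p∪q∣≤∣p∣+∣q∣ []          []          = ℕ.z≤n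
∣p∪q∣≤∣p∣+∣q∣ (true  ∷ p) (true  ∷ q) = s≤s (ℕ.≤-trans (∣p∪q∣≤∣p∣+∣q∣ p q) (ℕ.+-monoʳ-≤ ∣ p ∣ (ℕ.n≤1+n ∣ q ∣)))
∣p∪q∣≤∣p∣+∣q∣ (true  ∷ p) (false ∷ q) = s≤s (∣p∪q∣≤∣p∣+∣q∣ p q)
∣p∪q∣≤∣p∣+∣q∣ (false ∷ p) (true  ∷ q) = subst (suc ∣ p ∪ q ∣ ≤_) (sym (ℕ.+-suc ∣ p ∣ ∣ q ∣)) (s≤s (∣p∪q∣≤∣p∣+∣q∣ p q))
∣p∪q∣≤∣p∣+∣q∣ (false ∷ p) (false ∷ q) = ∣p∪q∣≤∣p∣+∣q∣ p q

module _ {n : ℕ} (X : CoherentConfiguration n) (𝔽 : FieldOn n) where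

  open FieldOn 𝔽

  -- The field `points` yields the base consisting of 0, 1 and c, and `triple` the generalized base
  -- whose only member is the set of these points.
  record IsTriple (c : Fin n) : Set₁ where
    field
      points  : ∀ Z → X ⊑ Z → (let open Colouring Z) → IsFixed 0# → IsFixed 1# → IsFixed c → IsComplete Z
      triple  : ∀ Z → X ⊑ Z → (let open Colouring Z) →
                (∀ {x x′} → colour x x ≡ colour x′ x′ → x ≡ 0# ⊎ x ≡ 1# ⊎ x ≡ c → x′ ≡ 0# ⊎ x′ ≡ 1# ⊎ x′ ≡ c) → IsComplete Z

  -- All that the argument takes from the cyclotomic scheme, expressed on `Fin n`.
  record IsProportional : Set₁ where
    field
      K            : Fin n → Set
      1∈K          : K 1#
      *-closed     : ∀ {x y} → K x → K y → K (x * y)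
      K-≢0         : ∀ {x} → K x → x ≢ 0#
      -1∉K         : ¬ K (- 1#)
      proportional : ∀ Z → X ⊑ Z → (let open Colouring Z) → ∀ {x y x′ y′} → colour x y ≡ colour x′ y′ →
                     ∃ λ κ → K κ × x′ + - y′ ≡ κ * (x + - y)

  module _ {c : Fin n} (isTriple : IsTriple c) where

    open IsTriple isTriple

    private
      B : Subset n
      B = ⁅ 0# ⁆ ∪ (⁅ 1# ⁆ ∪ ⁅ c ⁆)

      ∈B⁺ : ∀ {x} → x ≡ 0# ⊎ x ≡ 1# ⊎ x ≡ c → x ∈ B
      ∈B⁺ (inj₁ refl)        = p⊆p∪q _ (x∈⁅x⁆ 0#)
      ∈B⁺ (inj₂ (inj₁ refl)) = q⊆p∪q ⁅ 0# ⁆ _ (p⊆p∪q _ (x∈⁅x⁆ 1#))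
      ∈B⁺ (inj₂ (inj₂ refl)) = q⊆p∪q ⁅ 0# ⁆ _ (q⊆p∪q ⁅ 1# ⁆ _ (x∈⁅x⁆ c))

      ∈B⁻ : ∀ {x} → x ∈ B → x ≡ 0# ⊎ x ≡ 1# ⊎ x ≡ c
      ∈B⁻ x∈ with x∈p∪q⁻ ⁅ 0# ⁆ _ x∈
      ... | inj₁ q = inj₁ (x∈⁅y⁆⇒x≡y 0# q)
      ... | inj₂ q with x∈p∪q⁻ ⁅ 1# ⁆ _ q
      ...   | inj₁ q₁ = inj₂ (inj₁ (x∈⁅y⁆⇒x≡y 1# q₁))
      ...   | inj₂ q₂ = inj₂ (inj₂ (x∈⁅y⁆⇒x≡y c q₂))

      -- Only an inequality holds in general, because c = 1 when q = 3.
      ∣B∣≤3 : ∣ B ∣ ≤ 3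
      ∣B∣≤3 = begin
        ∣ B ∣                                         ≤⟨ ∣p∪q∣≤∣p∣+∣q∣ ⁅ 0# ⁆ _ ⟩
        ∣ ⁅ 0# ⁆ ∣ ℕ.+ ∣ ⁅ 1# ⁆ ∪ ⁅ c ⁆ ∣             ≤⟨ ℕ.+-monoʳ-≤ ∣ ⁅ 0# ⁆ ∣ (∣p∪q∣≤∣p∣+∣q∣ ⁅ 1# ⁆ ⁅ c ⁆) ⟩
        ∣ ⁅ 0# ⁆ ∣ ℕ.+ (∣ ⁅ 1# ⁆ ∣ ℕ.+ ∣ ⁅ c ⁆ ∣)  ≡⟨ cong₂ ℕ._+_ (∣⁅x⁆∣≡1 0#) (cong₂ ℕ._+_ (∣⁅x⁆∣≡1 1#) (∣⁅x⁆∣≡1 c)) ⟩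
        3  ∎
        where open ℕ.≤-Reasoning

      isBase : IsBase X B
      isBase = complete⇒isGeneralizedBase λ Z X⊑Z separated →
        points Z X⊑Z (fixed Z separated (inj₁ refl)) (fixed Z separated (inj₂ (inj₁ refl))) (fixed Z separated (inj₂ (inj₂ refl)))
        where
        fixed : ∀ Z → All (IsUnionOf (IsFiber Z)) _ → ∀ {x} → x ≡ 0# ⊎ x ≡ 1# ⊎ x ≡ c → Colouring.IsFixed Z x
        fixed Z separated {x} xΔ e = x∈⁅y⁆⇒x≡y x (Colouring.fiber-respects Z
          (All.lookup separated (∈-map⁺ ⁅_⁆ (∈-filter⁺ (_∈? B) (∈-allFin x) (∈B⁺ xΔ)))) e (x∈⁅x⁆ x))

      isGeneralizedBase : IsGeneralizedBase X (B ∷ [])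
      isGeneralizedBase = complete⇒isGeneralizedBase λ { Z X⊑Z (separated ∷ []) →
        triple Z X⊑Z λ e xΔ → ∈B⁻ (Colouring.fiber-respects Z separated e (∈B⁺ xΔ)) }

    triple-bounds : gb X ≤ 1 × b X ≤ 3
    triple-bounds =
        proj₂ (gb-isMinimum X) (B ∷ [] , [] ∷ [] , refl , isGeneralizedBase)
      , ℕ.≤-trans (proj₂ (b-isMinimum X) (B , refl , isBase)) ∣B∣≤3

proportional⇒triple : ∀ {n} {X : CoherentConfiguration n} {𝔽 : FieldOn n} → IsProportional X 𝔽 → ∃ (IsTriple X 𝔽)
proportional⇒triple {zero}  {𝔽 = 𝔽} _ = case FieldOn.0# 𝔽 of λ ()
proportional⇒triple {suc m} {X} {𝔽} P = c , record
  { points = λ Z X⊑Z → threePoints⇒complete Z (proportional Z X⊑Z)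
  ; triple = λ Z X⊑Z → stable⇒complete Z (proportional Z X⊑Z)
  }
  where
  open IsProportional P
  open Base 𝔽 K 1∈K *-closed K-≢0 -1∉K

-- Transport of the field to its set of indices

module _ {c ℓ : Level} (F : FiniteField c ℓ) where

  open FiniteField F using (commutativeRing; 0≉1; invertible; size; index; element; enumeration)
  private
    module R = CommutativeRing commutativeRing

    element-index : ∀ x → element (index x) R.≈ x
    element-index x = Inverse.strictlyInverseʳ enumeration x

    index-element : ∀ i → index (element i) ≡ i
    index-element i = Inverse.strictlyInverseˡ enumeration i

    index-cong : ∀ {x y} → x R.≈ y → index x ≡ index y
    index-cong = Inverse.to-cong enumeration

    element-injective : ∀ {i j} → element i R.≈ element j → i ≡ j
    element-injective {i} {j} e = trans (sym (index-element i)) (trans (index-cong e) (index-element j))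

    rawRing : RawRing _ _
    rawRing = record
      { Carrier = Fin size
      ; _≈_     = _≡_
      ; _+_     = λ x y → index (element x R.+ element y)
      ; _*_     = λ x y → index (element x R.* element y)
      ; -_      = λ x → index (R.- element x)
      ; 0#      = index R.0#
      ; 1#      = index R.1#
      }

    isRingMonomorphism : IsRingMonomorphism rawRing R.rawRing element
    isRingMonomorphism = record
      { isRingHomomorphism = record
        { isSemiringHomomorphism = record
          { isNearSemiringHomomorphism = record
            { +-isMonoidHomomorphism = record
              { isMagmaHomomorphism = record
                { isRelHomomorphism = record { cong = λ { refl → R.refl } }
                ; homo = λ _ _ → element-index _ }
              ; ε-homo = element-index _ }
            ; *-homo = λ _ _ → element-index _ }
          ; 1#-homo = element-index _ }
        ; -‿homo = λ _ → element-index _ }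
      ; injective = element-injective
      }

  fieldOn : FieldOn size
  fieldOn = record
    { isCommutativeRing = RingMonomorphism.isCommutativeRing isRingMonomorphism R.isCommutativeRing
    ; 0≢1        = λ e → 0≉1 (R.trans (R.sym (element-index R.0#)) (R.trans (R.reflexive (cong element e)) (element-index R.1#)))
    ; invertible = λ {x} x≢0 →
        let y , xy≈1 = invertible {element x} (λ e → x≢0 (trans (sym (index-element x)) (index-cong e)))
        in index y , index-cong (R.trans (R.*-congˡ (element-index y)) xy≈1)
    }

  module _ (K : MultiplicativeSubgroup F) where

    open MultiplicativeSubgroup K using (members; nonzero; 1∈K; *-closed)
    private
      module 𝔽 = FieldOn fieldOn
      module 𝔽R = CommutativeRing 𝔽.commutativeRing
      module G = PermutationGroup (affineGroup F K)
      X = cyclotomicScheme F K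

      affine≡ : ∀ a t x → affine F K a t x ≡ a 𝔽.* x 𝔽.+ t
      affine≡ a t x = index-cong (R.+-congʳ (R.sym (element-index _)))

      ∈members : ∀ {x} → x ∈ members → index (element x) ∈ members
      ∈members {x} = subst (_∈ members) (sym (index-element x))

      differences : ∀ {x y x′ y′} → G.SameOrbit x y x′ y′ → ∃ λ κ → κ ∈ members × x′ 𝔽.+ 𝔽.- y′ ≡ κ 𝔽.* (x 𝔽.+ 𝔽.- y)
      differences {x} {y} (π , (a , t , a∈ , π≡) , refl , refl) = a , a∈ , (begin
        (π ⟨$⟩ʳ x) 𝔽.+ 𝔽.- (π ⟨$⟩ʳ y)  ≡⟨ cong₂ (λ u v → u 𝔽.+ 𝔽.- v) (trans (π≡ x) (affine≡ a t x)) (trans (π≡ y) (affine≡ a t y)) ⟩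
        (a 𝔽.* x 𝔽.+ t) 𝔽.+ 𝔽.- (a 𝔽.* y 𝔽.+ t)  ≡⟨ solve 4 (λ a t x y → (a :* x :+ t) :- (a :* y :+ t) := a :* (x :- y)) refl a t x y ⟩
        a 𝔽.* (x 𝔽.+ 𝔽.- y)  ∎)
        where
        open ≡-Reasoning
        open IntegerSolver 𝔽.commutativeRing using (solve; _:=_; _:+_; _:*_; _:-_)

      orbit⁺ : ∀ {α β α′ β′} → G.SameOrbit α β α′ β′ → G.orbit α β ⟨ α′ , β′ ⟩
      orbit⁺ {α} {β} = ∈-relationOf⁺ (G.sameOrbit? α β)

      orbit⁻ : ∀ {α β α′ β′} → G.orbit α β ⟨ α′ , β′ ⟩ → G.SameOrbit α β α′ β′
      orbit⁻ {α} {β} = ∈-relationOf⁻ (G.sameOrbit? α β)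

      orbit-self : ∀ {α β} → G.orbit α β ⟨ α , β ⟩
      orbit-self = orbit⁺ (Perm.id , G.id-closed , refl , refl)

      -- The orbit of (x , y) is a relation of the fission, so it contains every pair of the same
      -- colour as (x , y); and affine maps scale differences by elements of the subgroup.
      proportional : ∀ Z → X ⊑ Z → (let open Colouring Z) → ∀ {x y x′ y′} → colour x y ≡ colour x′ y′ →
                     ∃ λ κ → κ ∈ members × x′ 𝔽.+ 𝔽.- y′ ≡ κ 𝔽.* (x 𝔽.+ 𝔽.- y)
      proportional Z X⊑Z {x} {y} e = differences (orbit⁻ (Colouring.relation-respects Z
        (X⊑Z (pointwise⇒isUnionOf λ q → G.orbit x y , (x , y , refl) , q , λ q → q)) e orbit-self))

      -- With - 1 in K, the map z ↦ 1 - z exchanges 0 and 1, so the orbit of (0 , 1) is symmetric.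
      -1∉members : IsAntisymmetric X → ¬ (𝔽.- 𝔽.1# ∈ members)
      -1∉members antisymmetric -1∈ = 𝔽.0≢1 (proj₁ (∈-1⁻ (antisymmetric (𝔽.0# , 𝔽.1# , refl) symmetric orbit-self)))
        where
        open IntegerSolver 𝔽.commutativeRing using (solve; _:=_; _:+_; _:*_; :-_; :0; :1)
        flip : Fin size → Fin size
        flip z = 𝔽.- 𝔽.1# 𝔽.* z 𝔽.+ 𝔽.1#
        flip-permutation : Permutation′ size
        flip-permutation = involution flip (solve 1 (λ z → (:- :1) :* ((:- :1) :* z :+ :1) :+ :1 := z) refl)
        flip-member : G.Member flip-permutation
        flip-member = 𝔽.- 𝔽.1# , 𝔽.1# , -1∈ , λ z → sym (affine≡ _ _ z)
        swap : ∀ {α β} → G.SameOrbit 𝔽.0# 𝔽.1# α β → G.SameOrbit 𝔽.0# 𝔽.1# β α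
        swap (π , π∈ , e₀ , e₁) = flip-permutation ∘ₚ π , G.∘-closed {flip-permutation} {π} flip-member π∈
          , trans (cong (π ⟨$⟩ʳ_) (solve 0 ((:- :1) :* :0 :+ :1 := :1) refl)) e₁
          , trans (cong (π ⟨$⟩ʳ_) (solve 0 ((:- :1) :* :1 :+ :1 := :0) refl)) e₀
        symmetric : G.orbit 𝔽.0# 𝔽.1# ≡ G.orbit 𝔽.0# 𝔽.1# *ʳ
        symmetric = relation-ext (λ q → ∈-*ʳ⁺ {s = G.orbit 𝔽.0# 𝔽.1#} (orbit⁺ (swap (orbit⁻ q))))
                                 (λ q → orbit⁺ (swap (orbit⁻ (∈-*ʳ⁻ {s = G.orbit 𝔽.0# 𝔽.1#} q))))

    cyclotomic-proportional : IsAntisymmetric X → IsProportional X fieldOn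
    cyclotomic-proportional antisymmetric = record
      { K            = _∈ members
      ; 1∈K          = 1∈K
      ; *-closed     = λ x∈ y∈ → *-closed (∈members x∈) (∈members y∈)
      ; K-≢0         = λ {x} x∈ e → nonzero (∈members x∈) (R.trans (R.reflexive (cong element e)) (element-index R.0#))
      ; -1∉K         = -1∉members antisymmetric
      ; proportional = proportional
      }

theorem3p2 : {c ℓ : Level} (F : FiniteField c ℓ) (K : MultiplicativeSubgroup F) →
    IsAntisymmetric (cyclotomicScheme F K) →
    gb (cyclotomicScheme F K) ≤ 1 × b (cyclotomicScheme F K) ≤ 3
theorem3p2 F K antisymmetric =
  triple-bounds (cyclotomicScheme F K) (fieldOn F) (proj₂ (proportional⇒triple (cyclotomic-proportional F K antisymmetric)))
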